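{- Let $R$ be a set and let $\pi$ be an $R$-deco polygon. The element $\mathrm B(\pi)$ associated to $\pi$ is a $0$-cocycle in the bar construction $\mathrm B(\mathcal P_\bullet(R))$.
   Context: **Polygons.** An $R$-deco polygon is an oriented convex polygon with $N\ge2$ sides decorated by elements of $R$, with a distinguished root side. The orientation gives a linear order of sides with root side last; write $[a_1,\dots,a_{n+1}]$ ($a_{n+1}$ on the root). Weight $\chi=n$ = number of non-root sides. $v_0$ is the vertex between root and first side (first vertex), $v_k$ the vertex between the $k$-th and $(k+1)$-st side. $\mathcal P=\mathcal P_\bullet(R)$ is the exterior $\mathbb Q$-algebra (with unit) on the vector space with basis the $R$-deco polygons. An arrow goes from a vertex $v_k$ to the interior of a side $a_l$ (arrows with the same vertex and side are identified); it is trivial if $v_k$ is an endpoint of the side, forward if $l>k$, backward otherwise. For a non-trivial forward arrow $\alpha:v_k\to a_l$ put $\pi_\alpha^{rt}=[a_1,\dots,a_k,a_l,\dots,a_{n+1}]$, $\pi_\alpha^{co}=[a_{k+1},\dots,a_{l-1},a_l]$, $\mathrm{sgn}(\alpha)=1$; for a non-trivial backward arrow ($l<k$) put $\pi_\alpha^{rt}=[a_1,\dots,a_l,a_{k+1},\dots,a_{n+1}]$, $\pi_\alpha^{co}=[a_k,\dots,a_{l+1},a_l]$, $\mathrm{sgn}(\alpha)=(-1)^{k-l}$. Then $\partial\pi=\sum_\alpha\mathrm{sgn}(\alpha)\pi_\alpha^{rt}\wedge\pi_\alpha^{co}$ over non-trivial arrows, extended as a derivation with sign $(-1)^{\deg}$,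 $\deg$ = exterior degree; $(\mathcal P,\partial)$ is an augmented DGA. **Dissections.** Two arrows do not intersect if (for suitable endpoints on the sides) they have no point in common except possibly the starting point. An $n$-fold dissection $D$ of $\pi$ is the set of $n$ regions cut out by $n-1$ distinct, pairwise non-intersecting, non-trivial arrows. The root region is the one containing the first vertex and part of the root side. The dual tree $\tau(D)$ has the regions as vertices, the arrows as edges (joining the two adjacent regions), and the root region as root; it defines a partial order on the regions (root region first, a region precedes those further from the root along the tree). Each region gives an $R$-deco polygon by contracting all arrows in its boundary: for the root region, root side and orientation are those of $\pi$; for any other region, let $\alpha$ be the unique boundary arrow closest to the root (the edge of $\tau(D)$ leading towards the root); the root side is the one where $\alpha$ ends, and the orientation is that of $\pi$ if $\alpha$ is forward and the opposite one if $\alpha$ is backward. Denote this polygon $\pi^{co}_{D,\alpha}$. The sign of $D$ is $\mathrm{sgn}(D)=\prod_{\alpha\text{ backward arrow of }D}(-1)^{\chi(\pi^{co}_{D,\alpha})}$. **The element $\mathrm B(\pi)$.** It is the sum over $n\ge1$ of its components in $\mathcal P^{\otimes n}$ given by $\sum_D\mathrm{sgn}(D)\sum_\lambda[\pi_D^{\lambda(1)}|\cdots|\pi_D^{\lambda(n)}]$, over all $n$-fold dissections $D$ of $\pi$ and all linear orders $\lambda$ of the associated polygons $\pi_D^i$ compatible with the partial order of $\tau(D)$ (for $n=1$ this is $[\pi]$). **Bar construction.** $\mathrm B(\mathcal P)$ is the tensor coalgebra on the augmentation ideal of $\mathcal P$, with words $[x_1|\cdots|x_N]$ placed in degree $\sum(\deg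 x_i-1)$, and with differential $D_1+D_2$ of degree $+1$, where $$D_1[x_1|\cdots|x_N]=-\sum_{j=1}^{N-1}(-1)^{\sum_{i\le j}(\deg x_i-1)}[x_1|\cdots|x_j\wedge x_{j+1}|\cdots|x_N],$$ $$D_2[x_1|\cdots|x_N]=\sum_{j=1}^{N}(-1)^{\sum_{i<j}(\deg x_i-1)}[x_1|\cdots|\partial x_j|\cdots|x_N],$$ with $\deg$ the exterior degree. A $0$-cocycle is an element of degree $0$ killed by $D_1+D_2$. -}

module Defs where

open import Data.Empty using (⊥; ⊥-elim; ⊥-elim-irr)
open import Data.Fin using (Fin; zero; suc; toℕ; fromℕ<)
import Data.Fin.Properties as Fin
open import Data.List
  using (List; []; _∷_; _++_; map; concatMap; filter; foldr; length; lookup;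
         take; drop; reverse; allFin; cartesianProduct)
open import Data.List.Membership.Propositional using (_∈_)
open import Data.List.Membership.Propositional.Properties using (∈-allFin; ∈-filter⁺)
open import Data.List.Properties
  using (length-++; length-take; length-drop; length-reverse; length-map)
open import Data.List.Relation.Unary.All as All using (All; []; _∷_)
open import Data.List.Relation.Unary.AllPairs using (AllPairs; []; _∷_; allPairs?)
open import Data.List.Relation.Unary.Any using (here; there)
open import Data.Maybe using (Maybe; nothing; just)
open import Data.Nat
  using (ℕ; zero; suc; _+_; _*_; _∸_; _⊓_; _⊔_; _≤_; _<_; z≤n; s≤s; _≤?_; _<?_)
import Data.Nat.Properties as ℕ
open import Data.Product using (∃; _×_; _,_; proj₁; proj₂; map₁)
open import Data.Rational as ℚ using (ℚ; 0ℚ; 1ℚ)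
open import Data.Sum using (_⊎_; inj₁; inj₂)
open import Data.Unit using (⊤; tt)
open import Data.Vec as Vec using (Vec; []; _∷_)
open import Function using (_∘_)
open import Relation.Binary.PropositionalEquality
  using (_≡_; _≢_; refl; sym; trans; cong; cong₂; subst; subst₂)
open import Relation.Binary using (tri<; tri≈; tri>)
open import Relation.Nullary using (¬_; Dec; yes; no; contradiction)
open import Relation.Nullary.Decidable using (_×-dec_; _⊎-dec_; _→-dec_; ¬?; map′)

-- Formal linear combinations, not reduced: equality is Quotient below.

Lin : Set → Set
Lin X = List (ℚ × X)

scale : {X : Set} → ℚ → Lin X → Lin X
scale c = map (map₁ (c ℚ.*_))

linear : {X Y : Set} → (X → Lin Y) → Lin X → Lin Y
linear f = concatMap (λ (c , x) → scale c (f x))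

-- Equality in the ℚ-vector space with generators X and relations
-- u = v for all u ∼ v.

data Quotient {X : Set} (_∼_ : Lin X → Lin X → Set) : Lin X → Lin X → Set where
  relation   : ∀ {u v} → u ∼ v → Quotient _∼_ u v
  ≈-refl     : ∀ {u} → Quotient _∼_ u u
  ≈-sym      : ∀ {u v} → Quotient _∼_ u v → Quotient _∼_ v u
  ≈-trans    : ∀ {u v w} → Quotient _∼_ u v → Quotient _∼_ v w → Quotient _∼_ u w
  ++-cong    : ∀ {u u′ v v′} → Quotient _∼_ u u′ → Quotient _∼_ v v′ →
               Quotient _∼_ (u ++ v) (u′ ++ v′)
  scale-cong : ∀ c {u v} → Quotient _∼_ u v → Quotient _∼_ (scale c u) (scale c v)
  ++-comm    : ∀ u v → Quotient _∼_ (u ++ v) (v ++ u)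
  merge      : ∀ a b x → Quotient _∼_ ((a , x) ∷ (b , x) ∷ []) ((a ℚ.+ b , x) ∷ [])
  vanish     : ∀ x → Quotient _∼_ ((0ℚ , x) ∷ []) []

sign : ℕ → ℚ
sign zero    = 1ℚ
sign (suc n) = ℚ.- sign n

-- The labels [a₁, …, aₙ₊₁] in the order given by the orientation, the
-- label of the root side last.

record Polygon (R : Set) : Set where
  constructor polygon
  field
    labels     : List R
    .two-sides : 2 ≤ length labels

open Polygon public

χ : {R : Set} → Polygon R → ℕ
χ π = length (labels π) ∸ 1

-- Sides are numbered from 0: in a polygon with N sides, side i : Fin N
-- carries the label a_{i+1} and runs from vertex v_i to vertex v_{i+1},
-- except that the root side N-1 runs from v_{N-1} to v_0.

data Endpoint {N : ℕ} (k i : Fin N) : Set where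
  first  : toℕ k ≡ toℕ i → Endpoint k i
  second : toℕ k ≡ suc (toℕ i) → Endpoint k i
  closed : toℕ k ≡ 0 → suc (toℕ i) ≡ N → Endpoint k i

endpoint? : ∀ {N} (k i : Fin N) → Dec (Endpoint k i)
endpoint? {N} k i =
  map′ (λ { (inj₁ p) → first p ; (inj₂ (inj₁ p)) → second p ; (inj₂ (inj₂ (p , q))) → closed p q })
       (λ { (first p) → inj₁ p ; (second p) → inj₂ (inj₁ p) ; (closed p q) → inj₂ (inj₂ (p , q)) })
       ((toℕ k ℕ.≟ toℕ i) ⊎-dec (toℕ k ℕ.≟ suc (toℕ i)) ⊎-dec
        ((toℕ k ℕ.≟ 0) ×-dec (suc (toℕ i) ℕ.≟ N)))

record Arrow (N : ℕ) : Set where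
  constructor arrow
  field
    source      : Fin N
    target      : Fin N
    .nontrivial : ¬ Endpoint source target

open Arrow public

_≟ᴬ_ : ∀ {N} (α β : Arrow N) → Dec (α ≡ β)
arrow k i _ ≟ᴬ arrow k′ i′ _ =
  map′ (λ { (refl , refl) → refl }) (λ { refl → refl , refl }) ((k Fin.≟ k′) ×-dec (i Fin.≟ i′))

nontrivialArrow : ∀ {N} → Fin N × Fin N → List (Arrow N)
nontrivialArrow (k , i) with endpoint? k i
... | yes _ = []
... | no nt = arrow k i nt ∷ []

arrows : (N : ℕ) → List (Arrow N)
arrows N = concatMap nontrivialArrow (cartesianProduct (allFin N) (allFin N))

-- In the 1-based numbering of sides this is l > k with l = i + 1.

Forward : ∀ {N} → Arrow N → Set
Forward α = toℕ (source α) ≤ toℕ (target α)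

forward? : ∀ {N} (α : Arrow N) → Dec (Forward α)
forward? α = toℕ (source α) ≤? toℕ (target α)

ifForward : ∀ {N} {A : Set} → Arrow N → A → A → A
ifForward α x y with forward? α
... | yes _ = x
... | no  _ = y

module _ {R : Set} where

  rtLabels : (ls : List R) → Arrow (length ls) → List R
  rtLabels ls α = ifForward α
    (take (toℕ (source α)) ls ++ drop (toℕ (target α)) ls)
    (take (suc (toℕ (target α))) ls ++ drop (toℕ (source α)) ls)

  coLabels : (ls : List R) → Arrow (length ls) → List R
  coLabels ls α = ifForward α
    (drop (toℕ (source α)) (take (suc (toℕ (target α))) ls))
    (reverse (drop (toℕ (target α)) (take (toℕ (source α)) ls)))

sgnArrow : ∀ {N} → Arrow N → ℚ
sgnArrow α = ifForward α 1ℚ (sign (toℕ (source α) ∸ suc (toℕ (target α))))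

nontrivial′ : ∀ {N} (α : Arrow N) → ¬ Endpoint (source α) (target α)
nontrivial′ (arrow _ _ nt) e = ⊥-elim-irr (nt e)

ifForward-elim : ∀ {N} {A : Set} (P : A → Set) (α : Arrow N) {x y : A} →
                 (Forward α → P x) → (¬ Forward α → P y) → P (ifForward α x y)
ifForward-elim P α f g with forward? α
... | yes p = f p
... | no ¬p = g ¬p

∸-pos : ∀ {m n} d → d + m ≤ n → d ≤ n ∸ m
∸-pos {m} {n} d p = subst (_≤ n ∸ m) (ℕ.m+n∸n≡m d m) (ℕ.∸-monoˡ-≤ m p)

suc< : ∀ {N} (α : Arrow N) → Forward α → toℕ (source α) < toℕ (target α)
suc< α f = ℕ.≤∧≢⇒< f (nontrivial′ α ∘ first)

suc<′ : ∀ {N} (α : Arrow N) → ¬ Forward α → suc (toℕ (target α)) < toℕ (source α)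
suc<′ α f = ℕ.≤∧≢⇒< (ℕ.≰⇒> f) (nontrivial′ α ∘ second ∘ sym)

module _ {R : Set} where

  length-cut : ∀ (ls : List R) a b → a ≤ length ls →
               length (take a ls ++ drop b ls) ≡ a + (length ls ∸ b)
  length-cut ls a b a≤ = trans (length-++ (take a ls))
    (cong₂ _+_ (trans (length-take a ls) (ℕ.m≤n⇒m⊓n≡m a≤)) (length-drop b ls))

  length-mid : ∀ (ls : List R) a b → b ≤ length ls → length (drop a (take b ls)) ≡ b ∸ a
  length-mid ls a b b≤ = trans (length-drop a (take b ls))
    (cong (_∸ a) (trans (length-take b ls) (ℕ.m≤n⇒m⊓n≡m b≤)))

  two-rt : (ls : List R) (α : Arrow (length ls)) → 2 ≤ length (rtLabels ls α)
  two-rt ls α with forward? α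
  ... | yes f = subst (2 ≤_) (sym (length-cut ls k i (ℕ.<⇒≤ (Fin.toℕ<n (source α))))) bound
    where
    k = toℕ (source α)
    i = toℕ (target α)
    bound : 2 ≤ k + (length ls ∸ i)
    bound with k in eq
    ... | suc m = ℕ.≤-trans (ℕ.+-mono-≤ (s≤s (z≤n {m})) (ℕ.m<n⇒0<n∸m (Fin.toℕ<n (target α))))
                            ℕ.≤-refl
    ... | zero  = ∸-pos 2 (ℕ.≤∧≢⇒< (Fin.toℕ<n (target α)) (nontrivial′ α ∘ closed eq))
  ... | no f = subst (2 ≤_) (sym (length-cut ls (suc i) k (Fin.toℕ<n (target α))))
                 (s≤s (ℕ.≤-trans (ℕ.m<n⇒0<n∸m (Fin.toℕ<n (source α))) (ℕ.m≤n+m _ i)))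
    where
    k = toℕ (source α)
    i = toℕ (target α)

  two-co : (ls : List R) (α : Arrow (length ls)) → 2 ≤ length (coLabels ls α)
  two-co ls α with forward? α
  ... | yes f = subst (2 ≤_) (sym (length-mid ls k (suc i) (Fin.toℕ<n (target α))))
                  (∸-pos 2 (s≤s (suc< α f)))
    where
    k = toℕ (source α)
    i = toℕ (target α)
  ... | no f = subst (2 ≤_)
                 (sym (trans (length-reverse (drop i (take k ls)))
                             (length-mid ls i k (ℕ.<⇒≤ (Fin.toℕ<n (source α))))))
                 (∸-pos 2 (suc<′ α f))
    where
    k = toℕ (source α)
    i = toℕ (target α)

module _ {R : Set} where

  π-rt π-co : (π : Polygon R) → Arrow (length (labels π)) → Polygon R
  π-rt π α = polygon (rtLabels (labels π) α) (two-rt (labels π) α)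
  π-co π α = polygon (coLabels (labels π) α) (two-co (labels π) α)

-- Λ R d is the component of exterior degree d; the monomial
-- π₁ ∷ … ∷ π_d ∷ [] stands for π₁ ∧ … ∧ π_d.

Λ : Set → ℕ → Set
Λ R d = Lin (Vec (Polygon R) d)

module _ {R : Set} where

  -- On a space with basis the polygons, v ∧ v = 0 for all v amounts to
  -- these relations between basis vectors.

  data Alternating : ∀ {d} → Λ R d → Λ R d → Set where
    square : ∀ {p q} (u : Vec (Polygon R) p) x (v : Vec (Polygon R) q) →
             Alternating ((1ℚ , u Vec.++ x ∷ x ∷ v) ∷ []) []
    swap   : ∀ {p q} (u : Vec (Polygon R) p) x y (v : Vec (Polygon R) q) →
             Alternating ((1ℚ , u Vec.++ x ∷ y ∷ v) ∷ (1ℚ , u Vec.++ y ∷ x ∷ v) ∷ []) []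

  infix 4 _≈Λ_

  _≈Λ_ : ∀ {d} → Λ R d → Λ R d → Set
  _≈Λ_ = Quotient Alternating

  infixr 6 _∧_

  _∧_ : ∀ {p q} → Λ R p → Λ R q → Λ R (p + q)
  x ∧ y = linear (λ u → linear (λ v → (1ℚ , u Vec.++ v) ∷ []) y) x

  monomial : ∀ {d} → Vec (Polygon R) d → Λ R d
  monomial u = (1ℚ , u) ∷ []

  ∂-polygon : Polygon R → Λ R 2
  ∂-polygon π = map (λ α → sgnArrow α , π-rt π α ∷ π-co π α ∷ []) (arrows (length (labels π)))

  ∂-monomial : ∀ {d} → Vec (Polygon R) d → Λ R (suc d)
  ∂-monomial []      = []
  ∂-monomial (π ∷ u) =
    (∂-polygon π ∧ monomial u) ++ scale (sign 1) (monomial (π ∷ []) ∧ ∂-monomial u)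

  ∂ : ∀ {d} → Λ R d → Λ R (suc d)
  ∂ = linear ∂-monomial

-- A homogeneous element of the augmentation ideal ⨁_{d ≥ 1} Λ R d; the field
-- deg-1 is its contribution deg x - 1 to the degree of a bar word.

record Letter (R : Set) : Set where
  constructor letter
  field
    deg-1   : ℕ
    element : Λ R (suc deg-1)

open Letter public

Bar : Set → Set
Bar R = Lin (List (Letter R))

module _ {R : Set} where

  [_∣_∣_] : List (Letter R) → ∀ {d} → Λ R (suc d) → List (Letter R) → Bar R
  [ u ∣ x ∣ v ] = (1ℚ , u ++ letter _ x ∷ v) ∷ []

  -- The relations of the tensor product over ℚ.

  data Multilinear : Bar R → Bar R → Set where
    resp  : ∀ u v {d} {x y : Λ R (suc d)} → x ≈Λ y → Multilinear [ u ∣ x ∣ v ] [ u ∣ y ∣ v ]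
    sum   : ∀ u v {d} (x y : Λ R (suc d)) →
            Multilinear [ u ∣ x ++ y ∣ v ] ([ u ∣ x ∣ v ] ++ [ u ∣ y ∣ v ])
    mult  : ∀ u v {d} c (x : Λ R (suc d)) →
            Multilinear [ u ∣ scale c x ∣ v ] (scale c [ u ∣ x ∣ v ])

  infix 4 _≈ᴮ_

  _≈ᴮ_ : Bar R → Bar R → Set
  _≈ᴮ_ = Quotient Multilinear

  degree : List (Letter R) → ℕ
  degree []      = 0
  degree (x ∷ w) = deg-1 x + degree w

  prepend : Letter R → Bar R → Bar R
  prepend x = map (λ (c , w) → c , x ∷ w)

  -- The argument e is the sum of deg xᵢ - 1 over the letters xᵢ to the
  -- left of the word treated.

  D₁-word : ℕ → List (Letter R) → Bar R
  D₁-word e []          = []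
  D₁-word e (x ∷ [])    = []
  D₁-word e (x ∷ y ∷ w) =
    (ℚ.- sign (e + deg-1 x) , letter _ (element x ∧ element y) ∷ w) ∷
    prepend x (D₁-word (e + deg-1 x) (y ∷ w))

  D₂-word : ℕ → List (Letter R) → Bar R
  D₂-word e []      = []
  D₂-word e (x ∷ w) =
    (sign e , letter _ (∂ (element x)) ∷ w) ∷ prepend x (D₂-word (e + deg-1 x) w)

  D₁ D₂ : Bar R → Bar R
  D₁ = linear (D₁-word 0)
  D₂ = linear (D₂-word 0)

  HasDegree : ℕ → Bar R → Set
  HasDegree m b = ∃ λ b′ → b ≈ᴮ b′ × All (λ (_ , w) → degree w ≡ m) b′

  IsCocycle : ℕ → Bar R → Set
  IsCocycle m b = HasDegree m b × D₁ b ++ D₂ b ≈ᴮ []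

-- Suitable endpoints are fixed as follows.  Divide every side into N equal
-- parts and number the division points along the boundary from v_0 = 0, so
-- that v_k is point k N and side i consists of the points from i N to
-- (i + 1) N.  The arrow from v_k to side i ends at the division point of
-- side i whose offset is (i - k) mod N.  Then non-trivial arrows end strictly
-- inside sides, at different points, and two arrows ending on the same side
-- do not meet; the chosen offsets do not matter for arrows which end on
-- different sides.

module _ {N : ℕ} where

  offset : Arrow N → ℕ
  offset α = ifForward α (toℕ (target α) ∸ toℕ (source α)) ((N + toℕ (target α)) ∸ toℕ (source α))

  sourcePoint targetPoint lo hi : Arrow N → ℕ
  sourcePoint α = toℕ (source α) * N
  targetPoint α = toℕ (target α) * N + offset α
  lo α = sourcePoint α ⊓ targetPoint α
  hi α = sourcePoint α ⊔ targetPoint α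

  -- Two chords of a convex polygon meet in an inner point iff their ends
  -- interlace strictly along the boundary.

  Intersect : Arrow N → Arrow N → Set
  Intersect α β = (lo α < lo β × lo β < hi α × hi α < hi β)
                ⊎ (lo β < lo α × lo α < hi β × hi β < hi α)

  intersect? : ∀ α β → Dec (Intersect α β)
  intersect? α β = ((lo α <? lo β) ×-dec (lo β <? hi α) ×-dec (hi α <? hi β))
             ⊎-dec ((lo β <? lo α) ×-dec (lo α <? hi β) ×-dec (hi β <? hi α))

  Compatible : Arrow N → Arrow N → Set
  Compatible α β = α ≢ β × ¬ Intersect α β

  compatible? : ∀ α β → Dec (Compatible α β)
  compatible? α β = ¬? (α ≟ᴬ β) ×-dec ¬? (intersect? α β)

record Dissection (N : ℕ) : Set where
  constructor dissection
  field
    cuts        : List (Arrow N)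
    .compatible : AllPairs Compatible cuts

open Dissection public

sublists : {A : Set} → List A → List (List A)
sublists []       = [] ∷ []
sublists (x ∷ xs) = map (x ∷_) (sublists xs) ++ sublists xs

toDissection : ∀ {N} → List (Arrow N) → List (Dissection N)
toDissection αs with allPairs? compatible? αs
... | yes c = dissection αs c ∷ []
... | no _  = []

dissections : (N : ℕ) → List (Dissection N)
dissections N = concatMap toDissection (sublists (arrows N))

-- A region is denoted by the edge of the dual tree leading from it towards
-- the root: just α is the region on the far side of α, and nothing is the
-- root region.  As the part cut off by α does not contain the last piece of
-- the root side, it meets the boundary in the points from lo α to hi α,
-- both for forward and for backward arrows.

Region : ℕ → Set
Region N = Maybe (Arrow N)

regions : ∀ {N} → Dissection N → List (Region N)
regions D = nothing ∷ map just (cuts D)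

module _ {N : ℕ} where

  -- The path in the dual tree from the root to a region crosses exactly the
  -- arrows which separate this region from the root.  Hence the region of α
  -- lies on the path to the region of β iff α cuts off the region of β, that
  -- is, iff the part cut off by β is contained in the part cut off by α.

  _≺_ : Region N → Region N → Set
  _      ≺ nothing = ⊥
  nothing ≺ just β = ⊤
  just α ≺ just β  = α ≢ β × lo α ≤ lo β × hi β ≤ hi α

  _≺?_ : ∀ r s → Dec (r ≺ s)
  nothing ≺? nothing = no λ ()
  just _  ≺? nothing = no λ ()
  nothing ≺? just β  = yes tt
  just α  ≺? just β  = ¬? (α ≟ᴬ β) ×-dec (lo α ≤? lo β) ×-dec (hi β ≤? hi α)

  -- Whether the boundary piece between the division points p and p + 1
  -- lies in the part of the polygon beyond the arrow towards the root.

  Beyond : Region N → ℕ → Set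
  Beyond nothing  p = ⊤
  Beyond (just α) p = lo α ≤ p × p < hi α

  beyond? : ∀ r p → Dec (Beyond r p)
  beyond? nothing  p = yes tt
  beyond? (just α) p = (lo α ≤? p) ×-dec (p <? hi α)

  InRegion : List (Arrow N) → Region N → ℕ → Set
  InRegion D r p = Beyond r p × All (λ β → r ≺ just β → ¬ Beyond (just β) p) D

  inRegion? : ∀ D r p → Dec (InRegion D r p)
  inRegion? D r p =
    beyond? r p ×-dec All.all? (λ β → (r ≺? just β) →-dec ¬? (beyond? (just β) p)) D

  -- A part of side i belongs to the boundary of the region.

  Meets : List (Arrow N) → Region N → Fin N → Set
  Meets D r i = ∃ λ (o : Fin N) → InRegion D r (toℕ i * N + toℕ o)

  meets? : ∀ D r i → Dec (Meets D r i)
  meets? D r i = Fin.any? (λ o → inRegion? D r (toℕ i * N + toℕ o))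

  -- The sides of the polygon of a region, in the order given by its own
  -- orientation and with its root side last.  The side where α ends is the
  -- last one met by the region of a forward arrow α and the first one met by
  -- the region of a backward arrow α, where the orientation is reversed.

  orient : Region N → List (Fin N) → List (Fin N)
  orient nothing  is = is
  orient (just α) is = ifForward α is (reverse is)

  regionSides : List (Arrow N) → Region N → List (Fin N)
  regionSides D r = orient r (filter (meets? D r) (allFin N))

-- Every region of a dissection has at least two sides: apart from the root
-- side there is the side next to the vertex where its arrow starts or, if
-- that is cut off by arrows starting at the same vertex, the side where the
-- outermost of these ends.

module _ {A : Set} where

  two-elements : ∀ {x y : A} {xs} → x ≢ y → x ∈ xs → y ∈ xs → 2 ≤ length xs
  two-elements x≢y (here refl) (here refl) = contradiction refl x≢y
  two-elements x≢y (here refl) (there {xs = _ ∷ _} _) = s≤s (s≤s z≤n)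
  two-elements x≢y (there {xs = _ ∷ _} _) (here refl) = s≤s (s≤s z≤n)
  two-elements x≢y (there p) (there q) = ℕ.m≤n⇒m≤1+n (two-elements x≢y p q)

  pairwise : ∀ {S : A → A → Set} → (∀ {x y} → S x y → S y x) →
             ∀ {xs} → AllPairs S xs → ∀ {x y} → x ∈ xs → y ∈ xs → x ≢ y → S x y
  pairwise symS (ss ∷ sss) (here refl) (here refl) x≢y = contradiction refl x≢y
  pairwise symS (ss ∷ sss) (here refl) (there q)   x≢y = All.lookup ss q
  pairwise symS (ss ∷ sss) (there p)   (here refl) x≢y = symS (All.lookup ss p)
  pairwise symS (ss ∷ sss) (there p)   (there q)   x≢y = pairwise symS sss p q x≢y

  maximal : ∀ {P : A → Set} (P? : ∀ x → Dec (P x)) (f : A → ℕ) (xs : List A) →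
            (∀ {x} → x ∈ xs → ¬ P x) ⊎
            (∃ λ x → x ∈ xs × P x × (∀ {y} → y ∈ xs → P y → f y ≤ f x))
  maximal P? f [] = inj₁ λ ()
  maximal P? f (x ∷ xs) with P? x | maximal P? f xs
  ... | no ¬p | inj₁ none = inj₁ λ { (here refl) → ¬p ; (there q) → none q }
  ... | no ¬p | inj₂ (m , m∈ , pm , max) =
        inj₂ (m , there m∈ , pm , λ { (here refl) p → contradiction p ¬p ; (there q) p → max q p })
  ... | yes p | inj₁ none =
        inj₂ (x , here refl , p , λ { (here refl) _ → ℕ.≤-refl ; (there q) p′ → contradiction p′ (none q) })
  ... | yes p | inj₂ (m , m∈ , pm , max) with ℕ.≤-total (f m) (f x)
  ...   | inj₁ m≤x = inj₂ (x , here refl , p ,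
            λ { (here refl) _ → ℕ.≤-refl ; (there q) p′ → ℕ.≤-trans (max q p′) m≤x })
  ...   | inj₂ x≤m = inj₂ (m , there m∈ , pm , λ { (here refl) _ → x≤m ; (there q) p′ → max q p′ })

module _ {N : ℕ} where

  mixed-< : ∀ {i i′ o o′} → o < N → i < i′ → i * N + o < i′ * N + o′
  mixed-< {i} {i′} {o} {o′} o<N i<i′ = begin-strict
    i * N + o    <⟨ ℕ.+-monoʳ-< (i * N) o<N ⟩
    i * N + N    ≡⟨ ℕ.+-comm (i * N) N ⟩
    suc i * N    ≤⟨ ℕ.*-monoˡ-≤ N i<i′ ⟩
    i′ * N       ≤⟨ ℕ.m≤m+n (i′ * N) o′ ⟩
    i′ * N + o′  ∎
    where open ℕ.≤-Reasoning

  mixed-≡ : ∀ {i i′ o o′} → o < N → o′ < N → i * N + o ≡ i′ * N + o′ → i ≡ i′ × o ≡ o′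
  mixed-≡ {i} {i′} {o} {o′} o<N o′<N eq with ℕ.<-cmp i i′
  ... | tri< i<i′ _ _ = contradiction eq (ℕ.<⇒≢ (mixed-< o<N i<i′))
  ... | tri> _ _ i′<i = contradiction (sym eq) (ℕ.<⇒≢ (mixed-< o′<N i′<i))
  ... | tri≈ _ refl _ = refl , ℕ.+-cancelˡ-≡ (i * N) o o′ eq

  split : ∀ {C : Set} (α : Arrow N) → (Forward α → C) → (¬ Forward α → C) → C
  split α f g with forward? α
  ... | yes p = f p
  ... | no ¬p = g ¬p

  k<N : (α : Arrow N) → toℕ (source α) < N
  k<N α = Fin.toℕ<n (source α)

  i<N : (α : Arrow N) → toℕ (target α) < N
  i<N α = Fin.toℕ<n (target α)

  0<N : Arrow N → 0 < N
  0<N α = ℕ.≤-<-trans z≤n (k<N α)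

  arrow-≡ : ∀ {α β : Arrow N} → source α ≡ source β → target α ≡ target β → α ≡ β
  arrow-≡ {arrow _ _ _} {arrow _ _ _} refl refl = refl

  offset-F : ∀ (α : Arrow N) → Forward α → offset α ≡ toℕ (target α) ∸ toℕ (source α)
  offset-F α f with forward? α
  ... | yes _ = refl
  ... | no ¬f = contradiction f ¬f

  offset-B : ∀ (α : Arrow N) → ¬ Forward α → offset α ≡ (N + toℕ (target α)) ∸ toℕ (source α)
  offset-B α ¬f with forward? α
  ... | yes f = contradiction f ¬f
  ... | no _  = refl

  k≤N+i : ∀ (α : Arrow N) → toℕ (source α) ≤ N + toℕ (target α)
  k≤N+i α = ℕ.≤-trans (ℕ.<⇒≤ (k<N α)) (ℕ.m≤m+n N _)

  k+offset-F : ∀ (α : Arrow N) → Forward α → toℕ (source α) + offset α ≡ toℕ (target α)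
  k+offset-F α f = trans (cong (toℕ (source α) +_) (offset-F α f)) (ℕ.m+[n∸m]≡n f)

  k+offset-B : ∀ (α : Arrow N) → ¬ Forward α → toℕ (source α) + offset α ≡ N + toℕ (target α)
  k+offset-B α ¬f = trans (cong (toℕ (source α) +_) (offset-B α ¬f)) (ℕ.m+[n∸m]≡n (k≤N+i α))

  offset<N : ∀ (α : Arrow N) → offset α < N
  offset<N α = bound (forward? α)
    where
    bound : Dec (Forward α) → offset α < N
    bound (yes f) = ℕ.≤-<-trans (ℕ.m≤n+m _ (toℕ (source α)))
                      (subst (_< N) (sym (k+offset-F α f)) (i<N α))
    bound (no ¬f) = ℕ.+-cancelˡ-< (toℕ (source α)) _ _
                      (subst₂ _<_ (sym (k+offset-B α ¬f)) (ℕ.+-comm N _) (ℕ.+-monoʳ-< N (ℕ.≰⇒> ¬f)))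

  0<offset : ∀ (α : Arrow N) → 0 < offset α
  0<offset α = bound (forward? α)
    where
    bound : Dec (Forward α) → 0 < offset α
    bound (yes f) = ℕ.+-cancelˡ-< (toℕ (source α)) _ _
                      (subst₂ _<_ (sym (ℕ.+-identityʳ _)) (sym (k+offset-F α f)) (suc< α f))
    bound (no ¬f) = ℕ.+-cancelˡ-< (toℕ (source α)) _ _
                      (subst₂ _<_ (sym (ℕ.+-identityʳ _)) (sym (k+offset-B α ¬f))
                        (ℕ.<-≤-trans (k<N α) (ℕ.m≤m+n N _)))

  not-mixed : ∀ {α β : Arrow N} → target α ≡ target β → offset α ≡ offset β →
              Forward α → ¬ Forward β → ⊥
  not-mixed {α} {β} ee oo f ¬g = ℕ.<⇒≱ (ℕ.+-monoˡ-< (offset β) (k<N β)) (begin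
    N + offset β                 ≡⟨ cong (N +_) oo ⟨
    N + offset α                 ≤⟨ ℕ.+-monoʳ-≤ N (ℕ.m≤n+m (offset α) (toℕ (source α))) ⟩
    N + (toℕ (source α) + offset α) ≡⟨ cong (N +_) (k+offset-F α f) ⟩
    N + toℕ (target α)              ≡⟨ cong (λ i → N + toℕ i) ee ⟩
    N + toℕ (target β)              ≡⟨ k+offset-B β ¬g ⟨
    toℕ (source β) + offset β     ∎)
    where open ℕ.≤-Reasoning

  same-start : ∀ {α β : Arrow N} → target α ≡ target β → offset α ≡ offset β → source α ≡ source β
  same-start {α} {β} ee oo = compare (forward? α) (forward? β)
    where
    compare : Dec (Forward α) → Dec (Forward β) → source α ≡ source β
    compare (yes f) (yes g) = Fin.toℕ-injective (ℕ.+-cancelʳ-≡ (offset α) _ _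
      (trans (k+offset-F α f) (trans (cong toℕ ee) (sym (trans (cong (toℕ (source β) +_) oo) (k+offset-F β g))))))
    compare (no f) (no g) = Fin.toℕ-injective (ℕ.+-cancelʳ-≡ (offset α) _ _
      (trans (k+offset-B α f) (trans (cong (λ i → N + toℕ i) ee)
        (sym (trans (cong (toℕ (source β) +_) oo) (k+offset-B β g))))))
    compare (yes f) (no g) = ⊥-elim (not-mixed {α} {β} ee oo f g)
    compare (no f) (yes g) = ⊥-elim (not-mixed {β} {α} (sym ee) (sym oo) g f)

  targetPoint-injective : ∀ {α β : Arrow N} → targetPoint α ≡ targetPoint β → α ≡ β
  targetPoint-injective {α} {β} eq with mixed-≡ (offset<N α) (offset<N β) eq
  ... | ee , oo = arrow-≡ (same-start {α} {β} (Fin.toℕ-injective ee) oo) (Fin.toℕ-injective ee)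

  targetPoint≢ : ∀ (α : Arrow N) k → targetPoint α ≢ k * N
  targetPoint≢ α k eq = ℕ.<⇒≢ (0<offset α) (sym (proj₂ (mixed-≡ {toℕ (target α)} {k} (offset<N α) (0<N α)
    (trans eq (sym (ℕ.+-identityʳ (k * N)))))))

  sourcePoint-injective : ∀ {α β : Arrow N} → sourcePoint α ≡ sourcePoint β → source α ≡ source β
  sourcePoint-injective {α} {β} eq = Fin.toℕ-injective (proj₁ (mixed-≡ {o = 0} {0} (0<N α) (0<N α) (cong (_+ 0) eq)))

  start<end : ∀ (α : Arrow N) → Forward α → sourcePoint α < targetPoint α
  start<end α f = subst (_< targetPoint α) (ℕ.+-identityʳ _) (mixed-< (0<N α) (suc< α f))

  end<start : ∀ (α : Arrow N) → ¬ Forward α → targetPoint α < sourcePoint α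
  end<start α f = subst (targetPoint α <_) (ℕ.+-identityʳ _) (mixed-< (offset<N α) (ℕ.≰⇒> f))

  lo-F : ∀ (α : Arrow N) → Forward α → lo α ≡ sourcePoint α
  lo-F α f = ℕ.m≤n⇒m⊓n≡m (ℕ.<⇒≤ (start<end α f))

  hi-F : ∀ (α : Arrow N) → Forward α → hi α ≡ targetPoint α
  hi-F α f = ℕ.m≤n⇒m⊔n≡n (ℕ.<⇒≤ (start<end α f))

  lo-B : ∀ (α : Arrow N) → ¬ Forward α → lo α ≡ targetPoint α
  lo-B α f = ℕ.m≥n⇒m⊓n≡n (ℕ.<⇒≤ (end<start α f))

  hi-B : ∀ (α : Arrow N) → ¬ Forward α → hi α ≡ sourcePoint α
  hi-B α f = ℕ.m≥n⇒m⊔n≡m (ℕ.<⇒≤ (end<start α f))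

  lo<hi : ∀ (α : Arrow N) → lo α < hi α
  lo<hi α = bound (forward? α)
    where
    bound : Dec (Forward α) → lo α < hi α
    bound (yes f) = subst₂ _<_ (sym (lo-F α f)) (sym (hi-F α f)) (start<end α f)
    bound (no f)  = subst₂ _<_ (sym (lo-B α f)) (sym (hi-B α f)) (end<start α f)

  lo-vertex : ∀ {α : Arrow N} {k} → lo α ≡ k * N → Forward α
  lo-vertex {α} {k} eq = split α (λ f → f)
    (λ ¬f → contradiction (trans (sym (lo-B α ¬f)) eq) (targetPoint≢ α k))

  hi-vertex : ∀ {α : Arrow N} {k} → hi α ≡ k * N → ¬ Forward α
  hi-vertex {α} {k} eq f = targetPoint≢ α k (trans (sym (hi-F α f)) eq)

  Intersect-sym : ∀ {α β : Arrow N} → Intersect α β → Intersect β α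
  Intersect-sym (inj₁ p) = inj₂ p
  Intersect-sym (inj₂ p) = inj₁ p

  Compatible-sym : ∀ {α β : Arrow N} → Compatible α β → Compatible β α
  Compatible-sym {α} {β} (ne , ni) = (λ e → ne (sym e)) , (λ x → ni (Intersect-sym {β} {α} x))

  module Find {D : List (Arrow N)} (comp : AllPairs Compatible D) (r : Region N) where

    Free : ℕ → Set
    Free p = All (λ β → r ≺ just β → ¬ Beyond (just β) p) D

    noncrossing : ∀ {β γ} → β ∈ D → γ ∈ D → β ≢ γ → ¬ Intersect β γ
    noncrossing b c ne = proj₂ (pairwise Compatible-sym comp b c ne)

    findForward : (k : Fin N) → (∀ {γ} → γ ∈ D → r ≺ just γ → toℕ k * N ≤ lo γ) →
      Free (toℕ k * N) ⊎
      (∃ λ β → β ∈ D × r ≺ just β × source β ≡ k × Forward β × Free (targetPoint β))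
    findForward k above = search (maximal P? hi D)
      where
      P : Arrow N → Set
      P β = r ≺ just β × lo β ≡ toℕ k * N
      P? : ∀ β → Dec (P β)
      P? β = (r ≺? just β) ×-dec (lo β ℕ.≟ toℕ k * N)
      search : (∀ {β} → β ∈ D → ¬ P β) ⊎
               (∃ λ β → β ∈ D × P β × (∀ {γ} → γ ∈ D → P γ → hi γ ≤ hi β)) → _
      search (inj₁ none) = inj₁ (All.tabulate λ γ∈ r≺γ (l , h) →
        none γ∈ (r≺γ , ℕ.≤-antisym l (above γ∈ r≺γ)))
      search (inj₂ (β , β∈ , (r≺β , loβ) , max)) =
        inj₂ (β , β∈ , r≺β , sourcePoint-injective′ , fβ , All.tabulate free)
        where
        fβ : Forward β
        fβ = lo-vertex {β} {toℕ k} loβ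
        sourcePoint-injective′ : source β ≡ k
        sourcePoint-injective′ = Fin.toℕ-injective (proj₁ (mixed-≡ (0<N β) (0<N β)
          (cong (_+ 0) (trans (sym (lo-F β fβ)) loβ))))
        free : ∀ {γ} → γ ∈ D → r ≺ just γ → ¬ Beyond (just γ) (targetPoint β)
        free {γ} γ∈ r≺γ (l , h) with ℕ.m≤n⇒m<n∨m≡n (above γ∈ r≺γ)
        ... | inj₂ eq = ℕ.<⇒≱ h (subst (hi γ ≤_) (hi-F β fβ) (max γ∈ (r≺γ , sym eq)))
        ... | inj₁ k<γ with ℕ.m≤n⇒m<n∨m≡n l
        ...   | inj₁ lt = noncrossing β∈ γ∈ (λ { refl → ℕ.<⇒≢ k<γ (sym loβ) })
                (inj₁ (subst (_< lo γ) (sym loβ) k<γ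
                      , subst (lo γ <_) (sym (hi-F β fβ)) lt
                      , subst (_< hi γ) (sym (hi-F β fβ)) h))
        ...   | inj₂ eq = split γ
                (λ fγ → targetPoint≢ β (toℕ (source γ)) (trans (sym eq) (lo-F γ fγ)))
                (λ ¬fγ → ¬fγ (subst Forward
                  (sym (targetPoint-injective {γ} {β} (trans (sym (lo-B γ ¬fγ)) eq))) fβ))

    findBackward : (k : Fin N) → (∀ {γ} → γ ∈ D → r ≺ just γ → hi γ ≤ toℕ k * N) →
      (∀ p → suc p ≡ toℕ k * N → Free p) ⊎
      (∃ λ β → β ∈ D × r ≺ just β × source β ≡ k × ¬ Forward β × (∀ p → suc p ≡ targetPoint β → Free p))
    findBackward k below = search (maximal P? (λ β → toℕ k * N ∸ lo β) D)
      where
      P : Arrow N → Set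
      P β = r ≺ just β × hi β ≡ toℕ k * N
      P? : ∀ β → Dec (P β)
      P? β = (r ≺? just β) ×-dec (hi β ℕ.≟ toℕ k * N)
      search : (∀ {β} → β ∈ D → ¬ P β) ⊎
               (∃ λ β → β ∈ D × P β ×
                 (∀ {γ} → γ ∈ D → P γ → toℕ k * N ∸ lo γ ≤ toℕ k * N ∸ lo β)) → _
      search (inj₁ none) = inj₁ λ p eq → All.tabulate λ {γ} γ∈ r≺γ (l , h) →
        none γ∈ (r≺γ , ℕ.≤-antisym (below γ∈ r≺γ) (subst (_≤ hi γ) eq h))
      search (inj₂ (β , β∈ , (r≺β , hiβ) , max)) =
        inj₂ (β , β∈ , r≺β , sβ , ¬fβ , λ p eq → All.tabulate (free p eq))
        where
        ¬fβ : ¬ Forward β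
        ¬fβ = hi-vertex {β} {toℕ k} hiβ
        sβ : source β ≡ k
        sβ = Fin.toℕ-injective (proj₁ (mixed-≡ (0<N β) (0<N β)
          (cong (_+ 0) (trans (sym (hi-B β ¬fβ)) hiβ))))
        free : ∀ p → suc p ≡ targetPoint β → ∀ {γ} → γ ∈ D → r ≺ just γ → ¬ Beyond (just γ) p
        free p eqp {γ} γ∈ r≺γ (l , h) with ℕ.m≤n⇒m<n∨m≡n (below γ∈ r≺γ)
        ... | inj₂ eq = ℕ.<⇒≱
                (ℕ.∸-monoʳ-< loγ<loβ (ℕ.<⇒≤ (subst (lo β <_) hiβ (lo<hi β)))) (max γ∈ (r≺γ , eq))
          where
          loγ<loβ : lo γ < lo β
          loγ<loβ = subst (lo γ <_) (trans eqp (sym (lo-B β ¬fβ))) (s≤s l)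
        ... | inj₁ γ<k with ℕ.m≤n⇒m<n∨m≡n h
        ...   | inj₁ lt = noncrossing β∈ γ∈ (λ { refl → ℕ.<⇒≢ γ<k hiβ })
                (inj₂ (subst (lo γ <_) (trans eqp (sym (lo-B β ¬fβ))) (s≤s l)
                      , subst (_< hi γ) (trans eqp (sym (lo-B β ¬fβ))) lt
                      , subst (hi γ <_) (sym hiβ) γ<k))
        ...   | inj₂ eq = split γ
                (λ fγ → ¬fβ (subst Forward
                  (targetPoint-injective {γ} {β} (trans (sym (hi-F γ fγ)) (trans (sym eq) eqp))) fγ))
                (λ ¬fγ → targetPoint≢ β (toℕ (source γ)) (trans (sym eqp) (trans eq (hi-B γ ¬fγ))))

    meets : ∀ j {p} o → o < N → toℕ j * N + o ≡ p → Beyond r p → Free p → Meets D r j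
    meets j {p} o o<N eq b f = fromℕ< o<N ,
      subst (InRegion D r) (sym (trans (cong (toℕ j * N +_) (Fin.toℕ-fromℕ< o<N)) eq)) (b , f)

    filtered : ∀ {i j} → i ≢ j → Meets D r i → Meets D r j →
               2 ≤ length (filter (meets? D r) (allFin N))
    filtered i≢j mi mj = two-elements i≢j (∈-filter⁺ (meets? D r) (∈-allFin _) mi)
                                          (∈-filter⁺ (meets? D r) (∈-allFin _) mj)

  module _ {D : List (Arrow N)} (comp : AllPairs Compatible D) where

    two-root : 2 ≤ N → 2 ≤ length (filter (meets? D nothing) (allFin N))
    two-root 2≤N = conclude (findForward v₀ λ {γ} _ _ → subst (λ k → k * N ≤ lo γ) (sym v₀≡0) z≤n)
      where
      open Find comp nothing
      0<N′ : 0 < N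
      0<N′ = ℕ.<⇒≤ 2≤N
      v₀ : Fin N
      v₀ = fromℕ< 0<N′
      v₀≡0 : toℕ v₀ ≡ 0
      v₀≡0 = Fin.toℕ-fromℕ< 0<N′
      suc-pred : suc (N ∸ 1) ≡ N
      suc-pred = ℕ.m+[n∸m]≡n 0<N′
      pred<N : N ∸ 1 < N
      pred<N = ℕ.≤-reflexive suc-pred
      last : Fin N
      last = fromℕ< pred<N
      last≡ : toℕ last ≡ N ∸ 1
      last≡ = Fin.toℕ-fromℕ< pred<N
      ≤last : ∀ {a} → a < N → a ≤ N ∸ 1
      ≤last a<N = ℕ.≤-pred (subst (_ <_) (sym suc-pred) a<N)
      hi≤ : ∀ γ → hi γ ≤ (N ∸ 1) * N + (N ∸ 1)
      hi≤ γ = ℕ.⊔-lub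
        (ℕ.≤-trans (ℕ.*-monoˡ-≤ N (≤last (k<N γ))) (ℕ.m≤m+n _ _))
        (ℕ.+-mono-≤ (ℕ.*-monoˡ-≤ N (≤last (i<N γ))) (≤last (offset<N γ)))
      meetsLast : Meets D nothing last
      meetsLast = meets last (N ∸ 1) pred<N (cong (λ k → k * N + (N ∸ 1)) last≡) tt
        (All.tabulate λ {γ} _ _ (_ , h) → ℕ.<⇒≱ h (hi≤ γ))
      conclude : _ → _
      conclude (inj₁ free) = filtered distinct
        (meets v₀ 0 0<N′ (ℕ.+-identityʳ _) tt free) meetsLast
        where
        distinct : v₀ ≢ last
        distinct eq = ℕ.<⇒≢ (ℕ.m<n⇒0<n∸m 2≤N)
          (trans (sym v₀≡0) (trans (cong toℕ eq) last≡))
      conclude (inj₂ (β , _ , _ , s , _ , free)) = filtered distinct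
        (meets (target β) (offset β) (offset<N β) refl tt free) meetsLast
        where
        distinct : target β ≢ last
        distinct eq = nontrivial′ β (closed (trans (cong toℕ s) v₀≡0)
          (trans (cong suc (trans (cong toℕ eq) last≡)) suc-pred))

    two-forward : (α : Arrow N) → Forward α → 2 ≤ length (filter (meets? D (just α)) (allFin N))
    two-forward α f = conclude (findForward (source α) λ { _ (_ , l , _) → subst (_≤ _) (lo-F α f) l })
      where
      open Find comp (just α)
      o = offset α ∸ 1
      suc-o : suc o ≡ offset α
      suc-o = ℕ.m+[n∸m]≡n (0<offset α)
      p = toℕ (target α) * N + o
      suc-p : suc p ≡ hi α
      suc-p = trans (sym (ℕ.+-suc _ o)) (trans (cong (toℕ (target α) * N +_) suc-o) (sym (hi-F α f)))
      hi≢ : ∀ {γ} → α ≢ γ → hi γ ≢ hi α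
      hi≢ {γ} ne eq = split γ
        (λ g → ne (sym (targetPoint-injective {γ} {α} (trans (sym (hi-F γ g)) (trans eq (hi-F α f))))))
        (λ ¬g → targetPoint≢ α (toℕ (source γ)) (trans (sym (hi-F α f)) (trans (sym eq) (hi-B γ ¬g))))
      meetsRoot : Meets D (just α) (target α)
      meetsRoot = meets (target α) o (ℕ.<-trans (ℕ.≤-reflexive suc-o) (offset<N α)) refl
        (ℕ.≤-pred (subst (lo α <_) (sym suc-p) (lo<hi α)) , ℕ.≤-reflexive suc-p)
        (All.tabulate λ {γ} _ (ne , _ , h) (_ , h′) →
          hi≢ ne (ℕ.≤-antisym h (subst (_≤ hi γ) suc-p h′)))
      conclude : _ → _
      conclude (inj₁ free) = filtered (λ eq → ℕ.<⇒≢ (suc< α f) (cong toℕ eq))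
        (meets (source α) 0 (0<N α) (ℕ.+-identityʳ _)
          (ℕ.≤-reflexive (lo-F α f) , subst (_< hi α) (lo-F α f) (lo<hi α)) free)
        meetsRoot
      conclude (inj₂ (β , _ , (ne , l , h) , s , fβ , free)) =
        filtered (λ eq → ne (sym (arrow-≡ s eq)))
          (meets (target β) (offset β) (offset<N β) refl
            (subst (lo α ≤_) (hi-F β fβ) (ℕ.≤-trans l (ℕ.<⇒≤ (lo<hi β)))
            , subst (_< hi α) (hi-F β fβ) (ℕ.≤∧≢⇒< h (hi≢ ne))) free)
          meetsRoot

    two-backward : (α : Arrow N) → ¬ Forward α → 2 ≤ length (filter (meets? D (just α)) (allFin N))
    two-backward α ¬f = conclude (findBackward (source α) λ { _ (_ , _ , h) → subst (_ ≤_) (hi-B α ¬f) h })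
      where
      open Find comp (just α)
      lo≢ : ∀ {γ} → α ≢ γ → lo α ≢ lo γ
      lo≢ {γ} ne eq = split γ
        (λ g → targetPoint≢ α (toℕ (source γ)) (trans (sym (lo-B α ¬f)) (trans eq (lo-F γ g))))
        (λ ¬g → ne (targetPoint-injective {α} {γ} (trans (sym (lo-B α ¬f)) (trans eq (lo-B γ ¬g)))))
      meetsRoot : Meets D (just α) (target α)
      meetsRoot = meets (target α) (offset α) (offset<N α) refl
        (ℕ.≤-reflexive (lo-B α ¬f) , subst (_< hi α) (lo-B α ¬f) (lo<hi α))
        (All.tabulate λ {γ} _ (ne , l , _) (l′ , _) →
          lo≢ ne (ℕ.≤-antisym l (subst (lo γ ≤_) (sym (lo-B α ¬f)) l′)))
      i+1<k : suc (toℕ (target α)) < toℕ (source α)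
      i+1<k = suc<′ α ¬f
      suc-k : suc (toℕ (source α) ∸ 1) ≡ toℕ (source α)
      suc-k = ℕ.m+[n∸m]≡n (ℕ.<-trans (s≤s z≤n) i+1<k)
      k-1<N : toℕ (source α) ∸ 1 < N
      k-1<N = ℕ.<-trans (ℕ.≤-reflexive suc-k) (k<N α)
      suc-N : suc (N ∸ 1) ≡ N
      suc-N = ℕ.m+[n∸m]≡n (0<N α)
      q = (toℕ (source α) ∸ 1) * N + (N ∸ 1)
      suc-q : suc q ≡ sourcePoint α
      suc-q = trans (sym (ℕ.+-suc _ (N ∸ 1))) (trans (cong ((toℕ (source α) ∸ 1) * N +_) suc-N)
        (trans (ℕ.+-comm _ N) (cong (_* N) suc-k)))
      conclude : _ → _
      conclude (inj₁ free) = filtered distinct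
        (meets (fromℕ< k-1<N) (N ∸ 1) (ℕ.≤-reflexive suc-N)
          (cong (λ k → k * N + (N ∸ 1)) (Fin.toℕ-fromℕ< k-1<N))
          (ℕ.≤-pred (subst (lo α <_) (trans (hi-B α ¬f) (sym suc-q)) (lo<hi α))
          , ℕ.≤-reflexive (trans suc-q (sym (hi-B α ¬f))))
          (free q suc-q))
        meetsRoot
        where
        distinct : fromℕ< k-1<N ≢ target α
        distinct eq = ℕ.<⇒≢ i+1<k (trans (cong suc (trans (sym (cong toℕ eq)) (Fin.toℕ-fromℕ< k-1<N))) suc-k)
      conclude (inj₂ (β , _ , (ne , l , h) , s , ¬fβ , free)) =
        filtered (λ eq → ne (sym (arrow-≡ s eq)))
          (meets (target β) o (ℕ.<-trans (ℕ.≤-reflexive suc-o) (offset<N β)) refl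
            (ℕ.≤-pred (subst (lo α <_) (trans (lo-B β ¬fβ) (sym suc-p)) (ℕ.≤∧≢⇒< l (lo≢ ne)))
            , subst (_≤ hi α) (trans (lo-B β ¬fβ) (sym suc-p)) (ℕ.≤-trans (ℕ.<⇒≤ (lo<hi β)) h))
            (free p suc-p))
          meetsRoot
        where
        o = offset β ∸ 1
        suc-o : suc o ≡ offset β
        suc-o = ℕ.m+[n∸m]≡n (0<offset β)
        p = toℕ (target β) * N + o
        suc-p : suc p ≡ targetPoint β
        suc-p = trans (sym (ℕ.+-suc _ o)) (cong (toℕ (target β) * N +_) suc-o)

    two-region : 2 ≤ N → ∀ r → 2 ≤ length (regionSides D r)
    two-region 2≤N nothing = two-root 2≤N
    two-region 2≤N (just α) = ifForward-elim (λ is → 2 ≤ length is) α (two-forward α)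
      (λ ¬f → subst (2 ≤_) (sym (length-reverse (filter (meets? D (just α)) (allFin N))))
                    (two-backward α ¬f))

two-labels : ∀ {R : Set} (ls : List R) {D : List (Arrow (length ls))} →
             AllPairs Compatible D → 2 ≤ length ls →
             ∀ r → 2 ≤ length (map (lookup ls) (regionSides D r))
two-labels ls {D} comp 2≤N r =
  subst (2 ≤_) (sym (length-map (lookup ls) (regionSides D r))) (two-region comp 2≤N r)

module _ {R : Set} where

  regionPolygon : (π : Polygon R) → Dissection (length (labels π)) →
                  Region (length (labels π)) → Polygon R
  regionPolygon (polygon ls two) (dissection D comp) r =
    polygon (map (lookup ls) (regionSides D r)) (two-labels ls comp two r)

  sgnDissection : (π : Polygon R) → Dissection (length (labels π)) → ℚ
  sgnDissection π D = foldr ℚ._*_ 1ℚ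
    (map (λ α → ifForward α 1ℚ (sign (χ (regionPolygon π D (just α))))) (cuts D))

insertions : {A : Set} → A → List A → List (List A)
insertions x []       = (x ∷ []) ∷ []
insertions x (y ∷ ys) = (x ∷ y ∷ ys) ∷ map (y ∷_) (insertions x ys)

permutations : {A : Set} → List A → List (List A)
permutations []       = [] ∷ []
permutations (x ∷ xs) = concatMap (insertions x) (permutations xs)

linearOrders : ∀ {N} → Dissection N → List (List (Region N))
linearOrders D = filter (allPairs? (λ r s → ¬? (s ≺? r))) (permutations (regions D))

B : {R : Set} → Polygon R → Bar R
B π = concatMap
  (λ D → map (λ rs → sgnDissection π D , map (λ r → letter 0 (monomial (regionPolygon π D r ∷ []))) rs)
             (linearOrders D))
  (dissections (length (labels π)))

{-# OPTIONS --safe #-}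
module Submission where

-- An arrow of the polygon of a region r of a dissection D is the same thing as an arrow α of π
-- which divides r in two, and the polygons π^rt and π^co it cuts out of r are those of the regions
-- r and α of D ∪ {α}; comparing weights one finds that also the signs agree.  Hence D₂ B(π) is the
-- sum over all dissections and orders with a marked pair of consecutive regions, joined by an edge
-- of the dual tree, of the words in which this pair is replaced by its wedge product.  These terms
-- occur in D₁ B(π) with the opposite sign.  In the remaining terms of D₁ B(π) the marked regions are
-- incomparable, so that they may be exchanged, which changes the sign of the wedge product: the sum
-- S of these terms satisfies S = - S.

open import Defs

import Algebra.Properties.Group as Group
open import Data.Empty using (⊥; ⊥-elim; ⊥-elim-irr)
open import Data.Fin using (Fin; toℕ; fromℕ<)
import Data.Fin.Properties as Fin
open import Data.List
  using (List; []; _∷_; _++_; map; concatMap; filter; foldr; length; lookup; take; drop;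
         reverse; _ʳ++_; catMaybes; allFin)
import Data.List.Membership.DecPropositional as DecMembership
open import Data.List.Membership.Propositional using (_∈_; _∉_; find; lose)
open import Data.List.Membership.Propositional.Properties
open import Data.List.Membership.Propositional.Properties.WithK using (unique∧set⇒bag)
open import Data.List.Properties
open import Data.List.Relation.Binary.BagAndSetEquality using (∼bag⇒↭)
open import Data.List.Relation.Binary.Permutation.Propositional as Perm
  using (_↭_; ↭-refl; ↭-sym; ↭-trans)
import Data.List.Relation.Binary.Permutation.Propositional.Properties as Perm
open import Data.List.Relation.Unary.All as All using (All; []; _∷_)
import Data.List.Relation.Unary.All.Properties as All
open import Data.List.Relation.Unary.AllPairs as AllPairs using (AllPairs; []; _∷_; allPairs?)
import Data.List.Relation.Unary.AllPairs.Properties as AllPairs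
open import Data.List.Relation.Unary.Any using (here; there)
open import Data.List.Relation.Unary.Unique.Propositional using (Unique)
import Data.List.Relation.Unary.Unique.Propositional.Properties as Unique
open import Data.Maybe using (nothing; just)
import Data.Maybe.Properties as Maybe
open import Data.Nat as ℕ
  using (ℕ; zero; suc; _+_; _*_; _∸_; _≤_; _<_; z≤n; s≤s; _≤?_; _<?_)
import Data.Nat.Properties as ℕ
open import Data.Product using (∃; _×_; _,_; proj₁; proj₂)
open import Data.Rational as ℚ using (ℚ; 0ℚ; 1ℚ; ½)
import Data.Rational.Properties as ℚ
open import Data.Sum using (_⊎_; inj₁; inj₂; [_,_]′)
open import Data.Unit using (⊤; tt)
open import Data.Vec using (Vec; []; _∷_)
open import Function using (_∘_; id; flip; mk⇔)
open import Relation.Binary using (tri<; tri≈; tri>)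
open import Relation.Binary.PropositionalEquality hiding (resp)
open import Relation.Nullary using (¬_; Dec; yes; no; contradiction)
open import Relation.Nullary.Decidable using (_×-dec_; _⊎-dec_; _→-dec_; ¬?)
open import Relation.Unary using (Decidable)

-- Regions and arrows

-- Every letter of `B π` has exterior degree 1, so the signs of the bar differential are constant
-- and two comparisons remain. The arrows of the polygon of r must correspond to the arrows of π
-- addable inside r. Contracting an arrow merges its source with an inner point of a side, so each
-- vertex of the contracted polygon comes from exactly one vertex of π, which serves as source. The
-- obstacle is that intersection is defined by fixed division points: one has to see that the chosen
-- offsets never produce a crossing which other endpoints would avoid. As to signs, an arrow changes
-- its direction when it is seen inside a reversed region. The factor by which its sign then differs
-- is supplied by the changed weight of r itself, since weights add up when a region is divided. All
-- sums run over explicit lists. They are matched by showing that two lists have no repetitions and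
-- the same members, so that the order of enumeration never matters. Finally, S = - S gives S = 0
-- because 2 is invertible in ℚ.

just-∈⁻ : ∀ {A : Set} {x : A} {xs} → just x ∈ nothing ∷ map just xs → x ∈ xs
just-∈⁻ {xs = _ ∷ _} (there (here refl)) = here refl
just-∈⁻ {xs = _ ∷ _} (there (there p)) = there (just-∈⁻ (there p))

module _ {N : ℕ} where

  -- Ends of arrows are vertices or targets. No target is a vertex, and different arrows have
  -- different targets; so different arrows share ends only at their sources.
  target≢lo : ∀ {α β : Arrow N} → α ≢ β → targetPoint α ≢ lo β
  target≢lo {α} {β} ne eq = split β
    (λ f → targetPoint≢ α (toℕ (source β)) (trans eq (lo-F β f)))
    (λ ¬f → ne (targetPoint-injective {α = α} {β} (trans eq (lo-B β ¬f))))

  target≢hi : ∀ {α β : Arrow N} → α ≢ β → targetPoint α ≢ hi β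
  target≢hi {α} {β} ne eq = split β
    (λ f → ne (targetPoint-injective {α = α} {β} (trans eq (hi-F β f))))
    (λ ¬f → targetPoint≢ α (toℕ (source β)) (trans eq (hi-B β ¬f)))

  -- The target of an arrow is an end of its interval and of no other interval. This makes `≺`
  -- asymmetric.
  interval-injective : ∀ {α β : Arrow N} → lo α ≡ lo β → hi α ≡ hi β → α ≡ β
  interval-injective {α} {β} l h with α ≟ᴬ β
  ... | yes eq = eq
  ... | no ne = ⊥-elim (split α
    (λ f → target≢hi {α} {β} ne (trans (sym (hi-F α f)) h))
    (λ ¬f → target≢lo {α} {β} ne (trans (sym (lo-B α ¬f)) l)))

  ≺-asym : ∀ {α β : Arrow N} → just α ≺ just β → ¬ just β ≺ just α
  ≺-asym {α} {β} (ne , l , h) (_ , l′ , h′) =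
    ne (interval-injective {α} {β} (ℕ.≤-antisym l l′) (ℕ.≤-antisym h′ h))

  ≺-trans : ∀ {r : Region N} {α β : Arrow N} → r ≺ just α → just α ≺ just β → r ≺ just β
  ≺-trans {nothing} _ _ = tt
  ≺-trans {just ρ} {α} {β} p@(_ , l , h) q@(_ , l′ , h′) =
    (λ { refl → ≺-asym {ρ} {α} p q }) , ℕ.≤-trans l l′ , ℕ.≤-trans h′ h

  ≺-irrefl : ∀ {r : Region N} → ¬ r ≺ r
  ≺-irrefl {just _} (ne , _) = ne refl

  data Position (α β : Arrow N) : Set where
    outside : just α ≺ just β → Position α β
    inside  : just β ≺ just α → Position α β
    before  : hi α ≤ lo β → Position α β
    after   : hi β ≤ lo α → Position α β

  -- Excluding strict interlacing leaves nested intervals and intervals with at most an end in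
  -- common; equal lower ends count as nested.
  position : ∀ {α β} → Compatible α β → Position α β
  position {α} {β} (ne , nc) with ℕ.<-cmp (lo α) (lo β)
  ... | tri< l _ _ with hi α ≤? lo β
  ...   | yes h = before h
  ...   | no h = outside (ne , ℕ.<⇒≤ l , ℕ.≮⇒≥ λ h′ → nc (inj₁ (l , ℕ.≰⇒> h , h′)))
  position {α} {β} (ne , nc) | tri> _ _ l with hi β ≤? lo α
  ...   | yes h = after h
  ...   | no h = inside (ne ∘ sym , ℕ.<⇒≤ l , ℕ.≮⇒≥ λ h′ → nc (inj₂ (l , ℕ.≰⇒> h , h′)))
  position {α} {β} (ne , nc) | tri≈ _ eq _ with ℕ.≤-total (hi α) (hi β)
  ...   | inj₁ h = inside (ne ∘ sym , ℕ.≤-reflexive (sym eq) , h)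
  ...   | inj₂ h = outside (ne , ℕ.≤-reflexive eq , h)

  Inside : Region N → ℕ → Set
  Inside nothing  x = ⊤
  Inside (just ρ) x = lo ρ ≤ x × x ≤ hi ρ

  Straddles : Arrow N → ℕ → Set
  Straddles β x = lo β < x × x < hi β

  -- For a vertex x this says that x lies on the boundary of r. Ends of arrows remain visible, so
  -- only strict inclusion in a part cut off hides x. The exposed vertices are the possible sources
  -- of arrows inside r.
  Exposed : List (Arrow N) → Region N → ℕ → Set
  Exposed D r x = Inside r x × All (λ β → r ≺ just β → ¬ Straddles β x) D

  -- D ∪ {α} is a dissection in which α divides the region r of D.

  Addable : List (Arrow N) → Region N → Arrow N → Set
  Addable D r α = All (Compatible α) D × r ≺ just α × All (λ β → r ≺ just β → ¬ just β ≺ just α) D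

  OnSide : Fin N → ℕ → Set
  OnSide j p = toℕ j * N ≤ p × p < suc (toℕ j) * N

  meets⁻ : ∀ {D r j} → Meets D r j → ∃ λ p → InRegion D r p × OnSide j p
  meets⁻ {j = j} (o , m) = toℕ j * N + toℕ o , m , ℕ.m≤m+n _ _ ,
    subst (toℕ j * N + toℕ o <_) (ℕ.+-comm (toℕ j * N) N) (ℕ.+-monoʳ-< (toℕ j * N) (Fin.toℕ<n o))

  meets⁺ : ∀ {D r j p} → InRegion D r p → OnSide j p → Meets D r j
  meets⁺ {D} {r} {j} {p} m (l , h) = fromℕ< o<N ,
    subst (InRegion D r) (sym (trans (cong (toℕ j * N +_) (Fin.toℕ-fromℕ< o<N)) (ℕ.m+[n∸m]≡n l))) m
    where
    o<N : p ∸ toℕ j * N < N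
    o<N = ℕ.+-cancelˡ-< (toℕ j * N) _ _ (subst₂ _<_ (sym (ℕ.m+[n∸m]≡n l)) (ℕ.+-comm N (toℕ j * N)) h)

  side≤ : ∀ {j p k} → OnSide j p → k * N ≤ p → k ≤ toℕ j
  side≤ {j} {k = k} (_ , h) kp = ℕ.≤-pred (ℕ.*-cancelʳ-< N k (suc (toℕ j)) (ℕ.≤-<-trans kp h))

  side< : ∀ {j p k} → OnSide j p → p < k * N → toℕ j < k
  side< {j} {k = k} (l , _) pk = ℕ.*-cancelʳ-< N (toℕ j) k (ℕ.≤-<-trans l pk)

  ≤side : ∀ {j p k} → OnSide j p → k ≤ toℕ j → k * N ≤ p
  ≤side (l , _) kj = ℕ.≤-trans (ℕ.*-monoˡ-≤ N kj) l

  <side : ∀ {j p k} → OnSide j p → toℕ j < k → p < k * N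
  <side (_ , h) jk = ℕ.<-≤-trans h (ℕ.*-monoˡ-≤ N jk)

  side-mono : ∀ {i j p q} → OnSide i p → OnSide j q → p ≤ q → toℕ i ≤ toℕ j
  side-mono ip jq pq = side≤ jq (ℕ.≤-trans (proj₁ ip) pq)

  onTarget : ∀ (α : Arrow N) → OnSide (target α) (targetPoint α)
  onTarget α = ℕ.m≤m+n _ _ ,
    subst (targetPoint α <_) (ℕ.+-comm (toℕ (target α) * N) N) (ℕ.+-monoʳ-< _ (offset<N α))

  start<target : ∀ (α : Arrow N) → toℕ (target α) * N < targetPoint α
  start<target α = ℕ.m<m+n _ (0<offset α)

  pred-target : ∀ (α : Arrow N) → ∃ λ q → suc q ≡ targetPoint α × OnSide (target α) q
  pred-target α with targetPoint α | start<target α | proj₂ (onTarget α)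
  ... | suc q | l | h = q , refl , ℕ.≤-pred l , ℕ.<-trans (ℕ.n<1+n q) h

  lo≤source : ∀ (α : Arrow N) → lo α ≤ sourcePoint α
  lo≤source α = ℕ.m⊓n≤m _ _

  source≤hi : ∀ (α : Arrow N) → sourcePoint α ≤ hi α
  source≤hi α = ℕ.m≤m⊔n _ _

  lo≤target : ∀ (α : Arrow N) → lo α ≤ targetPoint α
  lo≤target α = ℕ.m⊓n≤n (sourcePoint α) _

  target≤hi : ∀ (α : Arrow N) → targetPoint α ≤ hi α
  target≤hi α = ℕ.m≤n⊔m (sourcePoint α) _

  Comparable : Region N → Region N → Set
  Comparable r s = r ≡ s ⊎ r ≺ s ⊎ s ≺ r

  module Regions {D : List (Arrow N)} (comp : AllPairs Compatible D) where

    compatible-in : ∀ {β γ} → β ∈ D → γ ∈ D → β ≢ γ → Compatible β γ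
    compatible-in = pairwise (λ {β} {γ} → Compatible-sym {N} {β} {γ}) comp

    -- The regions above α form a chain: their intervals all contain the interval of α, which is not
    -- degenerate, so no two of them are disjoint.
    comparable : ∀ {r s α} → r ∈ regions (dissection D comp) → s ∈ regions (dissection D comp) →
                 r ≺ just α → s ≺ just α → Comparable r s
    comparable {nothing} {nothing} _ _ _ _ = inj₁ refl
    comparable {nothing} {just _} _ _ _ _ = inj₂ (inj₁ tt)
    comparable {just _} {nothing} _ _ _ _ = inj₂ (inj₂ tt)
    comparable {just ρ} {just σ} {α} (there r∈) (there s∈) (_ , l , h) (_ , l′ , h′) with ρ ≟ᴬ σ
    ... | yes refl = inj₁ refl
    ... | no ne with position (compatible-in (just-∈⁻ (there r∈)) (just-∈⁻ (there s∈)) ne)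
    ...   | outside p = inj₂ (inj₁ p)
    ...   | inside p = inj₂ (inj₂ p)
    ...   | before p = contradiction (lo<hi α) (ℕ.≤⇒≯ (ℕ.≤-trans h (ℕ.≤-trans p l′)))
    ...   | after p = contradiction (lo<hi α) (ℕ.≤⇒≯ (ℕ.≤-trans h′ (ℕ.≤-trans p l)))

    module _ {r : Region N} {α : Arrow N} (add : Addable D r α) where

      private
        r≺α : r ≺ just α
        r≺α = proj₁ (proj₂ add)

        around : ∀ {β} → β ∈ D → Position α β
        around β∈ = position (All.lookup (proj₁ add) β∈)

        distinct : ∀ {β} → β ∈ D → α ≢ β
        distinct β∈ = proj₁ (All.lookup (proj₁ add) β∈)

        not-between : ∀ {β} → β ∈ D → r ≺ just β → ¬ just β ≺ just α
        not-between = All.lookup (proj₂ (proj₂ add))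

      within : ∀ {x} → lo α ≤ x → x ≤ hi α → Inside r x
      within = go r r≺α
        where
        go : ∀ r → r ≺ just α → ∀ {x} → lo α ≤ x → x ≤ hi α → Inside r x
        go nothing _ _ _ = tt
        go (just ρ) (_ , l , h) l′ h′ = ℕ.≤-trans l l′ , ℕ.≤-trans h′ h

      beyond-mono : ∀ {p} → Beyond (just α) p → Beyond r p
      beyond-mono = go r r≺α
        where
        go : ∀ r → r ≺ just α → ∀ {p} → Beyond (just α) p → Beyond r p
        go nothing _ _ = tt
        go (just ρ) (_ , l , h) (l′ , h′) = ℕ.≤-trans l l′ , ℕ.<-≤-trans h′ h

      -- An arrow β of D below r does not contain α, hence lies within α or beside it, and then an
      -- end of α can at most be an end of β.
      endpoint-free : ∀ {β x} → x ≡ lo α ⊎ x ≡ hi α → β ∈ D → r ≺ just β → ¬ Straddles β x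
      endpoint-free e β∈ r≺β (l , h) with around β∈ | e
      ... | inside p             | _ = not-between β∈ r≺β p
      ... | outside (_ , lo≤ , _) | inj₁ refl = ℕ.<⇒≱ l lo≤
      ... | outside (_ , _ , hi≤) | inj₂ refl = ℕ.<⇒≱ h hi≤
      ... | before b | inj₁ refl = ℕ.<⇒≱ l (ℕ.≤-trans (ℕ.<⇒≤ (lo<hi α)) b)
      ... | before b | inj₂ refl = ℕ.<⇒≱ l b
      ... | after b  | inj₁ refl = ℕ.<⇒≱ h b
      ... | after b  | inj₂ refl = ℕ.<⇒≱ h (ℕ.≤-trans b (ℕ.<⇒≤ (lo<hi α)))

      source-end : sourcePoint α ≡ lo α ⊎ sourcePoint α ≡ hi α
      source-end = split α (λ f → inj₁ (sym (lo-F α f))) (λ ¬f → inj₂ (sym (hi-B α ¬f)))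

      target-end : targetPoint α ≡ lo α ⊎ targetPoint α ≡ hi α
      target-end = split α (λ f → inj₂ (sym (hi-F α f))) (λ ¬f → inj₁ (sym (lo-B α ¬f)))

      source-exposed : Exposed D r (sourcePoint α)
      source-exposed = within (lo≤source α) (source≤hi α) , All.tabulate λ β∈ → endpoint-free source-end β∈

      beyond-target : ∀ {q} → q ≡ targetPoint α ⊎ suc q ≡ targetPoint α → Beyond r q
      beyond-target = go r r≺α
        where
        go : ∀ r → r ≺ just α → ∀ {q} → q ≡ targetPoint α ⊎ suc q ≡ targetPoint α → Beyond r q
        go nothing _ _ = tt
        go (just ρ) (ne , l , h) (inj₁ refl) =
          ℕ.≤-trans l (lo≤target α) ,
          ℕ.≤∧≢⇒< (ℕ.≤-trans (target≤hi α) h) (target≢hi {α} {ρ} (ne ∘ sym))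
        go (just ρ) (ne , l , h) (inj₂ e) =
          ℕ.≤-pred (subst (lo ρ <_) (sym e) (ℕ.≤∧≢⇒< (ℕ.≤-trans l (lo≤target α))
            (target≢lo {α} {ρ} (ne ∘ sym) ∘ sym))) ,
          subst (_≤ hi ρ) (sym e) (ℕ.≤-trans (target≤hi α) h)

      -- The target of α lies inside a side and is an end of no other arrow, so both boundary pieces
      -- next to it belong to r. This is why the target side occurs in both polygons into which r is
      -- divided.
      target-in : ∀ {q} → q ≡ targetPoint α ⊎ suc q ≡ targetPoint α → InRegion D r q
      target-in e = beyond-target e , All.tabulate λ {β} β∈ r≺β b →
        endpoint-free target-end β∈ r≺β (go {β} (distinct β∈) e b)
        where
        go : ∀ {β} → α ≢ β → ∀ {q} → q ≡ targetPoint α ⊎ suc q ≡ targetPoint α →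
             Beyond (just β) q → Straddles β (targetPoint α)
        go {β} ne (inj₁ refl) (l , h) = ℕ.≤∧≢⇒< l (target≢lo {α} {β} ne ∘ sym) , h
        go {β} ne (inj₂ e) (l , h) = subst (lo β <_) e (s≤s l) ,
          ℕ.≤∧≢⇒< (subst (_≤ hi β) e h) (target≢hi {α} {β} ne)

      rest⁻ : ∀ {p} → InRegion (α ∷ D) r p → InRegion D r p × ¬ Beyond (just α) p
      rest⁻ (b , na ∷ f) = (b , f) , na r≺α

      rest⁺ : ∀ {p} → InRegion D r p → ¬ Beyond (just α) p → InRegion (α ∷ D) r p
      rest⁺ (b , f) na = b , (λ _ → na) ∷ f

      cut⁻ : ∀ {p} → InRegion (α ∷ D) (just α) p → InRegion D r p × Beyond (just α) p
      cut⁻ (b@(l , h) , _ ∷ f) = (beyond-mono b , All.tabulate free) , b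
        where
        free : ∀ {β} → β ∈ D → r ≺ just β → ¬ Beyond (just β) _
        free β∈ r≺β (l′ , h′) with around β∈
        ... | outside p = All.lookup f β∈ p (l′ , h′)
        ... | inside p = not-between β∈ r≺β p
        ... | before p = ℕ.<⇒≱ h (ℕ.≤-trans p l′)
        ... | after p = ℕ.<⇒≱ h′ (ℕ.≤-trans p l)

      cut⁺ : ∀ {p} → InRegion D r p → Beyond (just α) p → InRegion (α ∷ D) (just α) p
      cut⁺ (_ , f) b = b , (λ p → ⊥-elim (≺-irrefl {just α} p)) ∷
        All.map (λ {β} nb α≺β → nb (≺-trans {r} {α} {β} r≺α α≺β)) f

      module _ (r∈ : r ∈ nothing ∷ map just D) {s} (s∈ : s ∈ nothing ∷ map just D) (s≢r : s ≢ r) where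

        -- Only r loses a part to α. If s ≺ α and p is beyond α, then s is comparable to r: below r
        -- it would lie between r and α, and above r it would already have lost p to r.
        other⁺ : ∀ {p} → InRegion D s p → InRegion (α ∷ D) s p
        other⁺ (b , f) = b , (λ s≺α bα → go s≺α bα (comparable r∈ s∈ r≺α s≺α)) ∷ f
          where
          descend : ∀ t → t ∈ nothing ∷ map just D → r ≺ t → ¬ t ≺ just α
          descend (just σ) t∈ r≺σ = not-between (just-∈⁻ t∈) r≺σ
          ascend : ∀ t → t ∈ nothing ∷ map just D → s ≺ t → ¬ Beyond t _
          ascend (just ρ) t∈ s≺ρ = All.lookup f (just-∈⁻ t∈) s≺ρ
          go : s ≺ just α → Beyond (just α) _ → ¬ Comparable r s
          go s≺α bα (inj₁ eq) = s≢r (sym eq)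
          go s≺α bα (inj₂ (inj₁ r≺s)) = descend s s∈ r≺s s≺α
          go s≺α bα (inj₂ (inj₂ s≺r)) = ascend r r∈ s≺r (beyond-mono bα)

        meets-other⁺ : ∀ {j} → Meets D s j → Meets (α ∷ D) s j
        meets-other⁺ {j} m with meets⁻ {D} {s} {j} m
        ... | p , ip , op = meets⁺ {α ∷ D} {s} {j} (other⁺ ip) op

        meets-other⁻ : ∀ {j} → Meets (α ∷ D) s j → Meets D s j
        meets-other⁻ (o , b , _ ∷ f) = o , b , f

      private
        k = toℕ (source α)
        i = toℕ (target α)

        beyond-F : Forward α → ∀ {p} → Beyond (just α) p → k * N ≤ p × p < targetPoint α
        beyond-F f {p} (l , h) = subst (_≤ p) (lo-F α f) l , subst (p <_) (hi-F α f) h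

        beyond-F⁺ : Forward α → ∀ {p} → k * N ≤ p → p < targetPoint α → Beyond (just α) p
        beyond-F⁺ f {p} l h = subst (_≤ p) (sym (lo-F α f)) l , subst (p <_) (sym (hi-F α f)) h

        beyond-B : ¬ Forward α → ∀ {p} → Beyond (just α) p → targetPoint α ≤ p × p < k * N
        beyond-B f {p} (l , h) = subst (_≤ p) (lo-B α f) l , subst (p <_) (hi-B α f) h

        beyond-B⁺ : ¬ Forward α → ∀ {p} → targetPoint α ≤ p → p < k * N → Beyond (just α) p
        beyond-B⁺ f {p} l h = subst (_≤ p) (sym (lo-B α f)) l , subst (p <_) (sym (hi-B α f)) h

        target-rest : Forward α → ∀ {j} → toℕ j ≡ i → Meets (α ∷ D) r j
        target-rest f {j} eq = meets⁺ {α ∷ D} {r} {j} (rest⁺ (target-in (inj₁ refl))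
          (λ b → ℕ.n≮n _ (proj₂ (beyond-F f b))))
            (subst (λ j → j * N ≤ _ × _ < suc j * N) (sym eq) (onTarget α))

        pred-rest : ¬ Forward α → ∀ {j} → toℕ j ≡ i → Meets (α ∷ D) r j
        pred-rest f {j} eq with pred-target α
        ... | q , e , oq = meets⁺ {α ∷ D} {r} {j} (rest⁺ (target-in (inj₂ e))
          (λ b → ℕ.<⇒≱ (ℕ.≤-reflexive e) (proj₁ (beyond-B f b))))
            (subst (λ j → j * N ≤ _ × _ < suc j * N) (sym eq) oq)

        pred-cut : Forward α → ∀ {j} → toℕ j ≡ i → Meets (α ∷ D) (just α) j
        pred-cut f {j} eq with pred-target α
        ... | q , e , oq = meets⁺ {α ∷ D} {just α} {j} (cut⁺ (target-in (inj₂ e))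
          (beyond-F⁺ f (≤side {target α} oq f) (ℕ.≤-reflexive e)))
          (subst (λ j → j * N ≤ _ × _ < suc j * N) (sym eq) oq)

        target-cut : ¬ Forward α → ∀ {j} → toℕ j ≡ i → Meets (α ∷ D) (just α) j
        target-cut f {j} eq = meets⁺ {α ∷ D} {just α} {j} (cut⁺ (target-in (inj₁ refl))
          (beyond-B⁺ f ℕ.≤-refl (end<start α f)))
            (subst (λ j → j * N ≤ _ × _ < suc j * N) (sym eq) (onTarget α))

      meets-target : Meets D r (target α)
      meets-target = meets⁺ {D} {r} {target α} (target-in (inj₁ refl)) (onTarget α)

      -- This lemma and the next seven translate boundary pieces into sides. The source is a vertex,
      -- so α divides no side but its target side; the strict and weak inequalities are chosen so
      -- that side i belongs to the rest as well as to the part cut off.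
      rest-F⁻ : Forward α → ∀ {j} → Meets (α ∷ D) r j → Meets D r j × (toℕ j < k ⊎ i ≤ toℕ j)
      rest-F⁻ f {j} m with meets⁻ {α ∷ D} {r} {j} m
      ... | p , ip , op = meets⁺ {D} {r} {j} (proj₁ (rest⁻ ip)) op , side (k * N ≤? p)
        where
        side : Dec (k * N ≤ p) → toℕ j < k ⊎ i ≤ toℕ j
        side (no l) = inj₁ (side< {j} op (ℕ.≰⇒> l))
        side (yes l) = inj₂ (side-mono {target α} {j} (onTarget α) op
          (ℕ.≮⇒≥ λ h → proj₂ (rest⁻ ip) (beyond-F⁺ f l h)))

      rest-F⁺ : Forward α → ∀ {j} → Meets D r j → toℕ j < k ⊎ i ≤ toℕ j → Meets (α ∷ D) r j
      rest-F⁺ f {j} m e with meets⁻ {D} {r} {j} m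
      rest-F⁺ f {j} m (inj₁ l) | p , ip , op = meets⁺ {α ∷ D} {r} {j}
        (rest⁺ ip λ b → ℕ.<⇒≱ (<side {j} op l) (proj₁ (beyond-F f b))) op
      rest-F⁺ f {j} m (inj₂ l) | p , ip , op with ℕ.m≤n⇒m<n∨m≡n l
      ... | inj₂ eq = target-rest f {j} (sym eq)
      ... | inj₁ l′ = meets⁺ {α ∷ D} {r} {j} (rest⁺ ip λ b → ℕ.<⇒≱
        (ℕ.<-trans (proj₂ (beyond-F f b)) (<side {target α} (onTarget α) l′)) (proj₁ op)) op

      cut-F⁻ : Forward α → ∀ {j} → Meets (α ∷ D) (just α) j → Meets D r j × (k ≤ toℕ j × toℕ j < suc i)
      cut-F⁻ f {j} m with meets⁻ {α ∷ D} {just α} {j} m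
      ... | p , ip , op with cut⁻ ip
      ...   | ip′ , b = meets⁺ {D} {r} {j} ip′ op , side≤ {j} op (proj₁ (beyond-F f b)) ,
        s≤s (side-mono {j} {target α} op (onTarget α) (ℕ.<⇒≤ (proj₂ (beyond-F f b))))

      cut-F⁺ : Forward α → ∀ {j} → Meets D r j → k ≤ toℕ j × toℕ j < suc i → Meets (α ∷ D) (just α) j
      cut-F⁺ f {j} m (l , h) with ℕ.m≤n⇒m<n∨m≡n (ℕ.≤-pred h) | meets⁻ {D} {r} {j} m
      ... | inj₂ eq | _ = pred-cut f {j} eq
      ... | inj₁ h′ | p , ip , op = meets⁺ {α ∷ D} {just α} {j}
        (cut⁺ ip (beyond-F⁺ f (≤side {j} op l) (ℕ.<-trans (<side {j} op h′) (start<target α)))) op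

      rest-B⁻ : ¬ Forward α → ∀ {j} → Meets (α ∷ D) r j → Meets D r j × (toℕ j < suc i ⊎ k ≤ toℕ j)
      rest-B⁻ f {j} m with meets⁻ {α ∷ D} {r} {j} m
      ... | p , ip , op = meets⁺ {D} {r} {j} (proj₁ (rest⁻ ip)) op , side (k * N ≤? p)
        where
        side : Dec (k * N ≤ p) → toℕ j < suc i ⊎ k ≤ toℕ j
        side (yes l) = inj₂ (side≤ {j} op l)
        side (no l) = inj₁ (s≤s (side-mono {j} {target α} op (onTarget α)
          (ℕ.<⇒≤ (ℕ.≰⇒> λ h → proj₂ (rest⁻ ip) (beyond-B⁺ f h (ℕ.≰⇒> l))))))

      rest-B⁺ : ¬ Forward α → ∀ {j} → Meets D r j → toℕ j < suc i ⊎ k ≤ toℕ j → Meets (α ∷ D) r j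
      rest-B⁺ f {j} m e with meets⁻ {D} {r} {j} m
      rest-B⁺ f {j} m (inj₂ l) | p , ip , op = meets⁺ {α ∷ D} {r} {j}
        (rest⁺ ip λ b → ℕ.<⇒≱ (proj₂ (beyond-B f b)) (≤side {j} op l)) op
      rest-B⁺ f {j} m (inj₁ l) | p , ip , op with ℕ.m≤n⇒m<n∨m≡n (ℕ.≤-pred l)
      ... | inj₂ eq = pred-rest f {j} eq
      ... | inj₁ l′ = meets⁺ {α ∷ D} {r} {j} (rest⁺ ip λ b → ℕ.<⇒≱
        (ℕ.<-trans (<side {j} op l′) (start<target α)) (proj₁ (beyond-B f b))) op

      cut-B⁻ : ¬ Forward α → ∀ {j} → Meets (α ∷ D) (just α) j → Meets D r j × (i ≤ toℕ j × toℕ j < k)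
      cut-B⁻ f {j} m with meets⁻ {α ∷ D} {just α} {j} m
      ... | p , ip , op with cut⁻ ip
      ...   | ip′ , b = meets⁺ {D} {r} {j} ip′ op ,
        side-mono {target α} {j} (onTarget α) op (proj₁ (beyond-B f b)) , side< {j} op (proj₂ (beyond-B f b))

      cut-B⁺ : ¬ Forward α → ∀ {j} → Meets D r j → i ≤ toℕ j × toℕ j < k → Meets (α ∷ D) (just α) j
      cut-B⁺ f {j} m (l , h) with ℕ.m≤n⇒m<n∨m≡n l | meets⁻ {D} {r} {j} m
      ... | inj₂ eq | _ = target-cut f {j} (sym eq)
      ... | inj₁ l′ | p , ip , op = meets⁺ {α ∷ D} {just α} {j}
        (cut⁺ ip (beyond-B⁺ f (ℕ.<⇒≤ (ℕ.<-≤-trans (<side {target α} (onTarget α) l′) (proj₁ op)))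
          (<side {j} op h))) op

  -- Source plus offset is i for a forward arrow and N + i for a backward one. Along a side,
  -- therefore, the targets of forward arrows come first, with decreasing sources, and then those of
  -- backward arrows, again with decreasing sources.
  <⇒Forward : ∀ {α β : Arrow N} → toℕ (target α) ≡ toℕ (target β) → Forward β → offset α < offset β →
              Forward α × toℕ (source β) < toℕ (source α)
  <⇒Forward {α} {β} e f o = split α
    (λ g → g , ℕ.≰⇒> λ l → ℕ.<⇒≢ (ℕ.+-mono-≤-< l o)
      (trans (k+offset-F α g) (trans e (sym (k+offset-F β f)))))
    (λ ¬g → contradiction (trans (k+offset-B α ¬g) (cong (N +_) (trans e (sym (k+offset-F β f)))))
      (ℕ.<⇒≢ (ℕ.+-mono-<-≤ (k<N α) (ℕ.≤-trans (ℕ.<⇒≤ o) (ℕ.m≤n+m _ (toℕ (source β)))))))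

  <⇒Backward : ∀ {α β : Arrow N} → toℕ (target α) ≡ toℕ (target β) → ¬ Forward β → offset β < offset α →
               ¬ Forward α × toℕ (source α) < toℕ (source β)
  <⇒Backward {α} {β} e f o = split α
    (λ g → contradiction (trans (k+offset-B β f) (cong (N +_) (trans (sym e) (sym (k+offset-F α g)))))
      (ℕ.<⇒≢ (ℕ.+-mono-<-≤ (k<N β) (ℕ.≤-trans (ℕ.<⇒≤ o) (ℕ.m≤n+m _ (toℕ (source α)))))))
    (λ ¬g → ¬g , ℕ.≰⇒> λ l → ℕ.<⇒≢ (ℕ.+-mono-≤-< l o)
      (trans (k+offset-B β f) (trans (cong (N +_) (sym e)) (sym (k+offset-B α ¬g)))))

  offset-< : ∀ {α β : Arrow N} → toℕ (target α) ≡ toℕ (target β) → targetPoint α < targetPoint β →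
             offset α < offset β
  offset-< {α} {β} e l = ℕ.+-cancelˡ-< (toℕ (target α) * N) _ _
    (subst (λ i → targetPoint α < i * N + offset β) (sym e) l)

  -- On a given side the targets are ordered like the sources seen from that side.

  target-clear : ∀ {α β : Arrow N} {p} → OnSide (target α) p → ¬ Beyond (just β) p →
                 ¬ Straddles β (sourcePoint α) → ¬ Straddles β (targetPoint α)
  target-clear {α} {β} {p} op nb ns (l , h) = split β forward backward
    where
    forward : ¬ Forward β
    forward f with subst (_< targetPoint α) (lo-F β f) l | subst (targetPoint α <_) (hi-F β f) h | lo β ≤? p
    ... | l′ | h′ | no p<lo = ℕ.<⇒≱ (ℕ.<-trans l′ (<side {target α} (onTarget α)
      (side< {target α} {k = toℕ (source β)} op (subst (p <_) (lo-F β f) (ℕ.≰⇒> p<lo))))) ℕ.≤-refl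
    ... | l′ | h′ | yes lo≤p = ns (subst (_< sourcePoint α) (sym (lo-F β f))
      (ℕ.*-monoˡ-< N {{N≢0}} (proj₂ order)) ,
        ℕ.≤-<-trans (ℕ.≤-trans (ℕ.*-monoˡ-≤ N (proj₁ order)) (ℕ.<⇒≤ (start<target α))) h)
      where
      N≢0 = ℕ.>-nonZero (0<N α)
      same : toℕ (target α) ≡ toℕ (target β)
      same = ℕ.≤-antisym (side-mono {target α} {target β} (onTarget α) (onTarget β) (ℕ.<⇒≤ h′))
        (side-mono {target β} {target α} (onTarget β) op (subst (_≤ p) (hi-F β f) (ℕ.≮⇒≥ λ q → nb (lo≤p , q))))
      order = <⇒Forward {α} {β} same f (offset-< {α} {β} same h′)
    backward : ¬ ¬ Forward β
    backward f with subst (_< targetPoint α) (lo-B β f) l | subst (targetPoint α <_) (hi-B β f) h | lo β ≤? p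
    ... | l′ | h′ | yes lo≤p = ℕ.<⇒≱ h′ (ℕ.<⇒≤ (ℕ.≤-<-trans (ℕ.*-monoˡ-≤ N
      (side≤ {target α} {k = toℕ (source β)} op (subst (_≤ p) (hi-B β f) (ℕ.≮⇒≥ λ q → nb (lo≤p , q)))))
        (start<target α)))
    ... | l′ | h′ | no p<lo = ns (ℕ.<-trans l (end<start α (proj₁ order)) ,
        subst (sourcePoint α <_) (sym (hi-B β f)) (ℕ.*-monoˡ-< N {{N≢0}} (proj₂ order)))
      where
      N≢0 = ℕ.>-nonZero (0<N α)
      same : toℕ (target α) ≡ toℕ (target β)
      same = ℕ.≤-antisym
        (side-mono {target α} {target β} op (onTarget β) (ℕ.<⇒≤ (subst (p <_) (lo-B β f) (ℕ.≰⇒> p<lo))))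
        (side-mono {target β} {target α} (onTarget β) (onTarget α) (ℕ.<⇒≤ l′))
      order = <⇒Backward {α} {β} same f (offset-< {β} {α} (sym same) l′)

  -- Offsets matter only if α and ρ end on the same side. Then a target of α outside the part cut
  -- off by ρ would, by the order of targets on that side, put the source of α outside too.
  target-inside : ∀ {α ρ : Arrow N} {p} → OnSide (target α) p → Beyond (just ρ) p →
                  Inside (just ρ) (sourcePoint α) → Inside (just ρ) (targetPoint α)
  target-inside {α} {ρ} {p} op (bl , bh) (sl , sh) = split ρ forward backward
    where
    instance
      N≢0 : ℕ.NonZero N
      N≢0 = ℕ.>-nonZero (0<N α)
    forward : Forward ρ → lo ρ ≤ targetPoint α × targetPoint α ≤ hi ρ
    forward f = subst (_≤ targetPoint α) (sym (lo-F ρ f)) (ℕ.<⇒≤ (ℕ.≤-<-trans (ℕ.*-monoˡ-≤ N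
        (side≤ {target α} {k = toℕ (source ρ)} op (subst (_≤ p) (lo-F ρ f) bl))) (start<target α))) ,
      subst (targetPoint α ≤_) (sym (hi-F ρ f)) (ℕ.≮⇒≥ above)
      where
      above : ¬ targetPoint ρ < targetPoint α
      above l = ℕ.<⇒≱ (proj₂ (<⇒Forward {ρ} {α} (sym same) g (offset-< {ρ} {α} (sym same) l)))
        (ℕ.*-cancelʳ-≤ (toℕ (source ρ)) (toℕ (source α)) N (subst (_≤ sourcePoint α) (lo-F ρ f) sl))
        where
        same : toℕ (target α) ≡ toℕ (target ρ)
        same = ℕ.≤-antisym (side-mono {target α} {target ρ} op (onTarget ρ)
          (ℕ.<⇒≤ (subst (p <_) (hi-F ρ f) bh)))
          (side-mono {target ρ} {target α} (onTarget ρ) (onTarget α) (ℕ.<⇒≤ l))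
        g : Forward α
        g = subst (toℕ (source α) ≤_) (sym same)
          (side≤ {target ρ} {k = toℕ (source α)} (onTarget ρ) (subst (sourcePoint α ≤_) (hi-F ρ f) sh))
    backward : ¬ Forward ρ → lo ρ ≤ targetPoint α × targetPoint α ≤ hi ρ
    backward f = subst (_≤ targetPoint α) (sym (lo-B ρ f)) (ℕ.≮⇒≥ below) ,
      subst (targetPoint α ≤_) (sym (hi-B ρ f)) (ℕ.<⇒≤ (<side {target α} (onTarget α)
        (side< {target α} {k = toℕ (source ρ)} op (subst (p <_) (hi-B ρ f) bh))))
      where
      below : ¬ targetPoint α < targetPoint ρ
      below l = ℕ.<⇒≱ (proj₂ (<⇒Backward {ρ} {α} (sym same) g (offset-< {α} {ρ} same l)))
        (ℕ.*-cancelʳ-≤ (toℕ (source α)) (toℕ (source ρ)) N (subst (sourcePoint α ≤_) (hi-B ρ f) sh))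
        where
        same : toℕ (target α) ≡ toℕ (target ρ)
        same = ℕ.≤-antisym (side-mono {target α} {target ρ} (onTarget α) (onTarget ρ) (ℕ.<⇒≤ l))
          (side-mono {target ρ} {target α} (onTarget ρ) op (subst (_≤ p) (lo-B ρ f) bl))
        g : ¬ Forward α
        g l′ = ℕ.<⇒≱ (ℕ.<-≤-trans (start<target ρ) (subst (_≤ sourcePoint α) (lo-B ρ f) sl))
          (ℕ.*-monoˡ-≤ N (subst (toℕ (source α) ≤_) same l′))

  -- Vertices and sides on the boundary of a region

  Reversed : Region N → Set
  Reversed nothing  = ⊥
  Reversed (just ρ) = ¬ Forward ρ

  reversed? : ∀ r → Dec (Reversed r)
  reversed? nothing  = no λ ()
  reversed? (just ρ) = ¬? (forward? ρ)

  meets-bounds-F : ∀ {D ρ j} → Forward ρ → Meets D (just ρ) j →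
                   toℕ (source ρ) ≤ toℕ j × toℕ j ≤ toℕ (target ρ)
  meets-bounds-F {D} {ρ} {j} f m with meets⁻ {D} {just ρ} {j} m
  ... | p , ((l , h) , _) , op = side≤ {j} {k = toℕ (source ρ)} op (subst (_≤ p) (lo-F ρ f) l) ,
    side-mono {j} {target ρ} op (onTarget ρ) (ℕ.<⇒≤ (subst (p <_) (hi-F ρ f) h))

  meets-bounds-B : ∀ {D ρ j} → ¬ Forward ρ → Meets D (just ρ) j →
                   toℕ (target ρ) ≤ toℕ j × toℕ j < toℕ (source ρ)
  meets-bounds-B {D} {ρ} {j} f m with meets⁻ {D} {just ρ} {j} m
  ... | p , ((l , h) , _) , op = side-mono {target ρ} {j} (onTarget ρ) op (subst (_≤ p) (lo-B ρ f) l) ,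
    side< {j} {k = toℕ (source ρ)} op (subst (p <_) (hi-B ρ f) h)

  gap-F : ∀ {D r β j} → β ∈ D → r ≺ just β → Forward β → Meets D r j →
          toℕ (source β) ≤ toℕ j → ¬ toℕ j < toℕ (target β)
  gap-F {D} {r} {β} {j} β∈ r≺β f m l h with meets⁻ {D} {r} {j} m
  ... | p , (_ , free) , op = All.lookup free β∈ r≺β
    ( subst (_≤ p) (sym (lo-F β f)) (≤side {j} op l)
    , subst (p <_) (sym (hi-F β f)) (ℕ.<-trans (<side {j} op h) (start<target β)))

  gap-B : ∀ {D r β j} → β ∈ D → r ≺ just β → ¬ Forward β → Meets D r j →
          toℕ (target β) < toℕ j → ¬ toℕ j < toℕ (source β)
  gap-B {D} {r} {β} {j} β∈ r≺β f m l h with meets⁻ {D} {r} {j} m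
  ... | p , (_ , free) , op = All.lookup free β∈ r≺β
    ( subst (_≤ p) (sym (lo-B β f)) (ℕ.<⇒≤ (ℕ.<-≤-trans (proj₂ (onTarget β)) (≤side {j} op l)))
    , subst (p <_) (sym (hi-B β f)) (<side {j} op h))

  -- The first vertex of the polygon of r is v_0 for the root region and otherwise the source of its
  -- arrow, which contraction joins to the root side. In a reversed region it comes after all sides
  -- in the numbering of π.
  first-vertex : 0 < N → ∀ D r → ∃ λ (k : Fin N) → Exposed D r (toℕ k * N) ×
    (¬ Reversed r → ∀ {j} → Meets D r j → toℕ k ≤ toℕ j) ×
    (Reversed r → ∀ {j} → Meets D r j → toℕ j < toℕ k)
  first-vertex 0<N D nothing = fromℕ< 0<N ,
    subst (λ k → Exposed D nothing (k * N)) (sym 0≡) (tt , All.tabulate λ _ _ ()) ,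
    (λ _ {j} _ → subst (_≤ toℕ j) (sym 0≡) z≤n) , (λ ())
    where
    0≡ : toℕ (fromℕ< 0<N) ≡ 0
    0≡ = Fin.toℕ-fromℕ< 0<N
  first-vertex 0<N D (just ρ) = source ρ ,
    ((lo≤source ρ , source≤hi ρ) , All.tabulate λ _ → free) ,
    (λ ¬r {j} m → split ρ (λ f → proj₁ (meets-bounds-F {D} {ρ} {j} f m)) (λ ¬f → contradiction ¬f ¬r)) ,
    (λ ¬f {j} m → proj₂ (meets-bounds-B {D} {ρ} {j} ¬f m))
    where
    free : ∀ {β} → just ρ ≺ just β → ¬ Straddles β (sourcePoint ρ)
    free {β} (_ , l , h) (l′ , h′) = split ρ
      (λ f → ℕ.<⇒≱ l′ (subst (_≤ lo β) (lo-F ρ f) l))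
      (λ f → ℕ.<⇒≱ h′ (subst (hi β ≤_) (hi-B ρ f) h))

  -- The last side in the orientation of r. As every exposed vertex precedes it in this orientation,
  -- it bounds the numbers of the sources in `index-source<`.
  root-side : 0 < N → ∀ D r → ∃ λ j → Meets D r j ×
    (¬ Reversed r → ∀ {k : Fin N} → Exposed D r (toℕ k * N) → toℕ k ≤ toℕ j) ×
    (Reversed r → ∀ {k : Fin N} → Exposed D r (toℕ k * N) → toℕ j < toℕ k)
  root-side 0<N D nothing with N ∸ 1 | ℕ.m+[n∸m]≡n 0<N
  -- The last piece M N + M of the root side lies beyond no arrow: sources are at most M N, and
  -- targets at most M N + M.
  ... | M | eq = fromℕ< M<N , meets⁺ {D} {nothing} {fromℕ< M<N} {M * N + M}
      (tt , All.tabulate λ {β} _ _ (_ , h) → ℕ.<⇒≱ h (hi≤ β))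
      (subst (λ x → x * N ≤ M * N + M) (sym M≡) (ℕ.m≤m+n _ _) ,
       subst (λ x → M * N + M < suc x * N) (sym M≡)
         (subst (M * N + M <_) (ℕ.+-comm _ N) (ℕ.+-monoʳ-< (M * N) M<N))) ,
      (λ _ {k} _ → subst (toℕ k ≤_) (sym M≡) (≤M (Fin.toℕ<n k))) , (λ ())
    where
    M<N : M < N
    M<N = ℕ.≤-reflexive eq
    M≡ : toℕ (fromℕ< M<N) ≡ M
    M≡ = Fin.toℕ-fromℕ< M<N
    ≤M : ∀ {a} → a < N → a ≤ M
    ≤M l = ℕ.≤-pred (subst (_ <_) (sym eq) l)
    hi≤ : ∀ β → hi β ≤ M * N + M
    hi≤ β = ℕ.⊔-lub (ℕ.≤-trans (ℕ.*-monoˡ-≤ N (≤M (k<N β))) (ℕ.m≤m+n _ _))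
      (ℕ.+-mono-≤ (ℕ.*-monoˡ-≤ N (≤M (i<N β))) (≤M (offset<N β)))
  root-side 0<N D (just ρ) = target ρ , split ρ meets-F meets-B ,
    (λ ¬r {k} (( _ , h) , _) → split ρ
      (λ f → side≤ {target ρ} {k = toℕ k} (onTarget ρ) (subst (toℕ k * N ≤_) (hi-F ρ f) h))
      (λ ¬f → contradiction ¬f ¬r)) ,
    (λ ¬f {k} ((l , _) , _) → ℕ.*-cancelʳ-< N _ (toℕ k)
      (ℕ.<-≤-trans (start<target ρ) (subst (_≤ toℕ k * N) (lo-B ρ ¬f) l)))
    where
    meets-F : Forward ρ → Meets D (just ρ) (target ρ)
    meets-F f with pred-target ρ
    ... | q , e , oq = meets⁺ {D} {just ρ} {target ρ}
      ((ℕ.≤-pred (subst (lo ρ <_) eq (lo<hi ρ)) , ℕ.≤-reflexive (sym eq)) , All.tabulate λ {β} _ → free {β}) oq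
      where
      eq : hi ρ ≡ suc q
      eq = trans (hi-F ρ f) (sym e)
      free : ∀ {β} → just ρ ≺ just β → ¬ Beyond (just β) q
      free {β} (ne , _ , h) (_ , h′) = target≢hi {ρ} {β} ne
        (trans (sym (hi-F ρ f)) (ℕ.≤-antisym (subst (_≤ hi β) (sym eq) h′) h))
    meets-B : ¬ Forward ρ → Meets D (just ρ) (target ρ)
    meets-B f = meets⁺ {D} {just ρ} {target ρ}
      ((lo≤target ρ , subst (_< hi ρ) (lo-B ρ f) (lo<hi ρ)) , All.tabulate λ {β} _ → free {β}) (onTarget ρ)
      where
      free : ∀ {β} → just ρ ≺ just β → ¬ Beyond (just β) (targetPoint ρ)
      free {β} (ne , l , _) (l′ , _) = target≢lo {ρ} {β} ne
        (ℕ.≤-antisym (subst (_≤ lo β) (lo-B ρ f) l) l′)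

  beyond-inside : ∀ r {x y} → Inside r x → Inside r y → x < y → Beyond r x
  beyond-inside nothing _ _ _ = tt
  beyond-inside (just ρ) (l , _) (_ , h) lt = l , ℕ.<-≤-trans lt h

  inside-between : ∀ r {p q x} → Beyond r p → Beyond r q → p < x → x ≤ q → Inside r x
  inside-between nothing _ _ _ _ = tt
  inside-between (just ρ) (l , _) (_ , h) px xq = ℕ.≤-trans l (ℕ.<⇒≤ px) , ℕ.≤-trans xq (ℕ.<⇒≤ h)

  module Boundary {D : List (Arrow N)} (comp : AllPairs Compatible D)
                  {r : Region N} (r∈ : r ∈ nothing ∷ map just D) where
    open Regions comp

    -- Arrows below r strictly cover neither end of α, so they do not cross it. The others contain
    -- r, are its arrow or lie beside it, and stand in the same relation to α, whose interval lies
    -- in that of r. The last hypothesis excludes arrows of D, since these too may join an exposed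
    -- vertex to a side of r.
    addable⁺ : ∀ {α} → Exposed D r (sourcePoint α) → Meets D r (target α) → r ≢ just α →
               (∀ {β} → β ∈ D → r ≺ just β → α ≢ β) → Addable D r α
    addable⁺ {α} (ins , exp) m r≢α new with meets⁻ {D} {r} {target α} m
    ... | p , (bp , free) , op = All.tabulate compat , r≺α , All.tabulate nested
      where
      contained : ∀ s → r ≡ s → s ≺ just α
      contained nothing _ = tt
      contained (just ρ) refl with target-inside {α} {ρ} op bp ins
      ... | l , h = (λ { refl → r≢α refl }) ,
        split α (λ f → subst (lo ρ ≤_) (sym (lo-F α f)) (proj₁ ins))
          (λ f → subst (lo ρ ≤_) (sym (lo-B α f)) l) ,
        split α (λ f → subst (_≤ hi ρ) (sym (hi-F α f)) h) (λ f → subst (_≤ hi ρ) (sym (hi-B α f)) (proj₂ ins))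
      r≺α : r ≺ just α
      r≺α = contained r refl
      clear : ∀ {β} → β ∈ D → r ≺ just β → ¬ Straddles β (sourcePoint α) × ¬ Straddles β (targetPoint α)
      clear {β} β∈ r≺β = All.lookup exp β∈ r≺β ,
        target-clear {α} {β} op (All.lookup free β∈ r≺β) (All.lookup exp β∈ r≺β)
      ends : ∀ {β} → β ∈ D → r ≺ just β → ¬ Straddles β (lo α) × ¬ Straddles β (hi α)
      ends {β} β∈ r≺β with clear β∈ r≺β
      ... | s , t = split α (λ f → subst (¬_ ∘ Straddles β) (sym (lo-F α f)) s , subst (¬_ ∘ Straddles β)
        (sym (hi-F α f)) t)
        (λ f → subst (¬_ ∘ Straddles β) (sym (lo-B α f)) t , subst (¬_ ∘ Straddles β) (sym (hi-B α f)) s)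
      compat : ∀ {β} → β ∈ D → Compatible α β
      compat {β} β∈ = relate r r∈ refl (Maybe.≡-dec _≟ᴬ_ (just β) r)
        where
        below : r ≺ just β → Compatible α β
        below r≺β = new β∈ r≺β , λ
          { (inj₁ (l , m , h)) → proj₂ (ends β∈ r≺β) (m , h)
          ; (inj₂ (l , m , h)) → proj₁ (ends β∈ r≺β) (l , m) }
        relate : ∀ s → s ∈ nothing ∷ map just D → r ≡ s → Dec (just β ≡ s) → Compatible α β
        relate nothing _ refl _ = below tt
        relate (just ρ) _ refl (yes refl) = (λ { refl → r≢α refl }) , λ
          { (inj₁ (l , m , h)) → ℕ.<⇒≱ l (proj₁ (proj₂ r≺α))
          ; (inj₂ (l , m , h)) → ℕ.<⇒≱ h (proj₂ (proj₂ r≺α)) }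
        relate (just ρ) s∈ refl (no ne) with position (compatible-in (just-∈⁻ s∈) β∈ (λ { refl → ne refl }))
        ... | outside p = below p
        ... | inside p = (λ { refl → ≺-asym {ρ} {α} r≺α p }) , λ
          { (inj₁ (l , m , h)) → ℕ.<⇒≱ l (ℕ.≤-trans (proj₁ (proj₂ p)) (proj₁ (proj₂ r≺α)))
          ; (inj₂ (l , m , h)) → ℕ.<⇒≱ h (ℕ.≤-trans (proj₂ (proj₂ r≺α)) (proj₂ (proj₂ p))) }
        ... | before p = (λ { refl → ℕ.<⇒≱ (lo<hi β) (ℕ.≤-trans (proj₂ (proj₂ r≺α)) p) }) , λ
          { (inj₁ (l , m , h)) → ℕ.<⇒≱ m (ℕ.≤-trans (proj₂ (proj₂ r≺α)) p)
          ; (inj₂ (l , m , h)) → ℕ.<⇒≱ (ℕ.≤-<-trans p l) (ℕ.≤-trans (ℕ.<⇒≤ (lo<hi α)) (proj₂ (proj₂ r≺α))) }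
        ... | after p = (λ { refl → ℕ.<⇒≱ (lo<hi β) (ℕ.≤-trans p (proj₁ (proj₂ r≺α))) }) , λ
          { (inj₁ (l , m , h)) → ℕ.<⇒≱ (ℕ.<-≤-trans (ℕ.≤-<-trans (proj₁ (proj₂ r≺α)) l) (ℕ.<⇒≤ (lo<hi β))) p
          ; (inj₂ (l , m , h)) → ℕ.<⇒≱ m (ℕ.≤-trans p (proj₁ (proj₂ r≺α))) }
      nested : ∀ {β} → β ∈ D → r ≺ just β → ¬ just β ≺ just α
      nested {β} β∈ r≺β (ne , l , h) = proj₂ (clear β∈ r≺β)
        ( ℕ.≤∧≢⇒< (ℕ.≤-trans l (lo≤target α)) (target≢lo {α} {β} (new β∈ r≺β) ∘ sym)
        , ℕ.≤∧≢⇒< (ℕ.≤-trans (target≤hi α) h) (target≢hi {α} {β} (new β∈ r≺β)))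

    -- The next two lemmas say that the exposed vertices and the sides of a region alternate.

    meets-between : ∀ {k k′ : Fin N} → Exposed D r (toℕ k * N) → Exposed D r (toℕ k′ * N) → toℕ k < toℕ k′ →
                    ∃ λ j → Meets D r j × toℕ k ≤ toℕ j × toℕ j < toℕ k′
    meets-between {k} {k′} (ins , exp) (ins′ , exp′) k<k′ = search (maximal P? hi D)
      where
      instance
        N≢0 : ℕ.NonZero N
        N≢0 = ℕ.>-nonZero (ℕ.≤-<-trans z≤n (Fin.toℕ<n k))
      kN<k′N : toℕ k * N < toℕ k′ * N
      kN<k′N = ℕ.*-monoˡ-< N k<k′
      P : Arrow N → Set
      P β = r ≺ just β × lo β ≡ toℕ k * N
      P? : ∀ β → Dec (P β)
      P? β = (r ≺? just β) ×-dec (lo β ℕ.≟ toℕ k * N)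
      search : (∀ {β} → β ∈ D → ¬ P β) ⊎
               (∃ λ β → β ∈ D × P β × (∀ {γ} → γ ∈ D → P γ → hi γ ≤ hi β)) → _
      -- If no forward arrow of D below r leaves vertex k, the piece next to this vertex on side k
      -- belongs to r.
      search (inj₁ none) = k , meets⁺ {D} {r} {k} (beyond-inside r ins ins′ kN<k′N , All.tabulate free)
          (ℕ.≤-refl , ℕ.m<n+m _ (ℕ.≤-<-trans z≤n (Fin.toℕ<n k))) , ℕ.≤-refl , k<k′
        where
        free : ∀ {β} → β ∈ D → r ≺ just β → ¬ Beyond (just β) (toℕ k * N)
        free β∈ r≺β (l , h) with ℕ.m≤n⇒m<n∨m≡n l
        ... | inj₁ l′ = All.lookup exp β∈ r≺β (l′ , h)
        ... | inj₂ eq = none β∈ (r≺β , eq)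
      -- Among the forward arrows leaving vertex k take the one with the farthest target. An arrow
      -- covering this target would contain β, and so either start at vertex k and reach farther or
      -- hide the exposed vertex k.
      search (inj₂ (β , β∈ , (r≺β , loβ) , max)) = target β ,
          meets⁺ {D} {r} {target β} (beyond-target′ r≺β , All.tabulate free) (onTarget β) ,
          side≤ {target β} {k = toℕ k} (onTarget β) (ℕ.≤-trans (ℕ.≤-reflexive (sym loβ)) (lo≤target β)) ,
          ℕ.*-cancelʳ-< N _ _ (ℕ.<-≤-trans (start<target β) (subst (_≤ toℕ k′ * N) hiβ
            (ℕ.≮⇒≥ λ l → All.lookup exp′ β∈ r≺β (subst (_< toℕ k′ * N) (sym loβ) kN<k′N , l))))
        where
        fβ : Forward β
        fβ = lo-vertex {α = β} {toℕ k} loβ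
        hiβ : hi β ≡ targetPoint β
        hiβ = hi-F β fβ
        beyond-target′ : r ≺ just β → Beyond r (targetPoint β)
        beyond-target′ = go r
          where
          go : ∀ r → r ≺ just β → Beyond r (targetPoint β)
          go nothing _ = tt
          go (just ρ) (ne , l , h) = ℕ.≤-trans l (lo≤target β) ,
            ℕ.≤∧≢⇒< (ℕ.≤-trans (target≤hi β) h) (target≢hi {β} {ρ} (ne ∘ sym))
        free : ∀ {γ} → γ ∈ D → r ≺ just γ → ¬ Beyond (just γ) (targetPoint β)
        free {γ} γ∈ r≺γ (l , h) with β ≟ᴬ γ
        ... | yes refl = ℕ.<⇒≢ h (sym hiβ)
        ... | no ne with position (compatible-in β∈ γ∈ ne)
        ...   | outside (_ , _ , h′) = ℕ.<⇒≱ h (subst (hi γ ≤_) hiβ h′)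
        ...   | before b = target≢lo {β} {γ} ne (ℕ.≤-antisym (subst (_≤ lo γ) hiβ b) l)
        ...   | after b = ℕ.<⇒≱ h (ℕ.≤-trans b (lo≤target β))
        ...   | inside (_ , l′ , _) with ℕ.m≤n⇒m<n∨m≡n l′
        ...     | inj₂ eq = ℕ.<⇒≱ h (subst (hi γ ≤_) hiβ (max γ∈ (r≺γ , trans eq loβ)))
        ...     | inj₁ l″ = All.lookup exp γ∈ r≺γ (subst (lo γ <_) loβ l″ ,
                  ℕ.≤-<-trans (ℕ.≤-reflexive (sym loβ)) (ℕ.≤-<-trans (lo≤target β) h))

    exposed-between : ∀ {i j} → Meets D r i → Meets D r j → toℕ i < toℕ j →
                      ∃ λ (k : Fin N) → Exposed D r (toℕ k * N) × toℕ i < toℕ k × toℕ k ≤ toℕ j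
    exposed-between {i} {j} mi mj i<j with meets⁻ {D} {r} {i} mi | meets⁻ {D} {r} {j} mj
    ... | p , (bp , fp) , op | q , (bq , fq) , oq = search (maximal P? hi D)
      where
      v : ℕ
      v = suc (toℕ i) * N
      v≤q : v ≤ q
      v≤q = ≤side {j} oq i<j
      P : Arrow N → Set
      P β = r ≺ just β × Straddles β v
      P? : ∀ β → Dec (P β)
      P? β = (r ≺? just β) ×-dec (lo β <? v) ×-dec (v <? hi β)
      search : (∀ {β} → β ∈ D → ¬ P β) ⊎
               (∃ λ β → β ∈ D × P β × (∀ {γ} → γ ∈ D → P γ → hi γ ≤ hi β)) → _
      search (inj₁ none) = k , (subst (λ k → Exposed D r (k * N)) (sym k≡)
          (inside-between r bp bq (proj₂ op) v≤q , All.tabulate λ β∈ r≺β s → none β∈ (r≺β , s))) ,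
          ℕ.≤-reflexive (sym k≡) , ℕ.≤-trans (ℕ.≤-reflexive k≡) i<j
        where
        k = fromℕ< (ℕ.≤-<-trans i<j (Fin.toℕ<n j))
        k≡ : toℕ k ≡ suc (toℕ i)
        k≡ = Fin.toℕ-fromℕ< _
      -- β covers the end v of side i but not p, so its lower end is strictly inside side i and is
      -- not a vertex. Hence β is backward, its upper end is a vertex, and this vertex is exposed
      -- because β reaches farthest.
      search (inj₂ (β , β∈ , (r≺β , l , h) , max)) = source β ,
          subst (Exposed D r) hiβ (inside-between r bp bq (ℕ.<-trans (proj₂ op) h) hi≤q , All.tabulate free) ,
          ℕ.<⇒≤ (ℕ.*-cancelʳ-< N (suc (toℕ i)) _ (subst (v <_) hiβ h)) ,
          side≤ {j} {k = toℕ (source β)} oq (subst (_≤ q) hiβ hi≤q)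
        where
        p<lo : p < lo β
        p<lo = ℕ.≰⇒> λ lo≤p → All.lookup fp β∈ r≺β (lo≤p , ℕ.<-trans (proj₂ op) h)
        hi≤q : hi β ≤ q
        hi≤q = ℕ.≮⇒≥ λ q<hi → All.lookup fq β∈ r≺β (ℕ.≤-trans (ℕ.<⇒≤ l) v≤q , q<hi)
        ¬fβ : ¬ Forward β
        ¬fβ f = ℕ.<⇒≱ (side< {i} {k = toℕ (source β)} op (subst (p <_) (lo-F β f) p<lo))
          (ℕ.≤-pred (ℕ.*-cancelʳ-< N _ (suc (toℕ i)) (subst (_< v) (lo-F β f) l)))
        hiβ : hi β ≡ sourcePoint β
        hiβ = hi-B β ¬fβ
        free : ∀ {γ} → γ ∈ D → r ≺ just γ → ¬ Straddles γ (hi β)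
        free {γ} γ∈ r≺γ (l′ , h′) with position (compatible-in β∈ γ∈ λ { refl → ℕ.n≮n _ h′ })
        ... | outside (_ , _ , x) = ℕ.<⇒≱ h′ x
        ... | inside (_ , x , _) = ℕ.<⇒≱ h′ (max γ∈ (r≺γ , ℕ.≤-<-trans x l , ℕ.<-trans h h′))
        ... | before x = ℕ.<⇒≱ l′ x
        ... | after x = ℕ.<⇒≱ h′ (ℕ.≤-trans x (ℕ.<⇒≤ (lo<hi β)))

-- Cutting lists

-- The pairs (vertex, side) of the non-trivial arrows of an m-gon, both numbered from 0.

Valid : ℕ → ℕ × ℕ → Set
Valid m (k , i) = k < m × i < m × k ≢ i × k ≢ suc i × ¬ (k ≡ 0 × suc i ≡ m)

module _ {A : Set} where

  filter-filter : ∀ {P Q R : A → Set} (P? : Decidable P) (Q? : Decidable Q) (R? : Decidable R) →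
                  (∀ {x} → R x → P x × Q x) → (∀ {x} → P x → Q x → R x) →
                  ∀ xs → filter R? xs ≡ filter Q? (filter P? xs)
  filter-filter P? Q? R? f g [] = refl
  filter-filter P? Q? R? f g (x ∷ xs) with P? x
  ... | no ¬p = trans (filter-reject R? (¬p ∘ proj₁ ∘ f)) (filter-filter P? Q? R? f g xs)
  ... | yes p with Q? x
  ...   | yes q = trans (filter-accept R? (g p q)) (cong (x ∷_) (filter-filter P? Q? R? f g xs))
  ...   | no ¬q = trans (filter-reject R? (¬q ∘ proj₂ ∘ f)) (filter-filter P? Q? R? f g xs)

  split-at : ∀ (xs : List A) d → d < length xs → ∃ λ ys → ∃ λ x → ∃ λ zs → xs ≡ ys ++ x ∷ zs × length ys ≡ d
  split-at (x ∷ xs) zero l = [] , x , xs , refl , refl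
  split-at (x ∷ xs) (suc d) (s≤s l) with split-at xs d l
  ... | ys , y , zs , refl , refl = x ∷ ys , y , zs , refl , refl

  take-length : ∀ (xs : List A) {ys} → take (length xs) (xs ++ ys) ≡ xs
  take-length [] = refl
  take-length (x ∷ xs) = cong (x ∷_) (take-length xs)

  drop-length : ∀ (xs : List A) {ys} → drop (length xs) (xs ++ ys) ≡ ys
  drop-length [] = refl
  drop-length (x ∷ xs) = drop-length xs

  reverse-insert : ∀ xs (y : A) zs → reverse (xs ++ y ∷ zs) ≡ reverse zs ++ y ∷ reverse xs
  reverse-insert xs y zs = begin
    reverse (xs ++ y ∷ zs)                   ≡⟨ reverse-++ xs (y ∷ zs) ⟩
    reverse (y ∷ zs) ++ reverse xs           ≡⟨ cong (_++ reverse xs) (unfold-reverse y zs) ⟩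
    (reverse zs ++ y ∷ []) ++ reverse xs     ≡⟨ ++-assoc (reverse zs) (y ∷ []) (reverse xs) ⟩
    reverse zs ++ y ∷ reverse xs             ∎
    where open ≡-Reasoning

  -- π^rt and π^co for the arrow from vertex k to side i, both numbered from 0.

  rtN coN : List A → ℕ → ℕ → List A
  rtN xs k i with k ≤? i
  ... | yes _ = take k xs ++ drop i xs
  ... | no _  = take (suc i) xs ++ drop k xs
  coN xs k i with k ≤? i
  ... | yes _ = drop k (take (suc i) xs)
  ... | no _  = reverse (drop i (take k xs))

  -- Block lengths replace positions: y is the target side, shared by `rest` and `cut`, and
  -- reversing σ turns each constructor into the other. F stands for the direction and is later
  -- `ForwardIn r α`.
  data Cut (F : Set) (σ : List A) (k i : ℕ) (rest cut : List A) : Set where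
    forward  : F → ∀ X Y y Z → σ ≡ X ++ Y ++ y ∷ Z → k ≡ length X → i ≡ length X + length Y →
               rest ≡ X ++ y ∷ Z → cut ≡ Y ++ y ∷ [] → Cut F σ k i rest cut
    backward : ¬ F → ∀ X Y y Z → σ ≡ X ++ y ∷ Y ++ Z → k ≡ length X + suc (length Y) → i ≡ length X →
               rest ≡ X ++ y ∷ Z → cut ≡ reverse (y ∷ Y) → Cut F σ k i rest cut

  private
    assoc : ∀ (X : List A) y {Z} → X ++ y ∷ Z ≡ (X ++ y ∷ []) ++ Z
    assoc X y {Z} = sym (++-assoc X (y ∷ []) Z)

    take-insert : ∀ (X : List A) y {Z} → take (suc (length X)) (X ++ y ∷ Z) ≡ X ++ y ∷ []
    take-insert [] y = refl
    take-insert (x ∷ X) y = cong (x ∷_) (take-insert X y)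

    drop-+ : ∀ (X Y : List A) {Z} → drop (length X + length Y) (X ++ Y ++ Z) ≡ Z
    drop-+ [] Y = drop-length Y
    drop-+ (x ∷ X) Y = drop-+ X Y

    middle : ∀ (X Y : List A) {Z} → drop (length X) (take (length X + length Y) (X ++ Y ++ Z)) ≡ Y
    middle [] Y = take-length Y
    middle (x ∷ X) Y = middle X Y

    middle′ : ∀ (X Y : List A) y {Z} → drop (length X) (take (suc (length X + length Y)) (X ++ Y ++ y ∷ Z))
      ≡ Y ++ y ∷ []
    middle′ [] Y y = take-insert Y y
    middle′ (x ∷ X) Y y = middle′ X Y y

  rtN-cut : ∀ {F σ k i rest cut} → Cut F σ k i rest cut → rest ≡ rtN σ k i
  rtN-cut (forward _ X Y y Z refl refl refl refl refl) with length X ≤? length X + length Y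
  ... | yes _ = sym (cong₂ _++_ (take-length X) (drop-+ X Y))
  ... | no ¬l = contradiction (ℕ.m≤m+n (length X) (length Y)) ¬l
  rtN-cut (backward _ X Y y Z refl refl refl refl refl) with length X + suc (length Y) ≤? length X
  ... | yes l = contradiction l (ℕ.<⇒≱ (ℕ.m<m+n (length X) (s≤s z≤n)))
  ... | no _ = trans (assoc X y) (sym (cong₂ _++_ (take-insert X y) (drop-+ X (y ∷ Y))))

  coN-cut : ∀ {F σ k i rest cut} → Cut F σ k i rest cut → cut ≡ coN σ k i
  coN-cut (forward _ X Y y Z refl refl refl refl refl) with length X ≤? length X + length Y
  ... | yes _ = sym (middle′ X Y y)
  ... | no ¬l = contradiction (ℕ.m≤m+n (length X) (length Y)) ¬l
  coN-cut (backward _ X Y y Z refl refl refl refl refl) with length X + suc (length Y) ≤? length X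
  ... | yes l = contradiction l (ℕ.<⇒≱ (ℕ.m<m+n (length X) (s≤s z≤n)))
  ... | no _ = cong reverse (sym (middle X (y ∷ Y)))

  -- The target side y is counted twice. Hence the weights, one less than the numbers of sides, add
  -- up.
  length-cut-sum : ∀ {F σ k i rest cut} → Cut F σ k i rest cut → suc (length σ) ≡ length rest + length cut
  length-cut-sum (forward _ X Y y Z refl refl refl refl refl) = begin
    suc (length (X ++ Y ++ y ∷ Z)) ≡⟨ cong suc (trans (length-++ X) (cong (length X +_) (length-++ Y))) ⟩
    suc (x + (b + suc z))          ≡⟨ cong suc
      (trans (cong (x +_) (ℕ.+-comm b (suc z))) (sym (ℕ.+-assoc x (suc z) b))) ⟩
    suc (x + suc z + b)            ≡⟨ ℕ.+-suc (x + suc z) b ⟨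
    x + suc z + suc b              ≡⟨ cong₂ _+_ (length-++ X) (trans (length-++ Y) (ℕ.+-comm b 1)) ⟨
    length (X ++ y ∷ Z) + length (Y ++ y ∷ []) ∎
    where
    open ≡-Reasoning
    x = length X
    b = length Y
    z = length Z
  length-cut-sum (backward _ X Y y Z refl refl refl refl refl) = begin
    suc (length (X ++ y ∷ Y ++ Z)) ≡⟨ cong suc (trans (length-++ X) (cong (λ n → x + suc n) (length-++ Y))) ⟩
    suc (x + suc (b + z))          ≡⟨ cong suc
      (trans (cong (λ n → x + suc n) (ℕ.+-comm b z)) (sym (ℕ.+-assoc x (suc z) b))) ⟩
    suc (x + suc z + b)            ≡⟨ ℕ.+-suc (x + suc z) b ⟨
    x + suc z + suc b              ≡⟨ cong₂ _+_ (length-++ X) (length-reverse (y ∷ Y)) ⟨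
    length (X ++ y ∷ Z) + length (reverse (y ∷ Y)) ∎
    where
    open ≡-Reasoning
    x = length X
    b = length Y
    z = length Z

  -- If the source were an endpoint of the target side, one of the two polygons would have a single
  -- side. Thus non-triviality can be read off from the sizes.
  cut-valid : ∀ {F σ k i rest cut} → Cut F σ k i rest cut → k < length σ → 2 ≤ length rest → 2 ≤ length cut →
              Valid (length σ) (k , i)
  cut-valid (forward _ X Y y Z refl refl refl refl refl) k<m two-r two-c =
    k<m , subst (x + b <_) (sym len) (ℕ.+-monoʳ-< x (ℕ.m<m+n b (s≤s z≤n))) ,
    (λ e → ℕ.<⇒≢ 0<b (ℕ.+-cancelˡ-≡ x 0 b (trans (ℕ.+-identityʳ x) e))) ,
    ℕ.<⇒≢ (s≤s (ℕ.m≤m+n x b)) ,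
    λ { (e , e′) → ℕ.<⇒≱ two-r (ℕ.≤-reflexive (trans (length-++ X) (cong₂ _+_ e (cong suc (zero-Z e e′))))) }
    where
    x = length X
    b = length Y
    z = length Z
    len : length (X ++ Y ++ y ∷ Z) ≡ x + (b + suc z)
    len = trans (length-++ X) (cong (x +_) (length-++ Y))
    0<b : 0 < b
    0<b = ℕ.≤-pred (subst (2 ≤_) (trans (length-++ Y) (ℕ.+-comm b 1)) two-c)
    zero-Z : x ≡ 0 → suc (x + b) ≡ length (X ++ Y ++ y ∷ Z) → z ≡ 0
    zero-Z e e′ = sym (ℕ.+-cancelˡ-≡ (x + b) 0 z
      (trans (ℕ.+-identityʳ (x + b)) (ℕ.suc-injective (trans e′ (trans len
      (trans (cong (x +_) (ℕ.+-suc b z)) (trans (ℕ.+-suc x (b + z)) (cong suc (sym (ℕ.+-assoc x b z))))))))))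
  cut-valid (backward _ X Y y Z refl refl refl refl refl) k<m two-r two-c =
    k<m , ℕ.≤-<-trans (ℕ.m≤m+n x (suc b)) k<m ,
    (λ e → ℕ.<⇒≢ (ℕ.m<m+n x (s≤s z≤n)) (sym e)) ,
    (λ e → ℕ.<⇒≢ 0<b (sym (ℕ.+-cancelˡ-≡ x b 0
      (trans (ℕ.suc-injective (trans (sym (ℕ.+-suc x b)) e)) (sym (ℕ.+-identityʳ x)))))) ,
    λ { (e , _) → ℕ.<⇒≢ (ℕ.<-≤-trans (s≤s z≤n) (ℕ.m≤n+m (suc b) x)) (sym e) }
    where
    x = length X
    b = length Y
    0<b : 0 < b
    0<b = ℕ.≤-pred (subst (2 ≤_) (length-reverse (y ∷ Y)) two-c)

-- Sorted lists of sides and the number of sides before a vertex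

module _ {N : ℕ} where

  Sorted : List (Fin N) → Set
  Sorted = AllPairs (λ i j → toℕ i < toℕ j)

  allFin-sorted : Sorted (allFin N)
  allFin-sorted = AllPairs.tabulate⁺-< id

  below? : ∀ k (j : Fin N) → Dec (toℕ j < k)
  below? k j = toℕ j <? k

  above? : ∀ k (j : Fin N) → Dec (k ≤ toℕ j)
  above? k j = k ≤? toℕ j

  cnt : ℕ → List (Fin N) → ℕ
  cnt k xs = length (filter (below? k) xs)

  sorted-++ : ∀ k {xs} → Sorted xs → xs ≡ filter (below? k) xs ++ filter (above? k) xs
  sorted-++ k [] = refl
  sorted-++ k {x ∷ xs} (h ∷ s) with below? k x
  ... | yes l = trans (cong (x ∷_) (sorted-++ k s))
    (sym (cong₂ _++_ (filter-accept (below? k) l) (filter-reject (above? k) {x} {xs} (ℕ.<⇒≱ l))))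
  ... | no ¬l = sym (cong₂ _++_
    (filter-none (below? k) (¬l ∷ All.map (λ x<j j<k → ¬l (ℕ.<-trans x<j j<k)) h))
    (filter-all (above? k) (ℕ.≮⇒≥ ¬l ∷ All.map (λ x<j → ℕ.≤-trans (ℕ.≮⇒≥ ¬l) (ℕ.<⇒≤ x<j)) h)))

  sorted-++⁻ : ∀ (us : List (Fin N)) {vs} → Sorted (us ++ vs) → All (λ u → All (λ v → toℕ u < toℕ v) vs) us
    × Sorted vs
  sorted-++⁻ [] s = [] , s
  sorted-++⁻ (u ∷ us) (h ∷ s) = All.++⁻ʳ us h ∷ proj₁ (sorted-++⁻ us s) , proj₂ (sorted-++⁻ us s)

  record Threefold (a b : ℕ) (xs : List (Fin N)) : Set where
    constructor threefold
    field
      X Y Z : List (Fin N)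
      eq    : xs ≡ X ++ Y ++ Z
      allX  : All (λ j → toℕ j < a) X
      allY  : All (λ j → a ≤ toℕ j × toℕ j < b) Y
      allZ  : All (λ j → b ≤ toℕ j) Z
      sorted-Y : Sorted Y
      sorted-Z : Sorted Z

  divide : ∀ {a b xs} → a ≤ b → Sorted xs → Threefold a b xs
  divide {a} {b} {xs} a≤b s = record
    { X = filter (below? a) L ; Y = filter (above? a) L ; Z = filter (above? b) xs
    ; eq = trans (sorted-++ b s) (trans (cong (_++ filter (above? b) xs) (sorted-++ a sL))
             (++-assoc (filter (below? a) L) _ _))
    ; allX = All.all-filter (below? a) L
    ; allY = All.zip (All.all-filter (above? a) L , All.filter⁺ (above? a) (All.all-filter (below? b) xs))
    ; allZ = All.all-filter (above? b) xs
    ; sorted-Y = AllPairs.filter⁺ (above? a) sL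
    ; sorted-Z = AllPairs.filter⁺ (above? b) s }
    where
    L = filter (below? b) xs
    sL = AllPairs.filter⁺ (below? b) s

  cnt-++ : ∀ {k} (X : List (Fin N)) {Y} → All (λ j → toℕ j < k) X → All (λ j → k ≤ toℕ j) Y →
           cnt k (X ++ Y) ≡ length X
  cnt-++ {k} X {Y} aX aY = begin
    length (filter (below? k) (X ++ Y))                     ≡⟨ cong length (filter-++ (below? k) X Y) ⟩
    length (filter (below? k) X ++ filter (below? k) Y)     ≡⟨ cong length
      (cong₂ _++_ (filter-all (below? k) aX)
                                                                (filter-none (below? k) (All.map ℕ.≤⇒≯ aY))) ⟩
    length (X ++ [])                                        ≡⟨ cong length (++-identityʳ X) ⟩
    length X                                                ∎
    where open ≡-Reasoning

  sorted-head : ∀ {i xs} → Sorted xs → All (λ j → toℕ i ≤ toℕ j) xs → i ∈ xs →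
                ∃ λ ys → xs ≡ i ∷ ys × All (λ j → toℕ i < toℕ j) ys
  sorted-head (h ∷ _) _ (here refl) = _ , refl , h
  sorted-head (h ∷ _) (l ∷ _) (there i∈) = contradiction (All.lookup h i∈) (ℕ.≤⇒≯ l)

  module _ {a b xs} (t : Threefold a b xs) (a≤b : a ≤ b) where
    open Threefold t

    cnt-a : cnt a xs ≡ length X
    cnt-a = trans (cong (cnt a) eq) (cnt-++ X allX
      (All.++⁺ (All.map proj₁ allY) (All.map (ℕ.≤-trans a≤b) allZ)))

    cnt-b : cnt b xs ≡ length X + length Y
    cnt-b = trans (cong (cnt b) (trans eq (sym (++-assoc X Y Z)))) (trans
      (cnt-++ (X ++ Y) (All.++⁺ (All.map (λ l → ℕ.<-≤-trans l a≤b) allX) (All.map proj₂ allY)) allZ)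
      (length-++ X))

    ∈-middle : ∀ {j} → j ∈ xs → a ≤ toℕ j → toℕ j < b → j ∈ Y
    ∈-middle {j} j∈ l h with ∈-++⁻ X (subst (j ∈_) eq j∈)
    ... | inj₁ jX = contradiction (All.lookup allX jX) (ℕ.≤⇒≯ l)
    ... | inj₂ jYZ with ∈-++⁻ Y jYZ
    ...   | inj₁ jY = jY
    ...   | inj₂ jZ = contradiction h (ℕ.≤⇒≯ (All.lookup allZ jZ))

    ∈-end : ∀ {j} → j ∈ xs → b ≤ toℕ j → j ∈ Z
    ∈-end {j} j∈ l with ∈-++⁻ X (subst (j ∈_) eq j∈)
    ... | inj₁ jX = contradiction (All.lookup allX jX) (ℕ.≤⇒≯ (ℕ.≤-trans a≤b l))
    ... | inj₂ jYZ with ∈-++⁻ Y jYZ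
    ...   | inj₁ jY = contradiction (proj₂ (All.lookup allY jY)) (ℕ.≤⇒≯ l)
    ...   | inj₂ jZ = jZ

  module _ {xs} (s : Sorted xs) where

    cnt-strict : ∀ {a b j} → j ∈ xs → a ≤ toℕ j → toℕ j < b → cnt a xs < cnt b xs
    cnt-strict {a} {b} {j} j∈ l h = subst₂ _<_ (sym (cnt-a t a≤b)) (sym (cnt-b t a≤b))
      (ℕ.m<m+n _ (nonempty (∈-middle t a≤b j∈ l h)))
      where
      a≤b = ℕ.≤-trans l (ℕ.<⇒≤ h)
      t = divide a≤b s
      nonempty : ∀ {ys : List (Fin N)} → j ∈ ys → 0 < length ys
      nonempty (here _) = s≤s z≤n
      nonempty (there _) = s≤s z≤n

    cnt-gap : ∀ {a b} → a ≤ b → (∀ {j} → j ∈ xs → a ≤ toℕ j → ¬ toℕ j < b) → cnt a xs ≡ cnt b xs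
    cnt-gap {a} {b} a≤b none = trans (cnt-a t a≤b) (sym (trans (cnt-b t a≤b)
      (trans (cong (length X +_) (empty Y allY λ j∈ → subst (_ ∈_) (sym eq) (∈-++⁺ʳ X (∈-++⁺ˡ j∈))))
        (ℕ.+-identityʳ _))))
      where
      t = divide a≤b s
      open Threefold t
      empty : ∀ ys → All (λ j → a ≤ toℕ j × toℕ j < b) ys → (∀ {j} → j ∈ ys → j ∈ xs) → length ys ≡ 0
      empty [] _ _ = refl
      empty (y ∷ _) ((l , h) ∷ _) sub = contradiction h (none (sub (here refl)) l)

    cnt-suc : ∀ {i} → i ∈ xs → cnt (suc (toℕ i)) xs ≡ suc (cnt (toℕ i) xs)
    cnt-suc {i} i∈ with divide {b = suc (toℕ i)} (ℕ.n≤1+n _) s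
    ... | t with sorted-head (Threefold.sorted-Y t) (All.map proj₁ (Threefold.allY t))
      (∈-middle t (ℕ.n≤1+n _) i∈ ℕ.≤-refl ℕ.≤-refl)
    ...   | [] , e , _ = trans (cnt-b t (ℕ.n≤1+n _)) (trans (cong (λ ys → length (Threefold.X t) + length ys) e)
              (trans (ℕ.+-comm _ 1) (cong suc (sym (cnt-a t (ℕ.n≤1+n _))))))
    ...   | y ∷ ys , e , l ∷ _ = contradiction
      (proj₂ (All.lookup (Threefold.allY t) (subst (y ∈_) (sym e) (there (here refl)))))
              (ℕ.≤⇒≯ l)

    cnt-all : ∀ {k} → (∀ {j} → j ∈ xs → toℕ j < k) → cnt k xs ≡ length xs
    cnt-all {k} h = cong length (filter-all (below? k) (All.tabulate h))

    cnt-none : ∀ {k} → (∀ {j} → j ∈ xs → k ≤ toℕ j) → cnt k xs ≡ 0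
    cnt-none {k} h = cong length (filter-none (below? k) (All.tabulate (ℕ.≤⇒≯ ∘ h)))

    cnt-≤ : ∀ {k} → cnt k xs ≤ length xs
    cnt-≤ {k} = length-filter (below? k) xs

-- The polygons cut out by an arrow

module _ {N : ℕ} where

  ascending : List (Arrow N) → Region N → List (Fin N)
  ascending D r = filter (meets? D r) (allFin N)

  ascending-sorted : ∀ D r → Sorted (ascending D r)
  ascending-sorted D r = AllPairs.filter⁺ (meets? D r) allFin-sorted

  ascending⁺ : ∀ {D r j} → Meets D r j → j ∈ ascending D r
  ascending⁺ {D} {r} {j} m = ∈-filter⁺ (meets? D r) (∈-allFin j) m

  ascending⁻ : ∀ {D r j} → j ∈ ascending D r → Meets D r j
  ascending⁻ {D} {r} j∈ = proj₂ (∈-filter⁻ (meets? D r) {xs = allFin N} j∈)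

  ifForward-yes : ∀ {A : Set} (α : Arrow N) {x y : A} → Forward α → ifForward α x y ≡ x
  ifForward-yes α f with forward? α
  ... | yes _ = refl
  ... | no ¬f = contradiction f ¬f

  ifForward-no : ∀ {A : Set} (α : Arrow N) {x y : A} → ¬ Forward α → ifForward α x y ≡ y
  ifForward-no α ¬f with forward? α
  ... | yes f = contradiction f ¬f
  ... | no _ = refl

  orient-id : ∀ r {is : List (Fin N)} → ¬ Reversed r → orient r is ≡ is
  orient-id nothing _ = refl
  orient-id (just ρ) ¬r with forward? ρ
  ... | yes _ = refl
  ... | no ¬f = contradiction ¬f ¬r

  orient-reverse : ∀ r {is : List (Fin N)} → Reversed r → orient r is ≡ reverse is
  orient-reverse (just ρ) ¬f = ifForward-no ρ ¬f

  length-orient : ∀ r (is : List (Fin N)) → length (orient r is) ≡ length is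
  length-orient nothing is = refl
  length-orient (just ρ) is with forward? ρ
  ... | yes _ = refl
  ... | no _ = length-reverse is

  -- A vertex or side of π becomes the one of the region r preceded by as many sides of r; if the
  -- orientation of r is reversed, these are counted from the other end.

  reindex : Region N → List (Fin N) → Fin N → Fin N → ℕ × ℕ
  reindex r xs k i with reversed? r
  ... | yes _ = length xs ∸ cnt (toℕ k) xs , length xs ∸ suc (cnt (toℕ i) xs)
  ... | no _  = cnt (toℕ k) xs , cnt (toℕ i) xs

  reindex-reversed : ∀ r {xs k i} → Reversed r →
                     reindex r xs k i ≡ (length xs ∸ cnt (toℕ k) xs , length xs ∸ suc (cnt (toℕ i) xs))
  reindex-reversed r R with reversed? r
  ... | yes _ = refl
  ... | no ¬R = contradiction R ¬R

  reindex-same : ∀ r {xs k i} → ¬ Reversed r → reindex r xs k i ≡ (cnt (toℕ k) xs , cnt (toℕ i) xs)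
  reindex-same r ¬R with reversed? r
  ... | yes R = contradiction R ¬R
  ... | no _ = refl

  index : List (Arrow N) → Region N → Arrow N → ℕ × ℕ
  index D r α = reindex r (ascending D r) (source α) (target α)

  -- Whether α is forward as an arrow of the polygon of r.

  ForwardIn : Region N → Arrow N → Set
  ForwardIn r α = (Forward α × ¬ Reversed r) ⊎ (¬ Forward α × Reversed r)

  -- `Cut` in the orientation of π, before regions are oriented: vertices and sides enter through
  -- their counts, and the part cut off by a backward arrow is not yet reversed.
  data AscendingCut (xs : List (Fin N)) (α : Arrow N) (rest cut : List (Fin N)) : Set where
    forward  : Forward α → ∀ X Y y Z → xs ≡ X ++ Y ++ y ∷ Z →
               cnt (toℕ (source α)) xs ≡ length X → cnt (toℕ (target α)) xs ≡ length X + length Y →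
               rest ≡ X ++ y ∷ Z → cut ≡ Y ++ y ∷ [] → AscendingCut xs α rest cut
    backward : ¬ Forward α → ∀ X Y y Z → xs ≡ X ++ y ∷ Y ++ Z →
               cnt (toℕ (source α)) xs ≡ length X + suc (length Y) → cnt (toℕ (target α)) xs ≡ length X →
               rest ≡ X ++ y ∷ Z → cut ≡ y ∷ Y → AscendingCut xs α rest cut

  private
    outside? : ∀ a b (j : Fin N) → Dec (toℕ j < a ⊎ b ≤ toℕ j)
    outside? a b j = (toℕ j <? a) ⊎-dec (b ≤? toℕ j)

    inside? : ∀ a b (j : Fin N) → Dec (a ≤ toℕ j × toℕ j < b)
    inside? a b j = (a ≤? toℕ j) ×-dec (toℕ j <? b)

    select : ∀ {P : Fin N → Set} (P? : ∀ x → Dec (P x)) X Y {y} Z {X′ Y′ Z′} → filter P? X ≡ X′ →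
      filter P? Y ≡ Y′ → P y →
             filter P? Z ≡ Z′ → filter P? (X ++ Y ++ y ∷ Z) ≡ X′ ++ Y′ ++ y ∷ Z′
    select P? X Y {y} Z refl refl p refl = trans (filter-++ P? X (Y ++ y ∷ Z))
      (cong (filter P? X ++_) (trans (filter-++ P? Y (y ∷ Z)) (cong (filter P? Y ++_) (filter-accept P? p))))

    select′ : ∀ {P : Fin N → Set} (P? : ∀ x → Dec (P x)) X {y} Y Z {X′ Y′ Z′} → filter P? X ≡ X′ → P y →
      filter P? Y ≡ Y′ →
             filter P? Z ≡ Z′ → filter P? (X ++ y ∷ Y ++ Z) ≡ X′ ++ y ∷ Y′ ++ Z′
    select′ P? X {y} Y Z refl p refl refl = trans (filter-++ P? X (y ∷ Y ++ Z))
      (cong (filter P? X ++_) (trans (filter-accept P? p) (cong (y ∷_) (filter-++ P? Y Z))))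

  -- Reversing r exchanges the two directions and the blocks X and Z. The part cut off is oriented
  -- by the direction of α in π; relative to a reversed r this is again the rule for arrows of its
  -- own polygon.
  reindex-cut : ∀ {xs α rest cut} r → AscendingCut xs α rest cut →
                Cut (ForwardIn r α) (orient r xs) (proj₁ (reindex r xs (source α) (target α)))
                    (proj₂ (reindex r xs (source α) (target α)))
                    (orient r rest) (ifForward α cut (reverse cut))
  reindex-cut {xs} {α} r c with reversed? r | c
  ... | no ¬R | forward f X Y y Z e ek ei er ec = forward (inj₁ (f , ¬R)) X Y y Z
    (trans (orient-id r ¬R) e) ek ei
        (trans (orient-id r ¬R) er) (trans (ifForward-yes α f) ec)
  ... | no ¬R | backward f X Y y Z e ek ei er ec = backward
    (λ { (inj₁ (g , _)) → f g ; (inj₂ (_ , R)) → ¬R R }) X Y y Z (trans (orient-id r ¬R) e) ek ei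
        (trans (orient-id r ¬R) er) (trans (ifForward-no α f) (cong reverse ec))
  ... | yes R | forward f X Y y Z e ek ei er ec = backward
    (λ { (inj₁ (_ , ¬R)) → ¬R R ; (inj₂ (¬f , _)) → ¬f f }) (reverse Z) (reverse Y) y (reverse X)
        (trans (orient-reverse r R) (trans (cong reverse e) mirrored))
        (trans (cong₂ _∸_ len ek) (trans (ℕ.m+n∸m≡n x _)
          (trans (ℕ.+-comm b (suc z)) (trans (sym (ℕ.+-suc z b)) lens))))
        (trans (cong₂ (λ m n → m ∸ suc n) len ei)
          (trans (cong (_∸ suc (x + b)) (trans (sym (ℕ.+-assoc x b (suc z))) (ℕ.+-suc (x + b) z)))
          (trans (ℕ.m+n∸m≡n (suc (x + b)) z) (sym (length-reverse Z)))))
        (trans (orient-reverse r R) (trans (cong reverse er) (reverse-insert X y Z)))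
        (trans (ifForward-yes α f) (trans ec
          (sym (trans (unfold-reverse y (reverse Y)) (cong (_++ y ∷ []) (reverse-involutive Y))))))
    where
    x = length X
    b = length Y
    z = length Z
    len : length xs ≡ x + (b + suc z)
    len = trans (cong length e) (trans (length-++ X) (cong (x +_) (length-++ Y)))
    lens : z + suc b ≡ length (reverse Z) + suc (length (reverse Y))
    lens = sym (cong₂ (λ m n → m + suc n) (length-reverse Z) (length-reverse Y))
    mirrored : reverse (X ++ Y ++ y ∷ Z) ≡ reverse Z ++ y ∷ reverse Y ++ reverse X
    mirrored = trans (cong reverse (sym (++-assoc X Y (y ∷ Z)))) (trans (reverse-insert (X ++ Y) y Z)
      (cong (λ w → reverse Z ++ y ∷ w) (reverse-++ X Y)))
  ... | yes R | backward f X Y y Z e ek ei er ec = forward (inj₂ (f , R)) (reverse Z) (reverse Y) y (reverse X)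
        (trans (orient-reverse r R) (trans (cong reverse e) mirrored))
        (trans (cong₂ _∸_ len ek) (trans (cong (_∸ (x + suc b)) (sym (ℕ.+-assoc x (suc b) z)))
          (trans (ℕ.m+n∸m≡n (x + suc b) z) (sym (length-reverse Z)))))
        (trans (cong₂ (λ m n → m ∸ suc n) len ei) (trans (cong (_∸ suc x) (ℕ.+-suc x (b + z)))
          (trans (ℕ.m+n∸m≡n (suc x) (b + z)) (trans (ℕ.+-comm b z)
            (sym (cong₂ _+_ (length-reverse Z) (length-reverse Y)))))))
        (trans (orient-reverse r R) (trans (cong reverse er) (reverse-insert X y Z)))
        (trans (ifForward-no α f) (trans (cong reverse ec) (unfold-reverse y Y)))
    where
    x = length X
    b = length Y
    z = length Z
    len : length xs ≡ x + (suc b + z)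
    len = trans (cong length e) (trans (length-++ X) (cong (λ n → x + suc n) (length-++ Y)))
    mirrored : reverse (X ++ y ∷ Y ++ Z) ≡ reverse Z ++ reverse Y ++ y ∷ reverse X
    mirrored = trans (reverse-insert X y (Y ++ Z)) (trans (cong (_++ y ∷ reverse X) (reverse-++ Y Z))
      (++-assoc (reverse Z) (reverse Y) (y ∷ reverse X)))

  module _ {D : List (Arrow N)} (comp : AllPairs Compatible D) {r : Region N} {α : Arrow N}
    (add : Addable D r α) where
    open Regions comp

    private
      xs = ascending D r
      k = toℕ (source α)
      i = toℕ (target α)

    -- The target side belongs to r and therefore heads the block that starts at i; it is the y kept
    -- by both filters.
    ascending-cut : AscendingCut xs α (ascending (α ∷ D) r) (ascending (α ∷ D) (just α))
    ascending-cut = split α fw bw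
      where
      fw : Forward α → _
      fw f with divide {b = i} f (ascending-sorted D r)
      ... | t@(threefold X Y Z eq aX aY aZ _ sZ) with sorted-head sZ aZ
        (∈-end t f (ascending⁺ (meets-target add)) ℕ.≤-refl)
      ...   | Z′ , refl , h = forward f X Y (target α) Z′ eq (cnt-a t f) (cnt-b t f)
        (trans (filter-filter (meets? D r) (outside? k i) (meets? (α ∷ D) r)
                 (λ {j} → rest-F⁻ add f {j}) (λ {j} → rest-F⁺ add f {j}) (allFin N))
               (trans (cong (filter (outside? k i)) eq)
                 (select (outside? k i) X Y Z′ (filter-all (outside? k i) (All.map inj₁ aX))
                   (filter-none (outside? k i) (All.map
                     (λ { (l , h) (inj₁ l′) → ℕ.<⇒≱ l′ l ; (l , h) (inj₂ l′) → ℕ.<⇒≱ h l′ }) aY))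
                   (inj₂ ℕ.≤-refl) (filter-all (outside? k i) (All.map (inj₂ ∘ ℕ.<⇒≤) h)))))
        (trans (filter-filter (meets? D r) (inside? k (suc i)) (meets? (α ∷ D) (just α))
                 (λ {j} → cut-F⁻ add f {j}) (λ {j} → cut-F⁺ add f {j}) (allFin N))
               (trans (cong (filter (inside? k (suc i))) eq)
                 (select (inside? k (suc i)) X Y Z′ {X′ = []}
                   (filter-none (inside? k (suc i)) (All.map (λ { l (l′ , _) → ℕ.<⇒≱ l l′ }) aX))
                   (filter-all (inside? k (suc i)) (All.map (λ { (l , h) → l , ℕ.<-trans h (ℕ.n<1+n i) }) aY))
                   (f , ℕ.≤-refl)
                   (filter-none (inside? k (suc i)) (All.map (λ { l (_ , l′) → ℕ.<⇒≱ l (ℕ.≤-pred l′) }) h)))))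
      bw : ¬ Forward α → _
      bw f with ℕ.<⇒≤ (ℕ.≰⇒> f)
      ... | i≤k with divide {a = i} {b = k} i≤k (ascending-sorted D r)
      ...   | t@(threefold X Y Z eq aX aY aZ sY _)
        with sorted-head sY (All.map proj₁ aY)
          (∈-middle t i≤k (ascending⁺ (meets-target add)) ℕ.≤-refl (ℕ.≰⇒> f))
      ...     | Y′ , refl , h = backward f X Y′ (target α) Z eq (cnt-b t i≤k) (cnt-a t i≤k)
        (trans (filter-filter (meets? D r) (outside? (suc i) k) (meets? (α ∷ D) r)
                 (λ {j} → rest-B⁻ add f {j}) (λ {j} → rest-B⁺ add f {j}) (allFin N))
               (trans (cong (filter (outside? (suc i) k)) eq)
                 (select′ (outside? (suc i) k) X Y′ Z {Y′ = []}
                   (filter-all (outside? (suc i) k) (All.map (λ l → inj₁ (ℕ.<-trans l (ℕ.n<1+n i))) aX))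
                   (inj₁ ℕ.≤-refl)
                   (filter-none (outside? (suc i) k) (All.zipWith
                     (λ { (l , (_ , h)) (inj₁ l′) → ℕ.<⇒≱ l (ℕ.≤-pred l′) ; (l , (_ , h)) (inj₂ l′) →
                       ℕ.<⇒≱ h l′ })
                     (h , All.tail aY)))
                   (filter-all (outside? (suc i) k) (All.map inj₂ aZ)))))
        (trans (filter-filter (meets? D r) (inside? i k) (meets? (α ∷ D) (just α))
                 (λ {j} → cut-B⁻ add f {j}) (λ {j} → cut-B⁺ add f {j}) (allFin N))
               (trans (cong (filter (inside? i k)) eq)
                 (trans (select′ (inside? i k) X Y′ Z {X′ = []} {Z′ = []}
                   (filter-none (inside? i k) (All.map (λ { l (l′ , _) → ℕ.<⇒≱ l l′ }) aX))
                   (All.head aY) (filter-all (inside? i k) (All.tail aY))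
                   (filter-none (inside? i k) (All.map (λ { l (_ , l′) → ℕ.<⇒≱ l′ l }) aZ)))
                   (++-identityʳ (target α ∷ Y′)))))

    region-cut : Cut (ForwardIn r α) (regionSides D r) (proj₁ (index D r α)) (proj₂ (index D r α))
                     (regionSides (α ∷ D) r) (regionSides (α ∷ D) (just α))
    region-cut = reindex-cut r ascending-cut

-- Arrows of a region

module _ {N : ℕ} {D : List (Arrow N)} (comp : AllPairs Compatible D) {r : Region N}
         (r∈ : r ∈ nothing ∷ map just D) (0<N′ : 0 < N)
         {xs : List (Fin N)} (sorted : Sorted xs)
         (member⁺ : ∀ {j} → Meets D r j → j ∈ xs) (member⁻ : ∀ {j} → j ∈ xs → Meets D r j) where
  open Regions comp
  open Boundary comp r∈

  private
    m = length xs

    ι : Arrow N → ℕ × ℕ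
    ι α = reindex r xs (source α) (target α)

  -- The root side of r comes after every exposed vertex. If r is reversed, this says that the count
  -- is positive and its complement therefore less than the number of sides.
  index-source< : ∀ {α} → Addable D r α → proj₁ (ι α) < length (orient r xs)
  index-source< {α} add with reversed? r | root-side 0<N′ D r
  ... | no ¬R | j , mj , below , _ = subst (cnt (toℕ (source α)) xs <_) (sym (length-orient r xs))
    (ℕ.<-≤-trans (cnt-strict sorted (member⁺ mj) (below ¬R {source α} (source-exposed add)) (ℕ.n<1+n (toℕ j)))
      (cnt-≤ sorted {suc (toℕ j)}))
  ... | yes R | j , mj , _ , above = subst (m ∸ cnt (toℕ (source α)) xs <_) (sym (length-orient r xs))
    (ℕ.∸-monoʳ-< {m} {cnt (toℕ (source α)) xs} {0}
      (ℕ.≤-<-trans z≤n (cnt-strict sorted {0} (member⁺ mj) z≤n (above R {source α} (source-exposed add))))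
      (cnt-≤ sorted))

  private
    -- Two different exposed vertices have a side of r between them, which is counted for only one
    -- of them.
    source-injective : ∀ {α β} → Addable D r α → Addable D r β →
                       cnt (toℕ (source α)) xs ≡ cnt (toℕ (source β)) xs → source α ≡ source β
    source-injective {α} {β} a b eq with ℕ.<-cmp (toℕ (source α)) (toℕ (source β))
    ... | tri≈ _ e _ = Fin.toℕ-injective e
    ... | tri< l _ _ with meets-between {source α} {source β} (source-exposed a) (source-exposed b) l
    ...   | j , mj , l₁ , l₂ = contradiction eq (ℕ.<⇒≢ (cnt-strict sorted (member⁺ mj) l₁ l₂))
    source-injective {α} {β} a b eq | tri> _ _ l
      with meets-between {source β} {source α} (source-exposed b) (source-exposed a) l
    ...   | j , mj , l₁ , l₂ = contradiction (sym eq) (ℕ.<⇒≢ (cnt-strict sorted (member⁺ mj) l₁ l₂))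

    side-injective : ∀ {i j} → i ∈ xs → j ∈ xs → cnt (toℕ i) xs ≡ cnt (toℕ j) xs → i ≡ j
    side-injective {i} {j} i∈ j∈ eq with ℕ.<-cmp (toℕ i) (toℕ j)
    ... | tri≈ _ e _ = Fin.toℕ-injective e
    ... | tri< l _ _ = contradiction eq (ℕ.<⇒≢ (cnt-strict sorted i∈ ℕ.≤-refl l))
    ... | tri> _ _ l = contradiction (sym eq) (ℕ.<⇒≢ (cnt-strict sorted j∈ ℕ.≤-refl l))

    suc-cnt≤ : ∀ {i} → i ∈ xs → suc (cnt (toℕ i) xs) ≤ m
    suc-cnt≤ {i} i∈ = subst (_≤ m) (cnt-suc sorted i∈) (cnt-≤ sorted)

    target-member : ∀ {α} → Addable D r α → target α ∈ xs
    target-member add = member⁺ (meets-target add)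

  index-injective : ∀ {α β} → Addable D r α → Addable D r β → ι α ≡ ι β → α ≡ β
  index-injective {α} {β} a b eq with reversed? r
  ... | no _ = arrow-≡ (source-injective a b (cong proj₁ eq))
    (side-injective (target-member a) (target-member b) (cong proj₂ eq))
  ... | yes _ = arrow-≡
    (source-injective a b (ℕ.∸-cancelˡ-≡ (cnt-≤ sorted {toℕ (source α)}) (cnt-≤ sorted {toℕ (source β)})
      (cong proj₁ eq)))
    (side-injective (target-member a) (target-member b) (ℕ.suc-injective
      (ℕ.∸-cancelˡ-≡ (suc-cnt≤ (target-member a)) (suc-cnt≤ (target-member b)) (cong proj₂ eq))))

  private
    -- Counts run from 0 to m, although there are only m vertices: 0 and m both describe the vertex
    -- where the polygon closes. The first vertex comes before all sides of r, or after all of them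
    -- if r is reversed, which decides between the two values.
    Range : ℕ → Set
    Range c = (¬ Reversed r × c < m) ⊎ (Reversed r × 0 < c × c ≤ m)

    range-≤ : ∀ {c} → Range c → c ≤ m
    range-≤ (inj₁ (_ , l)) = ℕ.<⇒≤ l
    range-≤ (inj₂ (_ , _ , l)) = l

    vertex-at : ∀ c → Range c → ∃ λ (k : Fin N) → Exposed D r (toℕ k * N) × cnt (toℕ k) xs ≡ c
    vertex-at c R = at (c ℕ.≟ 0) (c ℕ.≟ m) R
      where
      at : Dec (c ≡ 0) → Dec (c ≡ m) → Range c → _
      at (yes refl) _ (inj₁ (¬R , _)) with first-vertex 0<N′ D r
      ... | k , ek , low , _ = k , ek , cnt-none sorted (λ {j} j∈ → low ¬R (member⁻ j∈))
      at (yes refl) _ (inj₂ (_ , () , _))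
      at (no _) (yes refl) (inj₂ (R , _)) with first-vertex 0<N′ D r
      ... | k , ek , _ , high = k , ek , cnt-all sorted (λ {j} j∈ → high R (member⁻ j∈))
      at (no _) (yes refl) (inj₁ (_ , l)) = ⊥-elim (ℕ.n≮n _ l)
      -- The vertex sought lies between the sides i and j in the consecutive places c - 1 and c of
      -- the list.
      at (no c≢0) (no c≢m) R with split-at xs c (ℕ.≤∧≢⇒< (range-≤ R) c≢m)
      ... | ys , j , zs , eq , len with last-of ys (λ e → c≢0 (trans (sym len) (cong length e)))
        where
        last-of : ∀ (ys : List (Fin N)) → ys ≢ [] → ∃ λ ws → ∃ λ i → ys ≡ ws ++ i ∷ []
        last-of [] ne = contradiction refl ne
        last-of (y ∷ []) _ = [] , y , refl
        last-of (y ∷ ys@(_ ∷ _)) _ with last-of ys (λ ())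
        ... | ws , i , e = y ∷ ws , i , cong (y ∷_) e
      ...   | ws , i , refl = conclude (exposed-between {i} {j} (member⁻ i∈) (member⁻ j∈) i<j)
        where
        sorted′ : Sorted ((ws ++ i ∷ []) ++ j ∷ zs)
        sorted′ = subst Sorted eq sorted
        earlier = proj₁ (sorted-++⁻ (ws ++ i ∷ []) sorted′)
        i∈ : i ∈ xs
        i∈ = subst (i ∈_) (sym eq) (∈-++⁺ˡ (∈-++⁺ʳ ws (here refl)))
        j∈ : j ∈ xs
        j∈ = subst (j ∈_) (sym eq) (∈-++⁺ʳ (ws ++ i ∷ []) (here refl))
        i<j : toℕ i < toℕ j
        i<j = All.head (All.lookup earlier (∈-++⁺ʳ ws (here refl)))
        ≤i : All (λ u → toℕ u ≤ toℕ i) (ws ++ i ∷ [])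
        ≤i = All.++⁺ (All.map (ℕ.<⇒≤ ∘ All.head)
          (proj₁ (sorted-++⁻ ws (subst Sorted (++-assoc ws (i ∷ []) (j ∷ zs)) sorted′)))) (ℕ.≤-refl ∷ [])
        j≤ : All (λ v → toℕ j ≤ toℕ v) (j ∷ zs)
        j≤ with proj₂ (sorted-++⁻ (ws ++ i ∷ []) sorted′)
        ... | h ∷ _ = ℕ.≤-refl ∷ All.map ℕ.<⇒≤ h
        conclude : _ → _
        conclude (k , ek , i<k , k≤j) = k , ek , trans (cong (cnt (toℕ k)) eq) (trans
          (cnt-++ (ws ++ i ∷ []) (All.map (λ l → ℕ.≤-<-trans l i<k) ≤i) (All.map (ℕ.≤-trans k≤j) j≤)) len)

    side-at : ∀ d → d < m → ∃ λ i → i ∈ xs × cnt (toℕ i) xs ≡ d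
    side-at d d<m with split-at xs d d<m
    ... | ys , i , zs , eq , len with sorted-++⁻ ys (subst Sorted eq sorted)
    ...   | lt , h ∷ _ = i , subst (i ∈_) (sym eq) (∈-++⁺ʳ ys (here refl)) , trans (cong (cnt (toℕ i)) eq)
      (trans (cnt-++ ys (All.map All.head lt) (ℕ.≤-refl ∷ All.map ℕ.<⇒≤ h)) len)

    -- In the polygon of r the arrow of r itself would lead from the first vertex to the root side,
    -- which is trivial.
    root-counts : ∀ {α} → r ≡ just α →
      (cnt (toℕ (source α)) xs ≡ 0 × cnt (suc (toℕ (target α))) xs ≡ m) ⊎
      (cnt (toℕ (source α)) xs ≡ m × cnt (toℕ (target α)) xs ≡ 0)
    root-counts {α} e = split α
      (λ f → inj₁ ( cnt-none sorted (λ {j} j∈ → proj₁ (meets-bounds-F {D = D} {α} {j} f (member′ j∈)))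
                  , cnt-all sorted (λ {j} j∈ → s≤s (proj₂ (meets-bounds-F {D = D} {α} {j} f (member′ j∈))))))
      (λ f → inj₂ ( cnt-all sorted (λ {j} j∈ → proj₂ (meets-bounds-B {D = D} {α} {j} f (member′ j∈)))
                  , cnt-none sorted (λ {j} j∈ → proj₁ (meets-bounds-B {D = D} {α} {j} f (member′ j∈)))))
      where
      member′ : ∀ {j} → j ∈ xs → Meets D (just α) j
      member′ {j} j∈ = subst (λ s → Meets D s j) e (member⁻ j∈)

    -- Apart from its target side, r has no side in the part cut off by β, so contraction makes the
    -- source of β an endpoint of its target side. A non-trivial pair of counts thus never comes
    -- from an arrow of D below r.
    gap-counts : ∀ {β} → β ∈ D → r ≺ just β →
      cnt (toℕ (source β)) xs ≡ cnt (toℕ (target β)) xs ⊎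
      cnt (toℕ (source β)) xs ≡ cnt (suc (toℕ (target β))) xs
    gap-counts {β} β∈ r≺β = split β
      (λ f → inj₁ (cnt-gap sorted f λ {j} j∈ → gap-F {D = D} {r} {β} {j} β∈ r≺β f (member⁻ j∈)))
      (λ f → inj₂ (sym (cnt-gap sorted (ℕ.≰⇒> f) λ {j} j∈ → gap-B {D = D} {r} {β} {j} β∈ r≺β f (member⁻ j∈))))

    counts-addable : ∀ {c d} α → c ≢ d → c ≢ suc d → ¬ (c ≡ 0 × suc d ≡ m) → ¬ (c ≡ m × d ≡ 0) →
                     Exposed D r (sourcePoint α) → cnt (toℕ (source α)) xs ≡ c →
                     target α ∈ xs → cnt (toℕ (target α)) xs ≡ d → Addable D r α
    counts-addable {c} {d} α c≢d c≢1+d nw nw′ ek ck i∈ ci = addable⁺ {α} ek (member⁻ i∈) not-root new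
      where
      csi : cnt (suc (toℕ (target α))) xs ≡ suc d
      csi = trans (cnt-suc sorted i∈) (cong suc ci)
      not-root : r ≢ just α
      not-root e with root-counts e
      ... | inj₁ (e₁ , e₂) = nw (trans (sym ck) e₁ , trans (sym csi) e₂)
      ... | inj₂ (e₁ , e₂) = nw′ (trans (sym ck) e₁ , trans (sym ci) e₂)
      new : ∀ {β} → β ∈ D → r ≺ just β → α ≢ β
      new β∈ r≺β refl with gap-counts β∈ r≺β
      ... | inj₁ e = c≢d (trans (sym ck) (trans e ci))
      ... | inj₂ e = c≢1+d (trans (sym ck) (trans e csi))

    counts-nontrivial : ∀ {c d k i} → c ≢ d → c ≢ suc d → ¬ (c ≡ 0 × suc d ≡ m) →
                        cnt (toℕ k) xs ≡ c → i ∈ xs → cnt (toℕ i) xs ≡ d → ¬ Endpoint k i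
    counts-nontrivial c≢d c≢1+d nw ck i∈ ci (first e) =
      c≢d (trans (sym ck) (trans (cong (λ x → cnt x xs) e) ci))
    counts-nontrivial c≢d c≢1+d nw ck i∈ ci (second e) =
      c≢1+d (trans (sym ck) (trans (cong (λ x → cnt x xs) e) (trans (cnt-suc sorted i∈) (cong suc ci))))
    counts-nontrivial {i = i} c≢d c≢1+d nw ck i∈ ci (closed e e′) = nw
      ( trans (sym ck) (trans (cong (λ x → cnt x xs) e) (cnt-none sorted (λ _ → z≤n)))
      , trans (sym (trans (cnt-suc sorted i∈) (cong suc ci)))
              (cnt-all sorted λ {j} _ → subst (toℕ j <_) (sym e′) (Fin.toℕ<n j)))

    add-at : ∀ {c d} → Range c → d < m → c ≢ d → c ≢ suc d → ¬ (c ≡ 0 × suc d ≡ m) → ¬ (c ≡ m × d ≡ 0) →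
             ∃ λ α → Addable D r α × cnt (toℕ (source α)) xs ≡ c × cnt (toℕ (target α)) xs ≡ d
    add-at {c} {d} R d<m c≢d c≢1+d nw nw′ with vertex-at c R | side-at d d<m
    ... | k , ek , ck | i , i∈ , ci =
      arrow k i nontriv , counts-addable (arrow k i nontriv) c≢d c≢1+d nw nw′ ek ck i∈ ci , ck , ci
      where
      nontriv : ¬ Endpoint k i
      nontriv = counts-nontrivial c≢d c≢1+d nw ck i∈ ci

    surjective-same : ¬ Reversed r → ∀ {c d} → Valid m (c , d) → ∃ λ α → Addable D r α × ι α ≡ (c , d)
    surjective-same ¬R (c< , d< , ne , ne′ , nw) = conclude
      (add-at (inj₁ (¬R , c<)) d< ne ne′ nw (ℕ.<⇒≢ c< ∘ proj₁))
      where
      conclude : _ → _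
      conclude (α , add , ec , ed) = α , add , trans (reindex-same r ¬R) (cong₂ _,_ ec ed)

    surjective-reversed : Reversed r → ∀ {c d} → Valid m (c , d) → ∃ λ α → Addable D r α × ι α ≡ (c , d)
    surjective-reversed R {c} {d} (c< , d< , ne , ne′ , nw) =
      -- Mirroring sends vertex c to m - c and side d to m - 1 - d. It exchanges the first two kinds
      -- of trivial arrows and turns the third, the closing one, into the pair (m, 0), which is why
      -- `add-at` excludes this pair as well.
      conclude (add-at {m ∸ c} {m ∸ suc d} (inj₂ (R , ℕ.m<n⇒0<n∸m c< , ℕ.m∸n≤m m c))
        (ℕ.∸-monoʳ-< {m} {suc d} {0} (s≤s z≤n) d<)
        (λ e → ne′ (ℕ.∸-cancelˡ-≡ (ℕ.<⇒≤ c<) d< e))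
        (λ e → ne (ℕ.∸-cancelˡ-≡ (ℕ.<⇒≤ c<) (ℕ.<⇒≤ d<) (trans e suc-∸)))
        (λ { (e , _) → ℕ.<⇒≢ (ℕ.m<n⇒0<n∸m c<) (sym e) })
        (λ { (e , e′) → nw (ℕ.∸-cancelˡ-≡ (ℕ.<⇒≤ c<) z≤n e ,
             sym (ℕ.∸-cancelˡ-≡ (ℕ.≤-refl {m}) d< (trans (ℕ.n∸n≡0 m) (sym e′)))) }))
      where
      suc-∸ : suc (m ∸ suc d) ≡ m ∸ d
      suc-∸ = sym (ℕ.+-∸-assoc 1 d<)
      conclude : _ → _
      conclude (α , add , ec , ed) = α , add , trans (reindex-reversed r R) (cong₂ _,_
        (trans (cong (m ∸_) ec) (ℕ.m∸[m∸n]≡n (ℕ.<⇒≤ c<)))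
        (trans (cong (λ n → m ∸ suc n) ed) (trans (cong (m ∸_) suc-∸) (ℕ.m∸[m∸n]≡n (ℕ.<⇒≤ d<)))))

  index-surjective : ∀ {κ} → Valid (length (orient r xs)) κ → ∃ λ α → Addable D r α × ι α ≡ κ
  index-surjective {κ} v = by (reversed? r) (subst (λ n → Valid n κ) (length-orient r xs) v)
    where
    by : Dec (Reversed r) → Valid m κ → ∃ λ α → Addable D r α × ι α ≡ κ
    by (yes R) = surjective-reversed R
    by (no ¬R) = surjective-same ¬R

module _ {N : ℕ} {D : List (Arrow N)} (comp : AllPairs Compatible D) {r : Region N}
         (r∈ : r ∈ nothing ∷ map just D) (2≤N : 2 ≤ N) where

  private
    xs = ascending D r
    sorted = ascending-sorted D r

    member⁺ : ∀ {j} → Meets D r j → j ∈ xs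
    member⁺ {j} = ascending⁺ {D = D} {r} {j}

    member⁻ : ∀ {j} → j ∈ xs → Meets D r j
    member⁻ {j} = ascending⁻ {D = D} {r} {j}

    0<N′ : 0 < N
    0<N′ = ℕ.<⇒≤ 2≤N

  -- Both polygons cut out by α are regions of the dissection α ∷ D and so have at least two sides.
  addable-valid : ∀ {α} → Addable D r α → Valid (length (regionSides D r)) (index D r α)
  addable-valid {α} add = cut-valid (region-cut comp add)
    (index-source< comp r∈ 0<N′ sorted (λ {j} → member⁺ {j}) (λ {j} → member⁻ {j}) add)
    (two-region comp′ 2≤N r) (two-region comp′ 2≤N (just α))
    where
    comp′ : AllPairs Compatible (α ∷ D)
    comp′ = proj₁ add ∷ comp

  addable-injective : ∀ {α β} → Addable D r α → Addable D r β → index D r α ≡ index D r β → α ≡ β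
  addable-injective = index-injective comp r∈ 0<N′ sorted (λ {j} → member⁺ {j}) (λ {j} → member⁻ {j})

  addable-surjective : ∀ {κ} → Valid (length (regionSides D r)) κ → ∃ λ α → Addable D r α × index D r α ≡ κ
  addable-surjective = index-surjective comp r∈ 0<N′ sorted (λ {j} → member⁺ {j}) (λ {j} → member⁻ {j})

-- Enumerations without repetition

∉-head : ∀ {A : Set} {x : A} {xs} → x ∉ xs → All (x ≢_) xs
∉-head x∉ = All.tabulate λ y∈ → λ { refl → x∉ y∈ }

module _ {A B : Set} where

  map-unique : ∀ {f : A → B} {xs} → (∀ {x y} → x ∈ xs → y ∈ xs → f x ≡ f y → x ≡ y) →
               Unique xs → Unique (map f xs)
  map-unique inj [] = []
  map-unique {f} {x ∷ xs} inj (h ∷ u) =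
    ∉-head (λ fx∈ → let (y , y∈ , e) = ∈-map⁻ f fx∈ in All.lookup h y∈ (inj (here refl) (there y∈) e)) ∷
    map-unique (λ x∈ y∈ → inj (there x∈) (there y∈)) u

  concatMap⁺ : ∀ (f : A → List B) {xs x y} → x ∈ xs → y ∈ f x → y ∈ concatMap f xs
  concatMap⁺ f x∈ y∈ = ∈-concatMap⁺ f (lose x∈ y∈)

  concatMap⁻ : ∀ (f : A → List B) {xs y} → y ∈ concatMap f xs → ∃ λ x → x ∈ xs × y ∈ f x
  concatMap⁻ f {xs} y∈ = find (∈-concatMap⁻ f {xs = xs} y∈)

  concatMap-unique : ∀ {f : A → List B} {xs} → Unique xs → (∀ {x} → x ∈ xs → Unique (f x)) →
                     (∀ {x x′ y} → x ∈ xs → x′ ∈ xs → y ∈ f x → y ∈ f x′ → x ≡ x′) → Unique (concatMap f xs)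
  concatMap-unique [] _ _ = []
  concatMap-unique {f} {x ∷ xs} (h ∷ u) uf sep = Unique.++⁺ (uf (here refl))
    (concatMap-unique u (uf ∘ there) (λ x∈ x′∈ → sep (there x∈) (there x′∈)))
    λ { (y∈ , y∈′) → let (x′ , x′∈ , m) = concatMap⁻ f y∈′ in
        All.lookup h x′∈ (sep (here refl) (there x′∈) y∈ m) }

module _ {A : Set} where

  -- The tool for the changes of summation index: only membership has to be characterised on both
  -- sides.
  unique-↭ : ∀ {xs ys : List A} → Unique xs → Unique ys →
             (∀ {x} → x ∈ xs → x ∈ ys) → (∀ {x} → x ∈ ys → x ∈ xs) → xs ↭ ys
  unique-↭ u v f g = ∼bag⇒↭ (unique∧set⇒bag u v (mk⇔ f g))

  head-∉ : ∀ {x : A} {xs} → Unique (x ∷ xs) → x ∉ xs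
  head-∉ = Unique.Unique[x∷xs]⇒x∉xs

  allPairs-↭ : ∀ {R : A → A → Set} → (∀ {x y} → R x y → R y x) → ∀ {xs ys} → xs ↭ ys → AllPairs R xs →
    AllPairs R ys
  allPairs-↭ s Perm.refl p = p
  allPairs-↭ s (Perm.prep x e) (h ∷ p) = Perm.All-resp-↭ e h ∷ allPairs-↭ s e p
  allPairs-↭ s (Perm.swap x y e) ((xy ∷ hx) ∷ hy ∷ p) =
    (s xy ∷ Perm.All-resp-↭ e hy) ∷ Perm.All-resp-↭ e hx ∷ allPairs-↭ s e p
  allPairs-↭ s (Perm.trans e f) p = allPairs-↭ s f (allPairs-↭ s e p)

  sublists-⊆ : ∀ (xs : List A) {ys y} → ys ∈ sublists xs → y ∈ ys → y ∈ xs
  sublists-⊆ [] (here refl) ()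
  sublists-⊆ (x ∷ xs) ys∈ y∈ with ∈-++⁻ (map (x ∷_) (sublists xs)) ys∈
  ... | inj₂ m = there (sublists-⊆ xs m y∈)
  ... | inj₁ m with ∈-map⁻ (x ∷_) m
  sublists-⊆ (x ∷ xs) ys∈ (here refl) | inj₁ m | zs , zs∈ , refl = here refl
  sublists-⊆ (x ∷ xs) ys∈ (there y∈) | inj₁ m | zs , zs∈ , refl = there (sublists-⊆ xs zs∈ y∈)

  sublists-unique : ∀ {xs : List A} → Unique xs → Unique (sublists xs)
  sublists-unique [] = [] ∷ []
  sublists-unique {x ∷ xs} u@(_ ∷ u′) = Unique.++⁺ (Unique.map⁺ ∷-injectiveʳ (sublists-unique u′))
    (sublists-unique u′)
    λ { (m , m′) → head-∉ u (sublists-⊆ xs m′ (∈-map∷⁻ m)) }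

  sublist-unique : ∀ {xs ys : List A} → Unique xs → ys ∈ sublists xs → Unique ys
  sublist-unique {[]} [] (here refl) = []
  sublist-unique {x ∷ xs} u@(_ ∷ u′) ys∈ with ∈-++⁻ (map (x ∷_) (sublists xs)) ys∈
  ... | inj₂ m = sublist-unique u′ m
  ... | inj₁ m with ∈-map⁻ (x ∷_) m
  ...   | zs , zs∈ , refl = ∉-head (head-∉ u ∘ sublists-⊆ xs zs∈) ∷ sublist-unique u′ zs∈

  -- A sublist inherits its order from xs. Hence different members of `dissections N` have different
  -- sets of arrows, and no ordered dissection is listed twice.
  sublists-set : ∀ {xs : List A} → Unique xs → ∀ {ys zs} → ys ∈ sublists xs → zs ∈ sublists xs →
                 (∀ {x} → x ∈ ys → x ∈ zs) → (∀ {x} → x ∈ zs → x ∈ ys) → ys ≡ zs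
  sublists-set {[]} _ (here refl) (here refl) _ _ = refl
  sublists-set {x ∷ xs} u@(_ ∷ u′) ys∈ zs∈ f g
    with ∈-++⁻ (map (x ∷_) (sublists xs)) ys∈ | ∈-++⁻ (map (x ∷_) (sublists xs)) zs∈
  ... | inj₂ m | inj₂ n = sublists-set u′ m n f g
  ... | inj₁ m | inj₂ n = contradiction (sublists-⊆ xs n (f (∈-map∷⁻ m))) (head-∉ u)
  ... | inj₂ m | inj₁ n = contradiction (sublists-⊆ xs m (g (∈-map∷⁻ n))) (head-∉ u)
  ... | inj₁ m | inj₁ n with ∈-map⁻ (x ∷_) m | ∈-map⁻ (x ∷_) n
  ...   | ys , ys∈′ , refl | zs , zs∈′ , refl =
    cong (x ∷_) (sublists-set u′ ys∈′ zs∈′ (λ y∈ → tail ys∈′ y∈ (f (there y∈)))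
      (λ y∈ → tail zs∈′ y∈ (g (there y∈))))
    where
    tail : ∀ {ws y vs} → ws ∈ sublists xs → y ∈ ws → y ∈ x ∷ vs → y ∈ vs
    tail ws∈ y∈ (here refl) = contradiction (sublists-⊆ xs ws∈ y∈) (head-∉ u)
    tail ws∈ y∈ (there p) = p

  filter-sublist : ∀ {P : A → Set} (P? : ∀ x → Dec (P x)) xs → filter P? xs ∈ sublists xs
  filter-sublist P? [] = here refl
  filter-sublist P? (x ∷ xs) with P? x
  ... | yes _ = ∈-++⁺ˡ (∈-map⁺ (x ∷_) (filter-sublist P? xs))
  ... | no _ = ∈-++⁺ʳ (map (x ∷_) (sublists xs)) (filter-sublist P? xs)

  insertions⁺ : ∀ (x : A) as bs → as ++ x ∷ bs ∈ insertions x (as ++ bs)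
  insertions⁺ x [] [] = here refl
  insertions⁺ x [] (b ∷ bs) = here refl
  insertions⁺ x (a ∷ as) bs = there (∈-map⁺ (a ∷_) (insertions⁺ x as bs))

  insertions⁻ : ∀ (x : A) zs {ys} → ys ∈ insertions x zs → ∃ λ as → ∃ λ bs → ys ≡ as ++ x ∷ bs × zs ≡ as ++ bs
  insertions⁻ x [] (here refl) = [] , [] , refl , refl
  insertions⁻ x (z ∷ zs) (here refl) = [] , z ∷ zs , refl , refl
  insertions⁻ x (z ∷ zs) (there m) with ∈-map⁻ (z ∷_) m
  ... | ws , ws∈ , refl with insertions⁻ x zs ws∈
  ...   | as , bs , refl , refl = z ∷ as , bs , refl , refl

  insertions-unique : ∀ {x : A} {zs} → x ∉ zs → Unique (insertions x zs)
  insertions-unique {zs = []} x∉ = [] ∷ []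
  insertions-unique {x} {z ∷ zs} x∉ =
    ∉-head (λ m → let (_ , _ , e) = ∈-map⁻ (z ∷_) m in x∉ (here (∷-injectiveˡ e))) ∷
    Unique.map⁺ ∷-injectiveʳ (insertions-unique (x∉ ∘ there))

  insertion-injective : ∀ {x : A} as as′ {bs bs′} → x ∉ as → x ∉ as′ → as ++ x ∷ bs ≡ as′ ++ x ∷ bs′ →
    as ++ bs ≡ as′ ++ bs′
  insertion-injective [] [] _ _ refl = refl
  insertion-injective [] (a ∷ as′) _ n refl = contradiction (here refl) n
  insertion-injective (a ∷ as) [] n _ refl = contradiction (here refl) n
  insertion-injective (a ∷ as) (a′ ∷ as′) n n′ e with ∷-injective e
  ... | refl , e′ = cong (a ∷_) (insertion-injective as as′ (n ∘ there) (n′ ∘ there) e′)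

  permutations⁺ : ∀ (xs : List A) {ys} → ys ↭ xs → ys ∈ permutations xs
  permutations⁺ [] e rewrite Perm.↭-empty-inv e = here refl
  permutations⁺ (x ∷ xs) e with ∈-∃++ (Perm.∈-resp-↭ (↭-sym e) (here refl))
  ... | as , bs , refl = concatMap⁺ (insertions x)
    (permutations⁺ xs (Perm.drop-mid as [] e)) (insertions⁺ x as bs)

  permutations⁻ : ∀ (xs : List A) {ys} → ys ∈ permutations xs → ys ↭ xs
  permutations⁻ [] (here refl) = ↭-refl
  permutations⁻ (x ∷ xs) m with concatMap⁻ (insertions x) m
  ... | zs , zs∈ , ys∈ with insertions⁻ x zs ys∈
  ...   | as , bs , refl , refl = ↭-trans (Perm.shift x as bs) (Perm.prep x (permutations⁻ xs zs∈))

  permutations-unique : ∀ {xs : List A} → Unique xs → Unique (permutations xs)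
  permutations-unique [] = [] ∷ []
  permutations-unique {x ∷ xs} u@(_ ∷ u′) = concatMap-unique (permutations-unique u′)
    (λ zs∈ → insertions-unique (absent zs∈)) separate
    where
    absent : ∀ {zs} → zs ∈ permutations xs → x ∉ zs
    absent zs∈ x∈ = head-∉ u (Perm.∈-resp-↭ (permutations⁻ xs zs∈) x∈)
    separate : ∀ {zs zs′ y} → zs ∈ permutations xs → zs′ ∈ permutations xs →
               y ∈ insertions x zs → y ∈ insertions x zs′ → zs ≡ zs′
    separate {zs} {zs′} zs∈ zs′∈ m m′ with insertions⁻ x zs m | insertions⁻ x zs′ m′
    ... | as , bs , refl , refl | as′ , bs′ , e , refl =
      insertion-injective as as′ (absent zs∈ ∘ ∈-++⁺ˡ) (absent zs′∈ ∘ ∈-++⁺ˡ) e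

  -- A list L cut in two: the first part is kept in reverse, so that L = P ʳ++ V.

  splits-from : List A → List A → List (List A × List A)
  splits-from P [] = (P , []) ∷ []
  splits-from P (x ∷ V) = (P , x ∷ V) ∷ splits-from (x ∷ P) V

  splits : List A → List (List A × List A)
  splits = splits-from []

  splits-from⁻ : ∀ P V {P′ V′} → (P′ , V′) ∈ splits-from P V → P′ ʳ++ V′ ≡ P ʳ++ V
  splits-from⁻ P [] (here refl) = refl
  splits-from⁻ P (x ∷ V) (here refl) = refl
  splits-from⁻ P (x ∷ V) (there m) = splits-from⁻ (x ∷ P) V m

  splits-from-refl : ∀ P V → (P , V) ∈ splits-from P V
  splits-from-refl P [] = here refl
  splits-from-refl P (x ∷ V) = here refl

  splits-⊆ : ∀ P V {s} → s ∈ splits-from P V → s ∈ splits (P ʳ++ V)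
  splits-⊆ [] V m = m
  splits-⊆ (x ∷ P) V m = splits-⊆ P (x ∷ V) (there m)

  splits⁺ : ∀ P V → (P , V) ∈ splits (P ʳ++ V)
  splits⁺ P V = splits-⊆ P V (splits-from-refl P V)


  splits-from-length : ∀ P V {P′ V′} → (P′ , V′) ∈ splits-from P V → length V′ ≤ length V
  splits-from-length P [] (here refl) = ℕ.≤-refl
  splits-from-length P (x ∷ V) (here refl) = ℕ.≤-refl
  splits-from-length P (x ∷ V) (there m) = ℕ.m≤n⇒m≤1+n (splits-from-length (x ∷ P) V m)

  splits-from-unique : ∀ P V → Unique (splits-from P V)
  splits-from-unique P [] = [] ∷ []
  splits-from-unique P (x ∷ V) =
    ∉-head (λ m → ℕ.n≮n _ (splits-from-length (x ∷ P) V m)) ∷ splits-from-unique (x ∷ P) V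

  module _ {R : A → A → Set} where

    allPairs-ʳ++⁻ : ∀ P {V} → AllPairs R (P ʳ++ V) →
                    AllPairs (flip R) P × AllPairs R V × All (λ p → All (R p) V) P
    allPairs-ʳ++⁻ [] v = [] , v , []
    allPairs-ʳ++⁻ (x ∷ P) g with allPairs-ʳ++⁻ P g
    ... | p , h ∷ v , c = All.map All.head c ∷ p , v , h ∷ All.map All.tail c

    allPairs-ʳ++⁺ : ∀ P {V} → AllPairs (flip R) P → AllPairs R V → All (λ p → All (R p) V) P →
      AllPairs R (P ʳ++ V)
    allPairs-ʳ++⁺ [] _ v _ = v
    allPairs-ʳ++⁺ (x ∷ P) (h ∷ p) v (hx ∷ c) = allPairs-ʳ++⁺ P p (hx ∷ v)
      (All.zipWith (λ (a , b) → a ∷ b) (h , c))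

  ʳ++-insert : ∀ P (x : A) V → P ʳ++ x ∷ V ↭ x ∷ (P ʳ++ V)
  ʳ++-insert P x V = ↭-trans (↭-sym (Perm.++↭ʳ++ P (x ∷ V)))
    (↭-trans (Perm.shift x P V) (Perm.prep x (Perm.++↭ʳ++ P V)))

  ∈-ʳ++⁻ : ∀ P {V} {x : A} → x ∈ P ʳ++ V → x ∈ P ⊎ x ∈ V
  ∈-ʳ++⁻ P {V} m = ∈-++⁻ P (Perm.∈-resp-↭ (↭-sym (Perm.++↭ʳ++ P V)) m)

  ∈-ʳ++⁺ : ∀ P {V} {x : A} → x ∈ P ⊎ x ∈ V → x ∈ P ʳ++ V
  ∈-ʳ++⁺ P {V} (inj₁ m) = Perm.∈-resp-↭ (Perm.++↭ʳ++ P V) (∈-++⁺ˡ m)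
  ∈-ʳ++⁺ P {V} (inj₂ m) = Perm.∈-resp-↭ (Perm.++↭ʳ++ P V) (∈-++⁺ʳ P m)

-- The words of B

module _ {N : ℕ} where

  endpoints : Arrow N → Fin N × Fin N
  endpoints α = source α , target α

  nontrivialArrow⁻ : ∀ p {α : Arrow N} → α ∈ nontrivialArrow p → endpoints α ≡ p
  nontrivialArrow⁻ (k , i) m with endpoint? k i
  nontrivialArrow⁻ (k , i) (here refl) | no _ = refl

  nontrivialArrow⁺ : ∀ (α : Arrow N) → α ∈ nontrivialArrow (endpoints α)
  nontrivialArrow⁺ α with endpoint? (source α) (target α)
  ... | yes e = contradiction e (nontrivial′ α)
  ... | no _ = here refl

  nontrivialArrow-unique : ∀ (p : Fin N × Fin N) → Unique (nontrivialArrow p)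
  nontrivialArrow-unique (k , i) with endpoint? k i
  ... | yes _ = []
  ... | no _ = [] ∷ []

  ∈-arrows : ∀ (α : Arrow N) → α ∈ arrows N
  ∈-arrows α = concatMap⁺ nontrivialArrow (∈-cartesianProduct⁺ (∈-allFin (source α)) (∈-allFin (target α)))
    (nontrivialArrow⁺ α)

  arrows-unique : Unique (arrows N)
  arrows-unique = concatMap-unique (Unique.cartesianProduct⁺ (Unique.allFin⁺ N) (Unique.allFin⁺ N))
    (λ {p} _ → nontrivialArrow-unique p)
    (λ {p} {q} _ _ m m′ → trans (sym (nontrivialArrow⁻ p m)) (nontrivialArrow⁻ q m′))

  toDissection⁺ : ∀ {αs : List (Arrow N)} → AllPairs Compatible αs → ∃ λ D → D ∈ toDissection αs × cuts D ≡ αs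
  toDissection⁺ {αs} c with allPairs? compatible? αs
  ... | yes _ = _ , here refl , refl
  ... | no n = contradiction c n

  toDissection⁻ : ∀ {αs : List (Arrow N)} {D} → D ∈ toDissection αs → cuts D ≡ αs × AllPairs Compatible αs
  toDissection⁻ {αs} m with allPairs? compatible? αs
  toDissection⁻ (here refl) | yes c = refl , c

  toDissection-unique : ∀ (αs : List (Arrow N)) → Unique (toDissection αs)
  toDissection-unique αs with allPairs? compatible? αs
  ... | yes _ = [] ∷ []
  ... | no _ = []

  dissections-unique : Unique (dissections N)
  dissections-unique = concatMap-unique (sublists-unique arrows-unique) (λ {αs} _ → toDissection-unique αs)
    (λ _ _ m m′ → trans (sym (proj₁ (toDissection⁻ m))) (proj₁ (toDissection⁻ m′)))

  dissections⁻ : ∀ {D} → D ∈ dissections N → cuts D ∈ sublists (arrows N) × AllPairs Compatible (cuts D)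
  dissections⁻ m with concatMap⁻ toDissection {xs = sublists (arrows N)} m
  ... | αs , αs∈ , D∈ with toDissection⁻ D∈
  ...   | refl , c = αs∈ , c

  dissections⁺ : ∀ {αs} → αs ∈ sublists (arrows N) → AllPairs Compatible αs → ∃ λ D →
    D ∈ dissections N × cuts D ≡ αs
  dissections⁺ αs∈ c with toDissection⁺ c
  ... | D , D∈ , eq = D , concatMap⁺ toDissection αs∈ D∈ , eq

  cuts-injective : ∀ {D D′ : Dissection N} → cuts D ≡ cuts D′ → D ≡ D′
  cuts-injective {dissection _ _} {dissection _ _} refl = refl

  -- Required of all pairs of a list, this describes at once a dissection and a linear order
  -- compatible with its dual tree.
  Before : Arrow N → Arrow N → Set
  Before α β = Compatible α β × ¬ just β ≺ just α

  catMaybes-map-just : ∀ {A : Set} (xs : List A) → catMaybes (map just xs) ≡ xs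
  catMaybes-map-just [] = refl
  catMaybes-map-just (x ∷ xs) = cong (x ∷_) (catMaybes-map-just xs)

  -- The root region precedes all others, so it has to head the list, and the order of the arrows
  -- determines everything.
  linearOrders⁻ : ∀ {D : Dissection N} {rs} → rs ∈ linearOrders D →
    rs ≡ nothing ∷ map just (catMaybes rs) × catMaybes rs ↭ cuts D × AllPairs (λ α β → ¬ just β ≺ just α)
      (catMaybes rs)
  linearOrders⁻ {D} {rs} m with ∈-filter⁻ (allPairs? (λ r s → ¬? (s ≺? r))) {xs = permutations (regions D)} m
  ... | rs∈ , ordered with permutations⁻ (regions D) rs∈
  linearOrders⁻ {D} {[]} m | rs∈ , ordered | e = contradiction (Perm.↭-sym e) Perm.¬x∷xs↭[]
  linearOrders⁻ {D} {just β ∷ rs} m | rs∈ , h ∷ ordered | e =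
    contradiction tt (All.lookup h (root (Perm.∈-resp-↭ (↭-sym e) (here refl))))
    where
    root : nothing ∈ just β ∷ rs → nothing ∈ rs
    root (there m) = m
  linearOrders⁻ {D} {nothing ∷ rs} m | rs∈ , _ ∷ ordered | e with Perm.↭-map-inv just (↭-sym (Perm.drop-∷ e))
  ... | αs , refl , e′ rewrite catMaybes-map-just αs = refl , ↭-sym e′ , AllPairs.map⁻ ordered

  linearOrders⁺ : ∀ {D : Dissection N} {L} → L ↭ cuts D → AllPairs (λ α β → ¬ just β ≺ just α) L →
                  nothing ∷ map just L ∈ linearOrders D
  linearOrders⁺ {D} e o = ∈-filter⁺ (allPairs? (λ r s → ¬? (s ≺? r)))
    (permutations⁺ (regions D) (Perm.prep nothing (Perm.map⁺ just e)))
    (All.tabulate (λ _ ()) ∷ AllPairs.map⁺ o)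

  -- The words of B, indexed by the arrows in the order of their regions; the root region always comes first.

  orderedCuts : List (List (Arrow N))
  orderedCuts = concatMap (λ D → map catMaybes (linearOrders D)) (dissections N)

  orderedCuts⁻ : ∀ {L} → L ∈ orderedCuts → AllPairs Before L
  orderedCuts⁻ m with concatMap⁻ (λ D → map catMaybes (linearOrders D)) {xs = dissections N} m
  ... | D , D∈ , L∈ with ∈-map⁻ catMaybes L∈
  ...   | rs , rs∈ , refl with linearOrders⁻ {D} rs∈
  ...     | _ , e , o = AllPairs.zip (allPairs-↭ (λ {α} {β} → Compatible-sym {α = α} {β}) (↭-sym e)
    (proj₂ (dissections⁻ D∈)) , o)

  open DecMembership (_≟ᴬ_ {N}) using (_∈?_)

  before-↭ : ∀ {L} → AllPairs Before L → L ↭ filter (_∈? L) (arrows N)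
  before-↭ {L} g = unique-↭ (AllPairs.map (proj₁ ∘ proj₁) g) (Unique.filter⁺ (_∈? L) arrows-unique)
    (λ {α} α∈ → ∈-filter⁺ (_∈? L) (∈-arrows α) α∈) (λ α∈ → proj₂ (∈-filter⁻ (_∈? L) {xs = arrows N} α∈))

  -- The dissection belonging to L is the sublist of `arrows N` with the same members, the only
  -- arrangement of them in `dissections N`.
  orderedCuts⁺ : ∀ {L} → AllPairs Before L → L ∈ orderedCuts
  orderedCuts⁺ {L} g with dissections⁺ (filter-sublist (_∈? L) (arrows N))
      (allPairs-↭ (λ {α} {β} → Compatible-sym {α = α} {β}) (before-↭ g) (AllPairs.map proj₁ g))
  ... | D , D∈ , eq = concatMap⁺ (λ D → map catMaybes (linearOrders D)) D∈
    (subst (_∈ map catMaybes (linearOrders D)) (catMaybes-map-just L)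
      (∈-map⁺ catMaybes (linearOrders⁺ {D} (subst (L ↭_) (sym eq) (before-↭ g)) (AllPairs.map proj₂ g))))

  regions-unique : ∀ {D} → D ∈ dissections N → Unique (regions D)
  regions-unique D∈ = ∉-head (λ m → let (_ , _ , e) = ∈-map⁻ just m in case e) ∷
    Unique.map⁺ Maybe.just-injective (sublist-unique arrows-unique (proj₁ (dissections⁻ D∈)))
    where
    case : ∀ {α : Arrow N} → nothing ≢ just α
    case ()

  orderedCuts-unique : Unique orderedCuts
  orderedCuts-unique = concatMap-unique dissections-unique
    (λ {D} D∈ → map-unique
      (λ x∈ y∈ e → trans (proj₁ (linearOrders⁻ {D} x∈))
        (trans (cong (λ L → nothing ∷ map just L) e) (sym (proj₁ (linearOrders⁻ {D} y∈)))))
      (Unique.filter⁺ (allPairs? (λ r s → ¬? (s ≺? r))) (permutations-unique (regions-unique D∈))))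
    (λ {D} {D′} D∈ D′∈ m m′ → cuts-injective (same D D′ D∈ D′∈ m m′))
    where
    same : ∀ D D′ {L} → D ∈ dissections N → D′ ∈ dissections N → L ∈ map catMaybes (linearOrders D) →
           L ∈ map catMaybes (linearOrders D′) → cuts D ≡ cuts D′
    same D D′ D∈ D′∈ m m′ with ∈-map⁻ catMaybes m | ∈-map⁻ catMaybes m′
    ... | rs , rs∈ , e | rs′ , rs′∈ , e′ =
      sublists-set arrows-unique (proj₁ (dissections⁻ D∈)) (proj₁ (dissections⁻ D′∈))
        (Perm.∈-resp-↭ p) (Perm.∈-resp-↭ (↭-sym p))
      where
      p : cuts D ↭ cuts D′
      p = ↭-trans (↭-sym (proj₁ (proj₂ (linearOrders⁻ {D} rs∈))))
        (↭-trans (Perm.↭-reflexive (trans (sym e) e′)) (proj₁ (proj₂ (linearOrders⁻ {D′} rs′∈))))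

  -- A pair (P , V) stands for the list P ʳ++ V with a mark on the last region of P, the root region if P is empty.

  top : List (Arrow N) → Region N
  top []      = nothing
  top (α ∷ _) = just α

  marked : List (List (Arrow N) × List (Arrow N))
  marked = concatMap splits orderedCuts

  marked⁺ : ∀ {P V} → AllPairs Before (P ʳ++ V) → (P , V) ∈ marked
  marked⁺ {P} {V} g = concatMap⁺ splits (orderedCuts⁺ g) (splits⁺ P V)

  marked⁻ : ∀ {P V} → (P , V) ∈ marked → AllPairs Before (P ʳ++ V)
  marked⁻ m with concatMap⁻ splits {xs = orderedCuts} m
  ... | L , L∈ , s∈ = subst (AllPairs Before) (sym (splits-from⁻ [] L s∈)) (orderedCuts⁻ L∈)

  marked-unique : Unique marked
  marked-unique = concatMap-unique orderedCuts-unique (λ {L} _ → splits-from-unique [] L)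
    (λ {L} {L′} _ _ m m′ → trans (sym (splits-from⁻ [] L m)) (splits-from⁻ [] L′ m′))

  Triple : Set
  Triple = List (Arrow N) × Arrow N × List (Arrow N)

  Good : Triple → Set
  Good (P , α , V) = AllPairs Before (P ʳ++ α ∷ V)

  next : List (Arrow N) × List (Arrow N) → List Triple
  next (P , [])    = []
  next (P , α ∷ V) = (P , α , V) ∷ []

  adjacent : List Triple
  adjacent = concatMap next marked

  adjacent⁺ : ∀ {t} → Good t → t ∈ adjacent
  adjacent⁺ {P , α , V} g = concatMap⁺ next (marked⁺ {P} {α ∷ V} g) (here refl)

  adjacent⁻ : ∀ {t} → t ∈ adjacent → Good t
  adjacent⁻ m with concatMap⁻ next {xs = marked} m
  ... | (P , α ∷ V) , s∈ , here refl = marked⁻ {P} {α ∷ V} s∈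

  adjacent-unique : Unique adjacent
  adjacent-unique = concatMap-unique marked-unique (λ { {P , []} _ → [] ; {P , α ∷ V} _ → [] ∷ [] })
    λ { {_ , _ ∷ _} {_ , _ ∷ _} _ _ (here refl) (here refl) → refl }

  addable? : ∀ D (r : Region N) α → Dec (Addable D r α)
  addable? D r α = All.all? (compatible? α) D ×-dec (r ≺? just α) ×-dec
    All.all? (λ β → (r ≺? just β) →-dec ¬? (just β ≺? just α)) D

  additions : List (Arrow N) × List (Arrow N) → List (Arrow N)
  additions (P , V) = filter (addable? (P ʳ++ V) (top P)) (arrows N)

  -- The index set of D₂: a marked region together with an arrow dividing it, which takes its place
  -- in the order directly after that region.
  inserted : List Triple
  inserted = concatMap (λ s → map (λ α → proj₁ s , α , proj₂ s) (additions s)) marked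

  top-∈ : ∀ P {V} → top P ∈ nothing ∷ map just (P ʳ++ V)
  top-∈ [] = here refl
  top-∈ (ρ ∷ P) = there (∈-map⁺ just (∈-ʳ++⁺ (ρ ∷ P) (inj₁ (here refl))))

  before⇒⊀ : ∀ {P V β} → AllPairs Before (P ʳ++ V) → β ∈ P → ¬ top P ≺ just β
  before⇒⊀ {P} g β∈ p with proj₁ (allPairs-ʳ++⁻ P g)
  before⇒⊀ {ρ ∷ P} g (here refl) p | _ = ≺-irrefl {r = just ρ} p
  before⇒⊀ {ρ ∷ P} g (there β∈) p | h ∷ _ = proj₂ (All.lookup h β∈) p

  -- A region between r and α in the tree would also stand between them in the order, where they are
  -- neighbours. So for neighbours `≺` already means an edge of the dual tree.
  good⇒addable : ∀ {P α V} → Good (P , α , V) → top P ≺ just α → AllPairs Before (P ʳ++ V) × Addable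
    (P ʳ++ V) (top P) α
  good⇒addable {P} {α} {V} g r≺α with allPairs-ʳ++⁻ P g
  ... | p , h ∷ v , c = g′ , All.tabulate compat , r≺α , All.tabulate nested
    where
    g′ = allPairs-ʳ++⁺ P p v (All.map All.tail c)
    compat : ∀ {β} → β ∈ P ʳ++ V → Compatible α β
    compat {β} β∈ = [ (λ m → Compatible-sym {α = β} {α} (proj₁ (All.head (All.lookup c m)))) ,
      (λ m → proj₁ (All.lookup h m)) ]′ (∈-ʳ++⁻ P β∈)
    nested : ∀ {β} → β ∈ P ʳ++ V → top P ≺ just β → ¬ just β ≺ just α
    nested {β} β∈ r≺β β≺α = [ (λ m → before⇒⊀ {P} g m r≺β) , (λ m → proj₂ (All.lookup h m) β≺α) ]′ (∈-ʳ++⁻ P β∈)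

  -- What lies beyond α lies beyond r and so stands after r. A later β ≺ α would be comparable to r,
  -- hence lie between r and α or, against the given order, above r.
  addable⇒good : ∀ {P α V} → AllPairs Before (P ʳ++ V) → Addable (P ʳ++ V) (top P) α → Good (P , α , V)
  addable⇒good {P} {α} {V} g (compat , r≺α , nested) with allPairs-ʳ++⁻ P g
  ... | p , v , c = allPairs-ʳ++⁺ P p (All.tabulate after-α ∷ v)
    (All.zipWith (λ (x , y) → x ∷ y) (All.tabulate before-α , c))
    where
    before-α : ∀ {β} → β ∈ P → Before β α
    before-α {β} β∈ = Compatible-sym {α = α} {β} (All.lookup compat (∈-ʳ++⁺ P (inj₁ β∈))) ,
      λ α≺β → before⇒⊀ {P} g β∈ (≺-trans {r = top P} {α} {β} r≺α α≺β)
    after-α : ∀ {β} → β ∈ V → Before α β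
    after-α {β} β∈ = All.lookup compat β∈′ , λ β≺α → order β≺α
        (Regions.comparable (AllPairs.map proj₁ g) {top P} {just β} {α} (top-∈ P) (there (∈-map⁺ just β∈′))
          r≺α β≺α)
      where
      β∈′ = ∈-ʳ++⁺ P (inj₂ β∈)
      earlier : ∀ P → All (λ p → All (Before p) V) P → ∀ {ρ} → top P ≡ just ρ → Before ρ β
      earlier (ρ ∷ _) (h ∷ _) refl = All.lookup h β∈
      order : just β ≺ just α → ¬ Comparable (top P) (just β)
      order β≺α (inj₁ eq) = proj₁ (proj₁ (earlier P c eq)) refl
      order β≺α (inj₂ (inj₁ r≺β)) = All.lookup nested β∈′ r≺β β≺α
      order β≺α (inj₂ (inj₂ β≺r)) = not-root (top P) refl β≺r
        where
        not-root : ∀ s → top P ≡ s → ¬ just β ≺ s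
        not-root (just ρ) eq = proj₂ (earlier P c eq)

  Covers : Triple → Set
  Covers (P , α , _) = top P ≺ just α

  covers? : ∀ t → Dec (Covers t)
  covers? (P , α , _) = top P ≺? just α

  inserted⁻ : ∀ {t} → t ∈ inserted → Good t × Covers t
  inserted⁻ m with concatMap⁻ (λ s → map (λ α → proj₁ s , α , proj₂ s) (additions s)) {xs = marked} m
  ... | (P , V) , s∈ , t∈ with ∈-map⁻ (λ α → P , α , V) t∈
  ...   | α , α∈ , refl with proj₂ (∈-filter⁻ (addable? (P ʳ++ V) (top P)) {xs = arrows N} α∈)
  ...     | add = addable⇒good {P} (marked⁻ {P} s∈) add , proj₁ (proj₂ add)

  inserted⁺ : ∀ {t} → Good t → Covers t → t ∈ inserted
  inserted⁺ {P , α , V} g c with good⇒addable {P} {α} {V} g c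
  ... | g′ , add = concatMap⁺ (λ s → map (λ α → proj₁ s , α , proj₂ s) (additions s)) (marked⁺ {P} g′)
    (∈-map⁺ (λ α → P , α , V) (∈-filter⁺ (addable? (P ʳ++ V) (top P)) (∈-arrows α) add))

  inserted-unique : Unique inserted
  inserted-unique = concatMap-unique marked-unique
    (λ {s} _ → Unique.map⁺ (λ { refl → refl })
      (Unique.filter⁺ (addable? (proj₁ s ʳ++ proj₂ s) (top (proj₁ s))) arrows-unique))
    λ { {s} {s′} _ _ m m′ → let (_ , _ , e) = ∈-map⁻ (λ α → proj₁ s , α , proj₂ s) m
                                (_ , _ , e′) = ∈-map⁻ (λ α → proj₁ s′ , α , proj₂ s′) m′
                            in cong (λ (P , _ , V) → P , V) (trans (sym e) e′) }

  covering-↭ : filter covers? adjacent ↭ inserted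
  covering-↭ = unique-↭ (Unique.filter⁺ covers? adjacent-unique) inserted-unique
    (λ m → let (m′ , c) = ∈-filter⁻ covers? {xs = adjacent} m in inserted⁺ (adjacent⁻ m′) c)
    (λ m → let (g , c) = inserted⁻ m in ∈-filter⁺ covers? (adjacent⁺ g) c)

  -- For empty P the marked region is the root, and such triples are always covering; the identity
  -- there makes the map an involution on all triples.
  exchange : Triple → Triple
  exchange ([]    , α , V) = [] , α , V
  exchange (β ∷ P , α , V) = α ∷ P , β , V

  exchange-injective : ∀ {t u} → exchange t ≡ exchange u → t ≡ u
  exchange-injective {[] , _ , _} {[] , _ , _} refl = refl
  exchange-injective {_ ∷ _ , _ , _} {_ ∷ _ , _ , _} refl = refl

  exchange-involutive : ∀ t → exchange (exchange t) ≡ t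
  exchange-involutive ([] , _ , _) = refl
  exchange-involutive (_ ∷ _ , _ , _) = refl

  -- The order excludes α ≺ β and the failure of covering excludes β ≺ α; the exchange interchanges
  -- these two facts.
  exchange-good : ∀ {t} → Good t → ¬ Covers t → Good (exchange t) × ¬ Covers (exchange t)
  exchange-good {[] , α , V} g n = g , n
  exchange-good {β ∷ P , α , V} g n with allPairs-ʳ++⁻ P g
  ... | p , ((βα , ⊀) ∷ hβ) ∷ hα ∷ v , c =
    allPairs-ʳ++⁺ P p (((Compatible-sym {α = β} {α} βα , n) ∷ hα) ∷ hβ ∷ v)
      (All.map (λ { (x ∷ y ∷ z) → y ∷ x ∷ z }) c) , ⊀

  noncovering : List Triple
  noncovering = filter (¬? ∘ covers?) adjacent

  exchange-↭ : map exchange noncovering ↭ noncovering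
  exchange-↭ = unique-↭ (Unique.map⁺ exchange-injective u) u to from
    where
    u = Unique.filter⁺ (¬? ∘ covers?) adjacent-unique
    swapped : ∀ {t} → t ∈ noncovering → exchange t ∈ noncovering
    swapped {t} m = let (t∈ , n) = ∈-filter⁻ (¬? ∘ covers?) {xs = adjacent} m
                        (g′ , n′) = exchange-good {t} (adjacent⁻ t∈) n
                    in ∈-filter⁺ (¬? ∘ covers?) (adjacent⁺ g′) n′
    to : ∀ {t} → t ∈ map exchange noncovering → t ∈ noncovering
    to m = let (u , u∈ , e) = ∈-map⁻ exchange m in subst (_∈ noncovering) (sym e) (swapped u∈)
    from : ∀ {t} → t ∈ noncovering → t ∈ map exchange noncovering
    from {t} m = subst (_∈ map exchange noncovering) (exchange-involutive t) (∈-map⁺ exchange (swapped m))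

  adjacent-↭ : adjacent ↭ inserted ++ noncovering
  adjacent-↭ = ↭-trans (unique-↭ adjacent-unique
      (Unique.++⁺ (Unique.filter⁺ covers? adjacent-unique) (Unique.filter⁺ (¬? ∘ covers?) adjacent-unique)
        λ { (m , m′) → proj₂ (∈-filter⁻ (¬? ∘ covers?) {xs = adjacent} m′)
          (proj₂ (∈-filter⁻ covers? {xs = adjacent} m)) })
      split-∈ (λ m → [ proj₁ ∘ ∈-filter⁻ covers? {xs = adjacent} , proj₁ ∘ ∈-filter⁻
        (¬? ∘ covers?) {xs = adjacent} ]′ (∈-++⁻ (filter covers? adjacent) m)))
    (Perm.++⁺ʳ noncovering covering-↭)
    where
    split-∈ : ∀ {t} → t ∈ adjacent → t ∈ filter covers? adjacent ++ noncovering
    split-∈ {t} m with covers? t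
    ... | yes c = ∈-++⁺ˡ (∈-filter⁺ covers? m c)
    ... | no n = ∈-++⁺ʳ (filter covers? adjacent) (∈-filter⁺ (¬? ∘ covers?) m n)

-- Formal linear combinations

module _ {X : Set} {_∼_ : Lin X → Lin X → Set} where

  infix 4 _≋_
  _≋_ : Lin X → Lin X → Set
  _≋_ = Quotient _∼_

  ≡⇒≋ : ∀ {u v} → u ≡ v → u ≋ v
  ≡⇒≋ refl = ≈-refl

  ↭⇒≋ : ∀ {u v} → u ↭ v → u ≋ v
  ↭⇒≋ Perm.refl = ≈-refl
  ↭⇒≋ (Perm.prep x p) = ++-cong {u = x ∷ []} ≈-refl (↭⇒≋ p)
  ↭⇒≋ (Perm.swap x y p) = ++-cong {u = x ∷ y ∷ []} (++-comm (x ∷ []) (y ∷ [])) (↭⇒≋ p)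
  ↭⇒≋ (Perm.trans p q) = ≈-trans (↭⇒≋ p) (↭⇒≋ q)

  module _ {I : Set} where

    concatMap-≋ : ∀ {f g : I → Lin X} xs → (∀ {x} → x ∈ xs → f x ≋ g x) → concatMap f xs ≋ concatMap g xs
    concatMap-≋ [] h = ≈-refl
    concatMap-≋ (x ∷ xs) h = ++-cong (h (here refl)) (concatMap-≋ xs (h ∘ there))

    cancel-≋ : ∀ {f g : I → ℚ × X} xs → (∀ {x} → x ∈ xs → f x ∷ g x ∷ [] ≋ []) → map f xs ++ map g xs ≋ []
    cancel-≋ [] h = ≈-refl
    cancel-≋ {f} {g} (x ∷ xs) h = ≈-trans (↭⇒≋ (Perm.prep (f x) (Perm.shift (g x) (map f xs) (map g xs))))
      (++-cong {u = f x ∷ g x ∷ []} (h (here refl)) (cancel-≋ xs (h ∘ there)))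

  scale-+ : ∀ a b u → scale a u ++ scale b u ≋ scale (a ℚ.+ b) u
  scale-+ a b [] = ≈-refl
  scale-+ a b ((c , x) ∷ u) = ≈-trans
    (↭⇒≋ (Perm.prep _ (Perm.shift (b ℚ.* c , x) (scale a u) (scale b u))))
    (≈-trans (++-cong {u = (a ℚ.* c , x) ∷ (b ℚ.* c , x) ∷ []} (merge (a ℚ.* c) (b ℚ.* c) x) (scale-+ a b u))
      (≡⇒≋ (cong (λ q → (q , x) ∷ scale (a ℚ.+ b) u) (sym (ℚ.*-distribʳ-+ c a b)))))

  scale-1 : ∀ (u : Lin X) → scale 1ℚ u ≡ u
  scale-1 [] = refl
  scale-1 ((c , x) ∷ u) = cong₂ _∷_ (cong (_, x) (ℚ.*-identityˡ c)) (scale-1 u)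

  -- u = ½ u + ½ u = ½ (u + u).
  double-≋ : ∀ {u} → u ++ u ≋ [] → u ≋ []
  double-≋ {u} h = ≈-trans (≡⇒≋ (sym (scale-1 u)))
    (≈-trans (≈-sym (scale-+ ½ ½ u)) (≈-trans (≡⇒≋ (sym (map-++ _ u u))) (scale-cong ½ h)))

  opposite-≋ : ∀ q x → (q , x) ∷ (ℚ.- q , x) ∷ [] ≋ []
  opposite-≋ q x = ≈-trans (merge q (ℚ.- q) x)
    (≈-trans (≡⇒≋ (cong (λ c → (c , x) ∷ []) (ℚ.+-inverseʳ q))) (vanish x))

module _ {R : Set} where

  word-≋ : ∀ u v {d} (x : Λ R (suc d)) → [ u ∣ x ∣ v ] ≈ᴮ map (λ (a , m) → a , u ++ letter d (monomial m) ∷ v) x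
  -- The zero letter is 0 times itself, so the word is 0 times a word.
  word-≋ u v [] = ≈-trans (relation (mult u v 0ℚ [])) (vanish _)
  word-≋ u v ((a , m) ∷ x) = ≈-trans (relation (sum u v ((a , m) ∷ []) x)) (++-cong term (word-≋ u v x))
    where
    term : [ u ∣ (a , m) ∷ [] ∣ v ] ≈ᴮ (a , u ++ letter _ (monomial m) ∷ v) ∷ []
    term = ≈-trans (≡⇒≋ (cong (λ c → [ u ∣ (c , m) ∷ [] ∣ v ]) (sym (ℚ.*-identityʳ a))))
      (≈-trans (relation (mult u v a (monomial m))) (≡⇒≋ (cong (λ c → (c , _) ∷ []) (ℚ.*-identityʳ a))))

  scaled-word-≋ : ∀ c u v {d} (x : Λ R (suc d)) →
    (c , u ++ letter d x ∷ v) ∷ [] ≈ᴮ map (λ (a , m) → c ℚ.* a , u ++ letter d (monomial m) ∷ v) x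
  scaled-word-≋ c u v x = ≈-trans (≡⇒≋ (cong (λ q → (q , _) ∷ []) (sym (ℚ.*-identityʳ c))))
    (≈-trans (scale-cong c (word-≋ u v x)) (≡⇒≋ (sym (map-∘ x))))

  swap-≋ : ∀ c u v (x y : Polygon R) →
    (c , u ++ letter 1 (monomial (x ∷ y ∷ [])) ∷ v) ∷ (c , u ++ letter 1 (monomial (y ∷ x ∷ [])) ∷ v) ∷ [] ≈ᴮ []
  swap-≋ c u v x y = ≈-trans (≡⇒≋ (cong (λ q → (q , _) ∷ (q , _) ∷ []) (sym (ℚ.*-identityʳ c))))
    (scale-cong c {u = [ u ∣ monomial (x ∷ y ∷ []) ∣ v ] ++ [ u ∣ monomial (y ∷ x ∷ []) ∣ v ]} {v = []}
      (≈-trans (≈-sym (relation (sum u v (monomial (x ∷ y ∷ [])) (monomial (y ∷ x ∷ [])))))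
        (≈-trans (relation (resp u v (relation (swap [] x y [])))) (word-≋ u v []))))

  ∂-monomial-polygon : ∀ (p : Polygon R) → ∂ (monomial (p ∷ [])) ≡ ∂-polygon p
  ∂-monomial-polygon p = begin
    scale 1ℚ ((∂-polygon p ∧ monomial []) ++ []) ++ []  ≡⟨ ++-identityʳ _ ⟩
    scale 1ℚ ((∂-polygon p ∧ monomial []) ++ [])        ≡⟨ scale-1 {_∼_ = Alternating} _ ⟩
    (∂-polygon p ∧ monomial []) ++ []                   ≡⟨ ++-identityʳ _ ⟩
    ∂-polygon p ∧ monomial []                           ≡⟨ wedge-unit (∂-polygon p) ⟩
    ∂-polygon p                                         ∎
    where
    open ≡-Reasoning
    wedge-unit : ∀ (x : Λ R 2) → x ∧ monomial [] ≡ x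
    wedge-unit [] = refl
    wedge-unit ((c , a ∷ b ∷ []) ∷ x) = cong₂ _∷_ (cong (_, a ∷ b ∷ []) (ℚ.*-identityʳ c)) (wedge-unit x)

sign-+ : ∀ m n → sign (m ℕ.+ n) ≡ sign m ℚ.* sign n
sign-+ zero n = sym (ℚ.*-identityˡ (sign n))
sign-+ (suc m) n = trans (cong ℚ.-_ (sign-+ m n)) (ℚ.neg-distribˡ-* (sign m) (sign n))

sign-square : ∀ n → sign n ℚ.* sign n ≡ 1ℚ
sign-square zero = refl
sign-square (suc n) = trans (sym (ℚ.neg-distribˡ-* (sign n) (ℚ.- sign n)))
  (trans (cong ℚ.-_ (sym (ℚ.neg-distribʳ-* (sign n) (sign n))))
    (trans (Group.⁻¹-involutive ℚ.+-0-group _) (sign-square n)))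

product : List ℚ → ℚ
product = foldr ℚ._*_ 1ℚ

product-↭ : ∀ {xs ys} → xs ↭ ys → product xs ≡ product ys
product-↭ Perm.refl = refl
product-↭ (Perm.prep x p) = cong (x ℚ.*_) (product-↭ p)
product-↭ (Perm.swap {xs} {ys} x y p) = begin
  x ℚ.* (y ℚ.* product xs)  ≡⟨ ℚ.*-assoc x y (product xs) ⟨
  x ℚ.* y ℚ.* product xs    ≡⟨ cong₂ ℚ._*_ (ℚ.*-comm x y) (product-↭ p) ⟩
  y ℚ.* x ℚ.* product ys    ≡⟨ ℚ.*-assoc y x (product ys) ⟩
  y ℚ.* (x ℚ.* product ys)  ∎
  where open ≡-Reasoning
product-↭ (Perm.trans p q) = trans (product-↭ p) (product-↭ q)

-- Boundary and sign of a region

module _ {N : ℕ} where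

  regionSides-↭ : ∀ {D D′ : List (Arrow N)} → D ↭ D′ → ∀ r → regionSides D r ≡ regionSides D′ r
  regionSides-↭ {D} {D′} e r = cong (orient r) (filter-≐ (meets? D r) (meets? D′ r)
    ((λ (o , b , f) → o , b , Perm.All-resp-↭ e f) , (λ (o , b , f) → o , b , Perm.All-resp-↭ (↭-sym e) f))
      (allFin N))

  module _ {D : List (Arrow N)} (comp : AllPairs Compatible D) {r : Region N} {α : Arrow N}
    (add : Addable D r α)
           (r∈ : r ∈ nothing ∷ map just D) where

    regionSides-other : ∀ {s} → s ∈ nothing ∷ map just D → s ≢ r → regionSides (α ∷ D) s ≡ regionSides D s
    regionSides-other {s} s∈ s≢r = cong (orient s) (filter-≐ (meets? (α ∷ D) s) (meets? D s)
      ((λ {j} → meets-other⁻ {j}) , (λ {j} → meets-other⁺ {j})) (allFin N))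
      where
      meets-other⁻ : ∀ {j} → Meets (α ∷ D) s j → Meets D s j
      meets-other⁻ {j} = Regions.meets-other⁻ comp add r∈ s∈ s≢r {j}
      meets-other⁺ : ∀ {j} → Meets D s j → Meets (α ∷ D) s j
      meets-other⁺ {j} = Regions.meets-other⁺ comp add r∈ s∈ s≢r {j}

numbers : ∀ {N} → Arrow N → ℕ × ℕ
numbers α = toℕ (source α) , toℕ (target α)

numbers-injective : ∀ {N} {α β : Arrow N} → numbers α ≡ numbers β → α ≡ β
numbers-injective e = arrow-≡ (Fin.toℕ-injective (cong proj₁ e)) (Fin.toℕ-injective (cong proj₂ e))

numbers-valid : ∀ {N} (α : Arrow N) → Valid N (numbers α)
numbers-valid α = k<N α , i<N α , nontrivial′ α ∘ first , nontrivial′ α ∘ second ,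
  λ (e , e′) → nontrivial′ α (closed e e′)

valid-numbers : ∀ {N} κ → Valid N κ → ∃ λ (α : Arrow N) → numbers α ≡ κ
valid-numbers {N} (k , i) (k< , i< , ne , ne′ , nw) = arrow k′ i′ nontriv , cong₂ _,_ k≡ i≡
  where
  k′ = fromℕ< k<
  i′ = fromℕ< i<
  k≡ : toℕ k′ ≡ k
  k≡ = Fin.toℕ-fromℕ< k<
  i≡ : toℕ i′ ≡ i
  i≡ = Fin.toℕ-fromℕ< i<
  nontriv : ¬ Endpoint k′ i′
  nontriv (first e) = ne (trans (sym k≡) (trans e i≡))
  nontriv (second e) = ne′ (trans (sym k≡) (trans e (cong suc i≡)))
  nontriv (closed e e′) = nw (trans (sym k≡) e , trans (cong suc (sym i≡)) e′)

valid-↭ : ∀ {N m} {P : Arrow N → Set} (P? : ∀ α → Dec (P α)) {f : Arrow N → ℕ × ℕ} →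
          (∀ {α} → P α → Valid m (f α)) → (∀ {α β} → P α → P β → f α ≡ f β → α ≡ β) →
          (∀ {κ} → Valid m κ → ∃ λ α → P α × f α ≡ κ) → map f (filter P? (arrows N)) ↭ map numbers (arrows m)
valid-↭ {N} {m} P? {f} valid injective surjective = unique-↭
    (map-unique (λ x∈ y∈ → injective (P-of x∈) (P-of y∈)) (Unique.filter⁺ P? arrows-unique))
    (Unique.map⁺ numbers-injective arrows-unique) to from
  where
  P-of : ∀ {α} → α ∈ filter P? (arrows N) → _
  P-of m = proj₂ (∈-filter⁻ P? {xs = arrows N} m)
  to : ∀ {κ} → κ ∈ map f (filter P? (arrows N)) → κ ∈ map numbers (arrows m)
  to κ∈ with ∈-map⁻ f κ∈
  ... | α , α∈ , refl with valid-numbers (f α) (valid (P-of α∈))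
  ...   | β , e = subst (_∈ map numbers (arrows m)) e (∈-map⁺ numbers (∈-arrows β))
  from : ∀ {κ} → κ ∈ map numbers (arrows m) → κ ∈ map f (filter P? (arrows N))
  from κ∈ with ∈-map⁻ numbers κ∈
  ... | β , β∈ , refl with surjective (numbers-valid β)
  ...   | α , p , e = subst (_∈ map f (filter P? (arrows N))) e (∈-map⁺ f (∈-filter⁺ P? (∈-arrows α) p))

-- Arrows of π and arrows of the polygon of r have different types, so they are compared as pairs of
-- numbers.
index-↭ : ∀ {N} {D : List (Arrow N)} → AllPairs Compatible D → ∀ {r} → r ∈ nothing ∷ map just D → 2 ≤ N →
          map (index D r) (filter (addable? D r) (arrows N)) ↭ map numbers (arrows (length (regionSides D r)))
index-↭ {D = D} comp {r} r∈ 2≤N = valid-↭ (addable? D r) (addable-valid comp r∈ 2≤N)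
  (addable-injective comp r∈ 2≤N) (addable-surjective comp r∈ 2≤N)

-- Signs and label lists of an arrow given by its numbers

sgnN : ℕ → ℕ → ℚ
sgnN k i with k ≤? i
... | yes _ = 1ℚ
... | no _  = sign (k ∸ suc i)

sgnN-forward : ∀ {A F : Set} {σ : List A} {k i rest cut} → Cut F σ k i rest cut → F → sgnN k i ≡ 1ℚ
sgnN-forward (forward _ X Y y Z refl refl refl refl refl) _ with length X ≤? length X + length Y
... | yes _ = refl
... | no ¬l = contradiction (ℕ.m≤m+n (length X) (length Y)) ¬l
sgnN-forward (backward ¬f _ _ _ _ _ _ _ _ _) f = contradiction f ¬f

-- The exponent k - i - 1 is one less than the number of sides of the part cut off, that is, its
-- weight. This connects the sign of an arrow with the sign of a dissection.
sgnN-backward : ∀ {A F : Set} {σ : List A} {k i rest cut} → Cut F σ k i rest cut → ¬ F → sgnN k i ≡ sign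
  (length cut ∸ 1)
sgnN-backward (forward f _ _ _ _ _ _ _ _ _) ¬f = contradiction f ¬f
sgnN-backward (backward _ X Y y Z refl refl refl refl refl) _ with length X + suc (length Y) ≤? length X
... | yes l = contradiction l (ℕ.<⇒≱ (ℕ.m<m+n (length X) (s≤s z≤n)))
... | no _ = cong sign (trans (trans (cong (_∸ suc (length X)) (ℕ.+-suc (length X) (length Y)))
  (ℕ.m+n∸m≡n (suc (length X)) (length Y))) (cong (_∸ 1) (sym (length-reverse (y ∷ Y)))))

module _ {A B : Set} (f : A → B) where

  rtN-map : ∀ xs k i → map f (rtN xs k i) ≡ rtN (map f xs) k i
  rtN-map xs k i with k ≤? i
  ... | yes _ = trans (map-++ f (take k xs) (drop i xs)) (sym (cong₂ _++_ (take-map k xs) (drop-map i xs)))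
  ... | no _ = trans (map-++ f (take (suc i) xs) (drop k xs))
    (sym (cong₂ _++_ (take-map (suc i) xs) (drop-map k xs)))

  coN-map : ∀ xs k i → map f (coN xs k i) ≡ coN (map f xs) k i
  coN-map xs k i with k ≤? i
  ... | yes _ = sym (trans (cong (drop k) (take-map (suc i) xs)) (drop-map k (take (suc i) xs)))
  ... | no _ = trans (reverse-map f (drop i (take k xs))) (cong reverse
    (sym (trans (cong (drop i) (take-map k xs)) (drop-map i (take k xs)))))

module _ {R : Set} where

  rtLabels≡ : ∀ (xs : List R) α → rtLabels xs α ≡ rtN xs (toℕ (source α)) (toℕ (target α))
  rtLabels≡ xs α with toℕ (source α) ≤? toℕ (target α)
  ... | yes _ = refl
  ... | no _ = refl

  coLabels≡ : ∀ (xs : List R) α → coLabels xs α ≡ coN xs (toℕ (source α)) (toℕ (target α))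
  coLabels≡ xs α with toℕ (source α) ≤? toℕ (target α)
  ... | yes _ = refl
  ... | no _ = refl

  sgnArrow≡ : ∀ {N} (α : Arrow N) → sgnArrow α ≡ sgnN (toℕ (source α)) (toℕ (target α))
  sgnArrow≡ α with toℕ (source α) ≤? toℕ (target α)
  ... | yes _ = refl
  ... | no _ = refl

module _ {N : ℕ} where

  -- The sign of the region r changes by s if its polygon is reversed.

  δ : ℚ → Region N → ℚ
  δ s nothing  = 1ℚ
  δ s (just ρ) = ifForward ρ 1ℚ s

  δ-reversed : ∀ {s} r → Reversed r → δ s r ≡ s
  δ-reversed (just ρ) R = ifForward-no ρ R

  δ-same : ∀ {s} r → ¬ Reversed r → δ s r ≡ 1ℚ
  δ-same nothing _ = refl
  δ-same (just ρ) ¬R = split ρ (λ f → ifForward-yes ρ f) (λ ¬f → contradiction ¬f ¬R)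

  -- Each reversal costs a factor s: that of α through the sign of its own region, that of r through
  -- its changed weight. Two reversals make α forward in r, and the factors cancel.
  δ-sign : ∀ {α : Arrow N} {r s t} → s ℚ.* s ≡ 1ℚ → (ForwardIn r α → t ≡ 1ℚ) → (¬ ForwardIn r α → t ≡ s) →
           ifForward α 1ℚ s ℚ.* δ s r ≡ t
  δ-sign {α} {r} {s} s² fw bw with reversed? r
  ... | yes R = split α
    (λ f → trans (cong₂ ℚ._*_ (ifForward-yes α f) (δ-reversed r R)) (trans (ℚ.*-identityˡ s)
      (sym (bw λ { (inj₁ (_ , ¬R)) → ¬R R ; (inj₂ (¬f , _)) → ¬f f }))))
    (λ ¬f → trans (cong₂ ℚ._*_ (ifForward-no α ¬f) (δ-reversed r R)) (trans s² (sym (fw (inj₂ (¬f , R))))))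
  ... | no ¬R = split α
    (λ f → trans (cong₂ ℚ._*_ (ifForward-yes α f) (δ-same r ¬R)) (sym (fw (inj₁ (f , ¬R)))))
    (λ ¬f → trans (cong₂ ℚ._*_ (ifForward-no α ¬f) (δ-same r ¬R)) (trans (ℚ.*-identityʳ s)
      (sym (bw λ { (inj₁ (f , _)) → ¬f f ; (inj₂ (_ , R)) → ¬R R }))))

  product-change : ∀ {f g : Arrow N → ℚ} {ρ d} {xs : List (Arrow N)} → Unique xs → ρ ∈ xs → f ρ ≡ g ρ ℚ.* d →
                   (∀ {β} → β ∈ xs → β ≢ ρ → f β ≡ g β) → product (map f xs) ≡ product (map g xs) ℚ.* d
  product-change {f} {g} {d = d} {x ∷ xs} (h ∷ _) (here refl) e o = begin
    f x ℚ.* product (map f xs)         ≡⟨ cong₂ ℚ._*_ e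
      (cong product (map-cong-local (All.tabulate λ β∈ → o (there β∈) λ { refl → All.lookup h β∈ refl }))) ⟩
    g x ℚ.* d ℚ.* product (map g xs)   ≡⟨ ℚ.*-assoc (g x) d _ ⟩
    g x ℚ.* (d ℚ.* product (map g xs)) ≡⟨ cong (g x ℚ.*_) (ℚ.*-comm d _) ⟩
    g x ℚ.* (product (map g xs) ℚ.* d) ≡⟨ ℚ.*-assoc (g x) _ d ⟨
    g x ℚ.* product (map g xs) ℚ.* d   ∎
    where open ≡-Reasoning
  product-change {f} {g} {d = d} {x ∷ xs} (h ∷ u) (there ρ∈) e o =
    trans (cong₂ ℚ._*_ (o (here refl) (All.lookup h ρ∈)) (product-change {f} {g} u ρ∈ e (o ∘ there)))
      (sym (ℚ.*-assoc (g x) _ d))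

  signOf : (Region N → ℚ) → Arrow N → ℚ
  signOf F β = ifForward β 1ℚ (F (just β))

  -- Of the old regions only r may change its value, and this is felt only if its arrow is backward;
  -- the root region contributes no factor.
  signs-change : ∀ (F G : Region N → ℚ) {D r s} → Unique D → r ∈ nothing ∷ map just D →
                 (∀ {t} → t ∈ nothing ∷ map just D → t ≢ r → F t ≡ G t) → F r ≡ G r ℚ.* s →
                 product (map (signOf F) D) ≡ product (map (signOf G) D) ℚ.* δ s r
  signs-change F G {D} {nothing} u r∈ o e = trans
    (cong product (map-cong-local (All.tabulate λ {β} β∈ → cong (ifForward β 1ℚ)
      (o (there (∈-map⁺ just β∈)) λ ()))))
    (sym (ℚ.*-identityʳ (product (map (signOf G) D))))
  signs-change F G {D} {just ρ} {s} u r∈ o e = product-change u (just-∈⁻ r∈)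
    (split ρ (λ f → trans (ifForward-yes ρ f) (sym (cong₂ ℚ._*_ (ifForward-yes ρ f) (ifForward-yes ρ f))))
      (λ ¬f → trans (ifForward-no ρ ¬f) (trans e (sym (cong₂ ℚ._*_ (ifForward-no ρ ¬f) (ifForward-no ρ ¬f))))))
    (λ {β} β∈ ne → cong (ifForward β 1ℚ) (o (there (∈-map⁺ just β∈)) λ { refl → ne refl }))

  signs-∷ : ∀ (F G : Region N → ℚ) {D r α t} → Unique D → r ∈ nothing ∷ map just D →
            (∀ {t} → t ∈ nothing ∷ map just D → t ≢ r → F t ≡ G t) → F r ≡ G r ℚ.* F (just α) →
            F (just α) ℚ.* F (just α) ≡ 1ℚ → (ForwardIn r α → t ≡ 1ℚ) → (¬ ForwardIn r α → t ≡ F (just α)) →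
            product (map (signOf F) (α ∷ D)) ≡ product (map (signOf G) D) ℚ.* t
  signs-∷ F G {D} {r} {α} {t} u r∈ o e s² fw bw = begin
    c ℚ.* product (map (signOf F) D)  ≡⟨ cong (c ℚ.*_) (signs-change F G u r∈ o e) ⟩
    c ℚ.* (w ℚ.* d)                   ≡⟨ ℚ.*-assoc c w d ⟨
    c ℚ.* w ℚ.* d                     ≡⟨ cong (ℚ._* d) (ℚ.*-comm c w) ⟩
    w ℚ.* c ℚ.* d                     ≡⟨ ℚ.*-assoc w c d ⟩
    w ℚ.* (c ℚ.* d)                   ≡⟨ cong (w ℚ.*_) (δ-sign {α} {r} s² fw bw) ⟩
    w ℚ.* t                           ∎
    where
    open ≡-Reasoning
    c = signOf F α
    w = product (map (signOf G) D)
    d = δ (F (just α)) r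

-- Polygons and weights as functions of a list of arrows

two≤ : ∀ {R : Set} (p : Polygon R) → 2 ≤ length (labels p)
two≤ (polygon xs two) with 2 ≤? length xs
... | yes l = l
... | no n = ⊥-elim-irr (n two)

module _ {R : Set} (π : Polygon R) where

  -- The polygon with given labels; the value for less than two labels is not used.

  withLabels : List R → Polygon R
  withLabels xs with 2 ≤? length xs
  ... | yes two = polygon xs two
  ... | no _ = π

  withLabels-≡ : ∀ {xs} .(two : 2 ≤ length xs) → polygon xs two ≡ withLabels xs
  withLabels-≡ {xs} two with 2 ≤? length xs
  ... | yes _ = refl
  ... | no n = ⊥-elim-irr (n two)

  labels-withLabels : ∀ {xs} → 2 ≤ length xs → labels (withLabels xs) ≡ xs
  labels-withLabels {xs} two = cong labels (sym (withLabels-≡ {xs} two))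

  sideTerm : List R → ℕ × ℕ → ℚ × Vec (Polygon R) 2
  sideTerm xs (k , i) = sgnN k i , withLabels (rtN xs k i) ∷ withLabels (coN xs k i) ∷ []

  ∂-polygon-≡ : ∀ p → ∂-polygon p ≡ map (sideTerm (labels p)) (map numbers (arrows (length (labels p))))
  ∂-polygon-≡ p = trans (map-cong term (arrows _)) (map-∘ (arrows _))
    where
    term : ∀ α → (sgnArrow α , π-rt p α ∷ π-co p α ∷ []) ≡ sideTerm (labels p) (numbers α)
    term α = cong₂ _,_ (sgnArrow≡ {R} α) (cong₂ (λ x y → x ∷ y ∷ [])
      (trans (withLabels-≡ (two-rt (labels p) α)) (cong withLabels (rtLabels≡ (labels p) α)))
      (trans (withLabels-≡ (two-co (labels p) α)) (cong withLabels (coLabels≡ (labels p) α))))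

  private
    N = length (labels π)

  2≤N : 2 ≤ N
  2≤N = two≤ π

  sides : List (Fin N) → List R
  sides = map (lookup (labels π))

  opaque

    -- Defined for arbitrary lists, so that lists can be permuted and extended without carrying
    -- proofs of compatibility along.
    poly : List (Arrow N) → Region N → Polygon R
    poly D r = withLabels (sides (regionSides D r))

    poly-≡ : ∀ D r → poly D r ≡ withLabels (sides (regionSides D r))
    poly-≡ D r = refl

  regionPolygon≡ : ∀ D r → regionPolygon π D r ≡ poly (cuts D) r
  regionPolygon≡ (dissection D c) r = trans
    (withLabels-≡ {sides (regionSides D r)} (two-labels (labels π) c 2≤N r)) (sym (poly-≡ D r))

  poly-↭ : ∀ {D D′} → D ↭ D′ → ∀ r → poly D r ≡ poly D′ r
  poly-↭ {D} {D′} e r = trans (poly-≡ D r)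
    (trans (cong (withLabels ∘ sides) (regionSides-↭ e r)) (sym (poly-≡ D′ r)))

  two-sides-of : ∀ {D} → AllPairs Compatible D → ∀ r → 2 ≤ length (sides (regionSides D r))
  two-sides-of {D} comp r = subst (2 ≤_) (sym (length-map _ (regionSides D r))) (two-region comp 2≤N r)

  χ-poly : ∀ {D} → AllPairs Compatible D → ∀ r → χ (poly D r) ≡ length (regionSides D r) ∸ 1
  χ-poly {D} comp r = trans (cong χ (poly-≡ D r)) (cong (_∸ 1)
    (trans (cong length (labels-withLabels {sides (regionSides D r)} (two-sides-of comp r)))
      (length-map _ (regionSides D r))))

  module _ {D : List (Arrow N)} (comp : AllPairs Compatible D) {r : Region N}
    (r∈ : r ∈ nothing ∷ map just D) where

    private
      σ = regionSides D r

      numbers-≡ : map (sideTerm (labels (poly D r))) (map numbers (arrows (length (labels (poly D r))))) ≡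
                  map (sideTerm (sides σ)) (map numbers (arrows (length σ)))
      numbers-≡ = cong₂ (λ xs m → map (sideTerm xs) (map numbers (arrows m)))
        labels-≡ (trans (cong length labels-≡) (length-map (lookup (labels π)) σ))
        where
        labels-≡ : labels (poly D r) ≡ sides σ
        labels-≡ = trans (cong labels (poly-≡ D r)) (labels-withLabels {sides σ} (two-sides-of comp r))

    ∂-poly : ∂-polygon (poly D r) ↭ map (sideTerm (sides (regionSides D r)) ∘ index D r)
      (filter (addable? D r) (arrows N))
    ∂-poly = ↭-trans (Perm.↭-reflexive (trans (∂-polygon-≡ (poly D r)) numbers-≡))
      (↭-trans (Perm.map⁺ (sideTerm (sides σ)) (↭-sym (index-↭ comp r∈ 2≤N)))
        (Perm.↭-reflexive (sym (map-∘ (filter (addable? D r) (arrows N))))))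

    module _ {α : Arrow N} (add : Addable D r α) where

      private
        k = proj₁ (index D r α)
        i = proj₂ (index D r α)
        cut = region-cut comp add
        comp′ : AllPairs Compatible (α ∷ D)
        comp′ = proj₁ add ∷ comp

      sideTerm-index : sideTerm (sides (regionSides D r)) (index D r α) ≡
                       (sgnN k i , poly (α ∷ D) r ∷ poly (α ∷ D) (just α) ∷ [])
      sideTerm-index = cong₂ (λ x y → sgnN k i , x ∷ y ∷ [])
        (trans (cong withLabels (trans (sym (rtN-map (lookup (labels π)) (regionSides D r) k i))
          (cong sides (sym (rtN-cut cut)))))
          (sym (poly-≡ (α ∷ D) r)))
        (trans (cong withLabels (trans (sym (coN-map (lookup (labels π)) (regionSides D r) k i))
          (cong sides (sym (coN-cut cut)))))
          (sym (poly-≡ (α ∷ D) (just α))))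

      χ-sum : χ (poly D r) ≡ χ (poly (α ∷ D) r) + χ (poly (α ∷ D) (just α))
      χ-sum = trans (χ-poly comp r) (trans
        (predecessors (length-cut-sum cut) (two-region comp′ 2≤N r) (two-region comp′ 2≤N (just α)))
        (sym (cong₂ _+_ (χ-poly comp′ r) (χ-poly comp′ (just α)))))
        where
        predecessors : ∀ {a b c} → suc a ≡ b + c → 2 ≤ b → 2 ≤ c → a ∸ 1 ≡ (b ∸ 1) + (c ∸ 1)
        predecessors {a} {suc b} {suc c} e _ _ = cong (_∸ 1) (trans (ℕ.suc-injective e) (ℕ.+-suc b c))

      s-co : ℚ
      s-co = sign (χ (poly (α ∷ D) (just α)))

      sgnN-forwardIn : ForwardIn r α → sgnN k i ≡ 1ℚ
      sgnN-forwardIn = sgnN-forward cut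

      sgnN-backwardIn : ¬ ForwardIn r α → sgnN k i ≡ s-co
      sgnN-backwardIn ¬f = trans (sgnN-backward cut ¬f) (cong sign (sym (χ-poly comp′ (just α))))

      poly-other : ∀ {s} → s ∈ nothing ∷ map just D → s ≢ r → poly (α ∷ D) s ≡ poly D s
      poly-other {s} s∈ s≢r = trans (poly-≡ (α ∷ D) s)
        (trans (cong (withLabels ∘ sides) (regionSides-other comp add r∈ s∈ s≢r)) (sym (poly-≡ D s)))

      poly-sign-other : ∀ {s} → s ∈ nothing ∷ map just D → s ≢ r → sign (χ (poly (α ∷ D) s)) ≡ sign
        (χ (poly D s))
      poly-sign-other s∈ s≢r = cong (sign ∘ χ) (poly-other s∈ s≢r)

      -- Weights add up, so removing the part beyond α changes the sign by that of this part, which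
      -- is its own inverse.
      sign-rest : sign (χ (poly (α ∷ D) r)) ≡ sign (χ (poly D r)) ℚ.* s-co
      sign-rest = sym (begin
        sign (χ (poly D r)) ℚ.* s-co                ≡⟨ cong (ℚ._* s-co) (trans (cong sign χ-sum) (sign-+ a _)) ⟩
        sign a ℚ.* s-co ℚ.* s-co                    ≡⟨ ℚ.*-assoc (sign a) s-co s-co ⟩
        sign a ℚ.* (s-co ℚ.* s-co)                  ≡⟨ cong (sign a ℚ.*_)
          (sign-square (χ (poly (α ∷ D) (just α)))) ⟩
        sign a ℚ.* 1ℚ                               ≡⟨ ℚ.*-identityʳ (sign a) ⟩
        sign a                                      ∎)
        where
        open ≡-Reasoning
        a = χ (poly (α ∷ D) r)

  sgnRegion : List (Arrow N) → Arrow N → ℚ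
  sgnRegion D α = ifForward α 1ℚ (sign (χ (poly D (just α))))

  weight : List (Arrow N) → ℚ
  weight D = product (map (sgnRegion D) D)

  sgnDissection≡ : ∀ D → sgnDissection π D ≡ weight (cuts D)
  sgnDissection≡ D = cong product (map-cong
    (λ α → cong (λ p → ifForward α 1ℚ (sign (χ p))) (regionPolygon≡ D (just α))) (cuts D))

  weight-↭ : ∀ {D D′} → D ↭ D′ → weight D ≡ weight D′
  weight-↭ {D} {D′} e = trans (cong product
    (map-cong (λ α → cong (λ p → ifForward α 1ℚ (sign (χ p))) (poly-↭ e (just α))) D))
    (product-↭ (Perm.map⁺ (sgnRegion D′) e))

  -- The agreement of signs: the factor of α and the change of the factor of r multiply to the sign
  -- of α as an arrow of the polygon of r.
  weight-∷ : ∀ {D} (comp : AllPairs Compatible D) {r} (r∈ : r ∈ nothing ∷ map just D) {α}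
    (add : Addable D r α) →
             weight (α ∷ D) ≡ weight D ℚ.* sgnN (proj₁ (index D r α)) (proj₂ (index D r α))
  weight-∷ {D} comp {r} r∈ {α} add =
    signs-∷ (λ s → sign (χ (poly (α ∷ D) s)))
      (λ s → sign (χ (poly D s))) {D} {r} {α} {sgnN (proj₁ (index D r α)) (proj₂ (index D r α))}
        (AllPairs.map proj₁ comp) r∈
      (poly-sign-other comp r∈ add) (sign-rest comp r∈ add) (sign-square (χ (poly (α ∷ D) (just α))))
      (sgnN-forwardIn comp r∈ add) (sgnN-backwardIn comp r∈ add)

-- The differential of B

concatMap-concatMap : ∀ {A B C : Set} (f : A → List B) (g : B → List C) xs →
                      concatMap g (concatMap f xs) ≡ concatMap (concatMap g ∘ f) xs
concatMap-concatMap f g [] = refl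
concatMap-concatMap f g (x ∷ xs) = trans (concatMap-++ g (f x) (concatMap f xs))
  (cong (concatMap g (f x) ++_) (concatMap-concatMap f g xs))

map-singletons : ∀ {A B : Set} (f : A → B) xs → map f xs ≡ concatMap (λ x → f x ∷ []) xs
map-singletons f [] = refl
map-singletons f (x ∷ xs) = cong (f x ∷_) (map-singletons f xs)

unique-middle : ∀ {A : Set} xs {y : A} {ys} → Unique (xs ++ y ∷ ys) → ∀ {z} → z ∈ xs ⊎ z ∈ ys → z ≢ y
unique-middle [] (h ∷ _) (inj₂ z∈) refl = All.lookup h z∈ refl
unique-middle (x ∷ xs) (h ∷ _) (inj₁ (here refl)) refl = All.lookup h (∈-++⁺ʳ xs (here refl)) refl
unique-middle (x ∷ xs) (_ ∷ u) (inj₁ (there z∈)) = unique-middle xs u (inj₁ z∈)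
unique-middle (x ∷ xs) (_ ∷ u) (inj₂ z∈) = unique-middle xs u (inj₂ z∈)

module _ {N : ℕ} where

  -- The regions before the marked one, in their order; P itself is stored in reverse.
  below : List (Arrow N) → List (Region N)
  below []      = []
  below (α ∷ P) = below P ++ top P ∷ []

  regions-ʳ++ : ∀ P V → below P ++ top P ∷ map just V ≡ nothing ∷ map just (P ʳ++ V)
  regions-ʳ++ [] V = refl
  regions-ʳ++ (α ∷ P) V = trans (++-assoc (below P) (top P ∷ []) (just α ∷ map just V)) (regions-ʳ++ P (α ∷ V))

  others : ∀ P {V s} → s ∈ below P ⊎ s ∈ map just V → s ∈ nothing ∷ map just (P ʳ++ V)
  others P {V} {s} (inj₁ m) = subst (s ∈_) (regions-ʳ++ P V) (∈-++⁺ˡ m)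
  others P {V} {s} (inj₂ m) = subst (s ∈_) (regions-ʳ++ P V) (∈-++⁺ʳ (below P) (there m))

  others-≢ : ∀ P {V s} → Unique (P ʳ++ V) → s ∈ below P ⊎ s ∈ map just V → s ≢ top P
  others-≢ P {V} u = unique-middle (below P) (subst Unique (sym (regions-ʳ++ P V))
    (All.map⁺ (All.tabulate λ _ ()) ∷ Unique.map⁺ Maybe.just-injective u))

module _ {R : Set} (π : Polygon R) where

  private
    N = length (labels π)

  polygonLetter : Polygon R → Letter R
  polygonLetter p = letter 0 (monomial (p ∷ []))

  letters : List (Arrow N) → List (Region N) → List (Letter R)
  letters L = map (λ r → polygonLetter (poly π L r))

  wordTerm : List (Arrow N) → ℚ × List (Letter R)
  wordTerm L = weight π L , letters L (nothing ∷ map just L)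

  B-words : B π ≡ map wordTerm orderedCuts
  B-words = trans (concatMap-cong per-dissection (dissections N))
    (sym (map-concatMap wordTerm (λ D → map catMaybes (linearOrders D)) (dissections N)))
    where
    per-order : ∀ D {rs} → rs ∈ linearOrders D →
      (sgnDissection π D , map (λ r → letter 0 (monomial (regionPolygon π D r ∷ []))) rs) ≡ wordTerm
        (catMaybes rs)
    per-order D {rs} rs∈ = cong₂ _,_ (trans (sgnDissection≡ π D) (weight-↭ π (↭-sym e)))
      (trans (map-cong {f = λ r → polygonLetter (regionPolygon π D r)} {g = λ r → polygonLetter
        (poly π (catMaybes rs) r)}
               (λ r → cong polygonLetter (trans (regionPolygon≡ π D r) (poly-↭ π (↭-sym e) r))) rs)
        (cong (letters (catMaybes rs)) (proj₁ (linearOrders⁻ {D = D} rs∈))))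
      where
      e : catMaybes rs ↭ cuts D
      e = proj₁ (proj₂ (linearOrders⁻ {D = D} rs∈))
    per-dissection : ∀ D → map (λ rs → sgnDissection π D , map
      (λ r → letter 0 (monomial (regionPolygon π D r ∷ []))) rs) (linearOrders D)
                           ≡ map wordTerm (map catMaybes (linearOrders D))
    per-dissection D = trans (map-cong-local (All.tabulate (per-order D))) (map-∘ (linearOrders D))

  markedWord : List (Arrow N) → List (Arrow N) → List (Arrow N) → Λ R 2 → List (Letter R)
  markedWord L P V x = letters L (below P) ++ letter 1 x ∷ letters L (map just V)

  pairWord : Triple {N} → List (Letter R)
  pairWord (P , α , V) = markedWord L P V (monomial (poly π L (top P) ∷ poly π L (just α) ∷ []))
    where L = P ʳ++ α ∷ V

  pairWeight : Triple {N} → ℚ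
  pairWeight (P , α , V) = weight π (P ʳ++ α ∷ V)

  -- The factor - 1 is the sign - (-1)^0 in D₁, all letters having exterior degree 1.
  wedgeTerm pairTerm : Triple {N} → ℚ × List (Letter R)
  wedgeTerm t = pairWeight t ℚ.* ℚ.- 1ℚ , pairWord t
  pairTerm  t = pairWeight t , pairWord t

  boundaryTerm : List (Arrow N) × List (Arrow N) → ℚ × List (Letter R)
  boundaryTerm (P , V) = weight π L ℚ.* 1ℚ , markedWord L P V (∂-polygon (poly π L (top P)))
    where L = P ʳ++ V

  extend : List (Arrow N) → List (Arrow N) → ℚ × List (Letter R) → ℚ × List (Letter R)
  extend L P (c , w) = weight π L ℚ.* c , letters L (below P) ++ w

  extend-∷ : ∀ L P α b → map (extend L P) (prepend (polygonLetter (poly π L (top P))) b) ≡ map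
    (extend L (α ∷ P)) b
  extend-∷ L P α b = trans (sym (map-∘ b)) (map-cong
    (λ (c , w) → cong (weight π L ℚ.* c ,_) (sym (trans (cong (_++ w) (map-++ _ (below P) (top P ∷ [])))
      (++-assoc (letters L (below P)) _ w)))) b)

  -- The differential runs along the word as `splits-from` does along the list: each step moves one
  -- region into P, and the running degree stays 0.
  D₁-marked : ∀ P V → map (extend (P ʳ++ V) P) (D₁-word 0 (letters (P ʳ++ V) (top P ∷ map just V)))
                      ≡ map wedgeTerm (concatMap next (splits-from P V))
  D₁-marked P [] = refl
  D₁-marked P (α ∷ V) = cong₂ _∷_ refl (trans (extend-∷ (P ʳ++ α ∷ V) P α _) (D₁-marked (α ∷ P) V))

  D₂-marked : ∀ P V → map (extend (P ʳ++ V) P) (D₂-word 0 (letters (P ʳ++ V) (top P ∷ map just V)))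
                      ≡ map boundaryTerm (splits-from P V)
  D₂-marked P [] = cong (λ x → (weight π (P ʳ++ []) ℚ.* 1ℚ , markedWord (P ʳ++ []) P [] x) ∷ [])
    (∂-monomial-polygon (poly π (P ʳ++ []) (top P)))
  D₂-marked P (α ∷ V) = cong₂ _∷_
    (cong (λ x → weight π (P ʳ++ α ∷ V) ℚ.* 1ℚ , markedWord (P ʳ++ α ∷ V) P (α ∷ V) x)
      (∂-monomial-polygon (poly π (P ʳ++ α ∷ V) (top P))))
    (trans (extend-∷ (P ʳ++ α ∷ V) P α _) (D₂-marked (α ∷ P) V))

  D₁-B : D₁ (B π) ≡ map wedgeTerm adjacent
  D₁-B = begin
    D₁ (B π)                                                            ≡⟨ cong D₁ B-words ⟩
    D₁ (map wordTerm orderedCuts)                                       ≡⟨ concatMap-map _ wordTerm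
      orderedCuts ⟩
    concatMap (λ L → map (extend L []) (D₁-word 0 (letters L (nothing ∷ map just L)))) orderedCuts
                                                                        ≡⟨ concatMap-cong (D₁-marked []) orderedCuts ⟩
    concatMap (map wedgeTerm ∘ concatMap next ∘ splits) orderedCuts     ≡⟨ map-concatMap wedgeTerm
      (concatMap next ∘ splits) (orderedCuts {N}) ⟨
    map wedgeTerm (concatMap (concatMap next ∘ splits) orderedCuts)     ≡⟨ cong (map wedgeTerm)
      (concatMap-concatMap splits next orderedCuts) ⟨
    map wedgeTerm adjacent                                              ∎
    where open ≡-Reasoning

  D₂-B : D₂ (B π) ≡ map boundaryTerm marked
  D₂-B = begin
    D₂ (B π)                                                            ≡⟨ cong D₂ B-words ⟩
    D₂ (map wordTerm orderedCuts)                                       ≡⟨ concatMap-map _ wordTerm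
      orderedCuts ⟩
    concatMap (λ L → map (extend L []) (D₂-word 0 (letters L (nothing ∷ map just L)))) orderedCuts
                                                                        ≡⟨ concatMap-cong (D₂-marked []) orderedCuts ⟩
    concatMap (map boundaryTerm ∘ splits) orderedCuts                   ≡⟨ map-concatMap boundaryTerm
      splits orderedCuts ⟨
    map boundaryTerm marked                                             ∎
    where open ≡-Reasoning

  letters-cong : ∀ {L L′} rs → (∀ {s} → s ∈ rs → poly π L s ≡ poly π L′ s) → letters L rs ≡ letters L′ rs
  letters-cong rs h = map-cong-local (All.tabulate λ s∈ → cong polygonLetter (h s∈))

  markedWord-cong : ∀ {L L′} P V {x y} →
    (∀ {s} → s ∈ below P ⊎ s ∈ map just V → poly π L s ≡ poly π L′ s) → x ≡ y →
                    markedWord L P V x ≡ markedWord L′ P V y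
  markedWord-cong P V h refl = cong₂ (λ u v → u ++ letter 1 _ ∷ v)
    (letters-cong (below P) (h ∘ inj₁)) (letters-cong (map just V) (h ∘ inj₂))

  -- Weight and polygons depend only on the set of arrows, so the two words agree outside the marked
  -- letter, whose factors are interchanged.
  exchange-≋ : ∀ {t} → t ∈ noncovering → wedgeTerm t ∷ wedgeTerm (exchange t) ∷ [] ≈ᴮ []
  -- The root region precedes every arrow, so a triple that is not covering has a non-empty P.
  exchange-≋ {[] , α , V} m = contradiction tt (proj₂ (∈-filter⁻ (¬? ∘ covers?) {xs = adjacent} m))
  exchange-≋ {β ∷ P , α , V} m = ≈-trans
    (≡⇒≋ (cong (λ t → wedgeTerm (β ∷ P , α , V) ∷ t ∷ []) (cong₂ _,_ (cong (ℚ._* ℚ.- 1ℚ) (weight-↭ π e))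
      (cong₂ (λ u v → u ++ letter 1 (monomial (poly π L′ (just α) ∷ poly π L′ (just β) ∷ [])) ∷ v)
        (letters-cong (below P ++ top P ∷ []) (λ {s} _ → poly-↭ π e s))
        (letters-cong (map just V) (λ {s} _ → poly-↭ π e s))))))
    (≈-trans (≡⇒≋ (cong₂ (λ x y → wedgeTerm (β ∷ P , α , V) ∷
        (c , letters L (below (β ∷ P)) ++ letter 1 (monomial (x ∷ y ∷ [])) ∷ letters L (map just V)) ∷ [])
        (poly-↭ π e (just α)) (poly-↭ π e (just β))))
      (swap-≋ c (letters L (below (β ∷ P))) (letters L (map just V)) (poly π L (just β)) (poly π L (just α))))
    where
    L L′ : List (Arrow N)
    L  = P ʳ++ β ∷ α ∷ V
    L′ = P ʳ++ α ∷ β ∷ V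
    c : ℚ
    c = pairWeight (β ∷ P , α , V) ℚ.* ℚ.- 1ℚ
    e : L′ ↭ L
    e = ↭-trans (↭-sym (Perm.++↭ʳ++ P (α ∷ β ∷ V)))
      (↭-trans (Perm.++⁺ˡ P (Perm.swap α β ↭-refl)) (Perm.++↭ʳ++ P (β ∷ α ∷ V)))

  noncovering-≋ : map wedgeTerm noncovering ≈ᴮ []
  noncovering-≋ = double-≋ (≈-trans
    (++-cong ≈-refl (≈-trans (↭⇒≋ (↭-sym (Perm.map⁺ wedgeTerm exchange-↭))) (≡⇒≋ (sym (map-∘ noncovering)))))
    (cancel-≋ noncovering exchange-≋))

  -- The marked letter is expanded linearly and its terms are indexed by the arrows dividing the
  -- region. The other letters stay the same because such an arrow changes no other region.
  boundary-≋ : ∀ {s} → s ∈ marked → boundaryTerm s ∷ [] ≈ᴮ map (λ α → pairTerm (proj₁ s , α , proj₂ s))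
    (additions s)
  boundary-≋ {P , V} s∈ = ≈-trans
    (scaled-word-≋ (weight π L ℚ.* 1ℚ) (letters L (below P)) (letters L (map just V))
      (∂-polygon (poly π L (top P))))
    (≈-trans (↭⇒≋ (Perm.map⁺ term (∂-poly π comp (top-∈ P))))
      (≡⇒≋ (trans (sym (map-∘ (additions (P , V)))) (map-cong-local (All.tabulate per-arrow)))))
    where
    L : List (Arrow N)
    L = P ʳ++ V
    good : AllPairs Before L
    good = marked⁻ {P = P} {V} s∈
    comp : AllPairs Compatible L
    comp = AllPairs.map proj₁ good
    term : ℚ × Vec (Polygon R) 2 → ℚ × List (Letter R)
    term (a , m) = weight π L ℚ.* 1ℚ ℚ.* a , markedWord L P V (monomial m)
    per-arrow : ∀ {α} → α ∈ additions (P , V) →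
      term (sideTerm π (sides π (regionSides L (top P))) (index L (top P) α)) ≡ pairTerm (P , α , V)
    per-arrow {α} α∈ = trans (cong term (sideTerm-index π comp (top-∈ P) add))
      (cong₂ _,_ (trans (cong (ℚ._* sgnN (proj₁ (index L (top P) α)) (proj₂ (index L (top P) α)))
        (ℚ.*-identityʳ (weight π L))) (trans (sym (weight-∷ π comp (top-∈ P) add)) (weight-↭ π e)))
        (markedWord-cong P V
          (λ {s} s∈ → trans (sym (poly-other π comp (top-∈ P) add (others P s∈)
            (others-≢ P (AllPairs.map proj₁ comp) s∈))) (poly-↭ π e s))
          (cong₂ (λ x y → monomial (x ∷ y ∷ [])) (poly-↭ π e (top P)) (poly-↭ π e (just α)))))
      where
      add = proj₂ (∈-filter⁻ (addable? L (top P)) {xs = arrows N} α∈)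
      e : α ∷ L ↭ P ʳ++ α ∷ V
      e = ↭-sym (ʳ++-insert P α V)

  D₂-B-≋ : D₂ (B π) ≈ᴮ map pairTerm inserted
  D₂-B-≋ = ≈-trans (≡⇒≋ (trans D₂-B (map-singletons boundaryTerm marked)))
    (≈-trans (concatMap-≋ marked boundary-≋)
      (≡⇒≋ (trans (concatMap-cong (λ s → map-∘ {g = pairTerm} {f = mark s} (additions s)) (marked {N}))
        (sym (map-concatMap pairTerm (λ s → map (mark s) (additions s)) (marked {N}))))))
    where
    mark : List (Arrow N) × List (Arrow N) → Arrow N → Triple
    mark s α = proj₁ s , α , proj₂ s

  D₁-B-≋ : D₁ (B π) ≈ᴮ map wedgeTerm inserted
  D₁-B-≋ = ≈-trans (≡⇒≋ D₁-B) (≈-trans (↭⇒≋ (Perm.map⁺ wedgeTerm adjacent-↭))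
    (≈-trans (≡⇒≋ (map-++ wedgeTerm inserted noncovering))
      (≈-trans (++-cong ≈-refl noncovering-≋) (≡⇒≋ (++-identityʳ _)))))

  B-closed : D₁ (B π) ++ D₂ (B π) ≈ᴮ []
  B-closed = ≈-trans (++-cong D₁-B-≋ D₂-B-≋) (cancel-≋ inserted λ {t} _ → ≈-trans
    (++-comm (wedgeTerm t ∷ []) (pairTerm t ∷ []))
    (≈-trans (≡⇒≋ (cong (λ q → pairTerm t ∷ (q , pairWord t) ∷ [])
        (trans (sym (ℚ.neg-distribʳ-* (pairWeight t) 1ℚ)) (cong ℚ.-_ (ℚ.*-identityʳ (pairWeight t))))))
      (opposite-≋ (pairWeight t) (pairWord t))))

  B-degree : All (λ (_ , w) → degree w ≡ 0) (B π)
  B-degree = subst (All _) (sym B-words)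
    (All.map⁺ (All.tabulate λ {L} _ → letters-degree L (nothing ∷ map just L)))
    where
    letters-degree : ∀ L rs → degree (letters L rs) ≡ 0
    letters-degree L [] = refl
    letters-degree L (r ∷ rs) = letters-degree L rs

proposition6p13 : (R : Set) (π : Polygon R) → IsCocycle 0 (B π)
proposition6p13 R π = (B π , ≈-refl , B-degree π) , B-closed π
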